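{- Let $n_1, n_2, \ldots, n_t$ be a sequence of sufficiently large integers, of which $t_e$ are even and $t_o$ are odd. Let $c=82\times 35^{2^{t_o}-2}\times 81^{t_e}$ and $n=\max(n_1,\dots,n_t)$, and suppose that for all $i$ we have $n_i\geq 2\lceil \log (nc) \rceil+2$. Then $$\hat{R}(C_{n_1},\ldots,C_{n_t})\leq (\ln c+1)\,c^2\, n.$$
   Context: $C_k$ denotes the cycle on $k$ vertices. For graphs $G_1,\ldots,G_k$, the size-Ramsey number $\hat{R}(G_1,\ldots,G_k)$ is the smallest integer $m$ for which there exists a graph $H$ with $m$ edges such that for every coloring of the edges of $H$ with colors $1,\ldots,k$ there is, for some $i$, a copy of $G_i$ in $H$ all of whose edges have color $i$. $\log$ denotes the logarithm to base $2$ and $\ln$ the natural logarithm. -}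

module Defs where

open import Data.Bool.Base using (Bool; false; T; not; _∧_; _∨_)
open import Data.Bool.Properties using (∨-comm)
open import Data.Fin.Base as Fin using (Fin; toℕ)
import Data.Fin.Properties as Fin
open import Data.Integer.Base as ℤ using (+_)
import Data.Integer.Properties as ℤ
open import Data.List.Base using (length; filterᵇ; cartesianProduct; allFin)
open import Data.Nat.Base as ℕ using (ℕ; zero; suc; _∸_; _≡ᵇ_; _<ᵇ_)
import Data.Nat.Properties as ℕ
open import Data.Nat.Divisibility using (_∣?_)
import Data.Nat.Logarithm as ℕ
import Data.Nat.Solver
open import Data.Product.Base using (Σ-syntax; ∃-syntax; _×_; _,_; uncurry)
open import Data.Rational.Base
import Data.Rational.Properties as ℚ
open import Data.Rational.Solver using (module +-*-Solver)
open import Data.Rational.Unnormalised.Base as ℚᵘ using (mkℚᵘ)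
import Data.Rational.Unnormalised.Properties as ℚᵘ
open import Data.Sum.Base using (inj₁; inj₂)
open import Data.Vec.Base using (Vec; count; foldr′)
open import Function.Base using (_∘_)
open import Function.Definitions using (Injective)
open import Relation.Nullary.Decidable using (does; yes; no; ¬?)
open import Relation.Nullary.Negation using (contradiction)
open import Relation.Binary.PropositionalEquality

------------------------------------------------------------------------
-- Finite simple graphs

record Graph : Set where
  field
    order       : ℕ
    adj         : Fin order → Fin order → Bool
    symmetric   : ∀ u v → adj u v ≡ adj v u
    irreflexive : ∀ u → adj u u ≡ false

  Vertex : Set
  Vertex = Fin order

  _~_ : Vertex → Vertex → Set
  u ~ v = T (adj u v)

  size : ℕ
  size = length (filterᵇ (uncurry λ u v → (toℕ u <ᵇ toℕ v) ∧ adj u v)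
                         (cartesianProduct (allFin order) (allFin order)))

-- Vertices i and i + 1 are consecutive, as are n - 1 and 0.  Loops are
-- removed (relevant only for n = 1); the result is the cycle C_n for n ≥ 3.

private
  next : ∀ {n} → Fin n → Fin n → Bool
  next {n} i j = (toℕ j ≡ᵇ suc (toℕ i))
               ∨ ((suc (toℕ i) ≡ᵇ n) ∧ (toℕ j ≡ᵇ 0))

  distinct : ∀ {n} → Fin n → Fin n → Bool
  distinct i j = not (does (i Fin.≟ j))

  distinct-sym : ∀ {n} (i j : Fin n) → distinct i j ≡ distinct j i
  distinct-sym i j with i Fin.≟ j | j Fin.≟ i
  ... | yes _   | yes _   = refl
  ... | no _    | no _    = refl
  ... | yes i≡j | no j≢i  = contradiction (sym i≡j) j≢i
  ... | no i≢j  | yes j≡i = contradiction (sym j≡i) i≢j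

  distinct-irrefl : ∀ {n} (i : Fin n) → distinct i i ≡ false
  distinct-irrefl i with i Fin.≟ i
  ... | yes _  = refl
  ... | no i≢i = contradiction refl i≢i

cycle : ℕ → Graph
cycle n = record
  { order       = n
  ; adj         = λ i j → distinct i j ∧ (next i j ∨ next j i)
  ; symmetric   = λ i j → cong₂ _∧_ (distinct-sym i j) (∨-comm (next i j) (next j i))
  ; irreflexive = λ i → cong (_∧ (next i i ∨ next i i)) (distinct-irrefl i)
  }

------------------------------------------------------------------------
-- Size-Ramsey numbers

record EdgeColouring (H : Graph) (t : ℕ) : Set where
  open Graph H
  field
    colour     : ∀ {u v} → u ~ v → Fin t
    colour-sym : ∀ {u v} (e : u ~ v) (e′ : v ~ u) → colour e ≡ colour e′

record MonochromaticCopy (G H : Graph) {t} (χ : EdgeColouring H t) (i : Fin t) : Set where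
  open Graph
  open EdgeColouring χ
  field
    φ             : Vertex G → Vertex H
    injective     : Injective _≡_ _≡_ φ
    homomorphism  : ∀ {u v} → _~_ G u v → _~_ H (φ u) (φ v)
    monochromatic : ∀ {u v} (e : _~_ G u v) → colour (homomorphism e) ≡ i

Arrows : ∀ {t} → Graph → (Fin t → Graph) → Set
Arrows {t} H Gs = (χ : EdgeColouring H t) → ∃[ i ] MonochromaticCopy (Gs i) H χ i

HasArrowingGraphOfSize : ∀ {t} → (Fin t → Graph) → ℕ → Set
HasArrowingGraphOfSize Gs m = Σ[ H ∈ Graph ] (Graph.size H ≡ m × Arrows H Gs)

IsSizeRamseyNumber : ∀ {t} → (Fin t → Graph) → ℕ → Set
IsSizeRamseyNumber Gs m =
  HasArrowingGraphOfSize Gs m × (∀ m′ → HasArrowingGraphOfSize Gs m′ → m ℕ.≤ m′)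

------------------------------------------------------------------------
-- Real numbers as Cauchy sequences of rationals

ι : ℕ → ℚ
ι n = + n / 1

record ℝ : Set where
  field
    seq    : ℕ → ℚ
    cauchy : ∀ ε → 0ℚ < ε →
             ∃[ N ] (∀ i j → N ℕ.≤ i → N ℕ.≤ j → ∣ seq i - seq j ∣ ≤ ε)

open ℝ

infix 4 _≤ᴿ_

_≤ᴿ_ : ℝ → ℝ → Set
x ≤ᴿ y = ∀ ε → 0ℚ < ε → ∃[ N ] (∀ k → N ℕ.≤ k → seq x k ≤ seq y k + ε)

private
  module _ where
    open +-*-Solver

    shift-eq : ∀ a b q → (a + q) - (b + q) ≡ a - b
    shift-eq = solve 3 (λ a b q → (a :+ q) :- (b :+ q) := a :- b) refl

    scale-eq : ∀ a b q → (a * q) - (b * q) ≡ (a - b) * q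
    scale-eq = solve 3 (λ a b q → (a :* q) :- (b :* q) := (a :- b) :* q) refl

    div-eq : ∀ e s q → (e * s) * q ≡ e * (s * q)
    div-eq = solve 3 (λ e s q → (e :* s) :* q := e :* (s :* q)) refl

fromℚ : ℚ → ℝ
fromℚ q = record
  { seq    = λ _ → q
  ; cauchy = λ ε 0<ε → 0 , λ _ _ _ _ →
      ℚ.≤-trans (ℚ.≤-reflexive (cong ∣_∣ (ℚ.+-inverseʳ q))) (ℚ.<⇒≤ 0<ε)
  }

infixl 6 _+ᴿ_
infixl 7 _*ᴿ_

_+ᴿ_ : ℝ → ℚ → ℝ
x +ᴿ q = record
  { seq    = λ k → seq x k + q
  ; cauchy = λ ε 0<ε → let N , h = cauchy x ε 0<ε in N , λ i j N≤i N≤j →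
      subst (λ d → ∣ d ∣ ≤ ε) (sym (shift-eq (seq x i) (seq x j) q)) (h i j N≤i N≤j)
  }

_*ᴿ_ : ℝ → ℚ → ℝ
x *ᴿ q = record
  { seq    = λ k → seq x k * q
  ; cauchy = λ ε 0<ε →
      let instance
            b>0 : Positive (1ℚ + ∣ q ∣)
            b>0 = ℚ.pos+nonNeg⇒pos 1ℚ ∣ q ∣ {{ℚ.∣-∣-nonNeg q}}
            b≢0 : NonZero (1ℚ + ∣ q ∣)
            b≢0 = ℚ.pos⇒nonZero (1ℚ + ∣ q ∣)
            s>0 : Positive (1/ (1ℚ + ∣ q ∣))
            s>0 = ℚ.1/pos⇒pos (1ℚ + ∣ q ∣)
            ε>0 : Positive ε
            ε>0 = positive 0<ε
            δ>0 : Positive (ε * 1/ (1ℚ + ∣ q ∣))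
            δ>0 = ℚ.pos*pos⇒pos ε (1/ (1ℚ + ∣ q ∣))
            δ≥0 : NonNegative (ε * 1/ (1ℚ + ∣ q ∣))
            δ≥0 = ℚ.pos⇒nonNeg (ε * 1/ (1ℚ + ∣ q ∣))
            q≥0 : NonNegative ∣ q ∣
            q≥0 = ℚ.∣-∣-nonNeg q
          b = 1ℚ + ∣ q ∣
          δ = ε * 1/ b
          N , h = cauchy x δ (ℚ.positive⁻¹ δ)
      in N , λ i j N≤i N≤j → let open ℚ.≤-Reasoning in begin
        ∣ seq x i * q - seq x j * q ∣   ≡⟨ cong ∣_∣ (scale-eq (seq x i) (seq x j) q) ⟩
        ∣ (seq x i - seq x j) * q ∣     ≡⟨ ℚ.∣p*q∣≡∣p∣*∣q∣ (seq x i - seq x j) q ⟩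
        ∣ seq x i - seq x j ∣ * ∣ q ∣   ≤⟨ ℚ.*-monoʳ-≤-nonNeg ∣ q ∣ (h i j N≤i N≤j) ⟩
        δ * ∣ q ∣                       ≡⟨ sym (ℚ.+-identityˡ (δ * ∣ q ∣)) ⟩
        0ℚ + δ * ∣ q ∣                  ≤⟨ ℚ.+-monoˡ-≤ (δ * ∣ q ∣) (ℚ.nonNegative⁻¹ δ) ⟩
        δ + δ * ∣ q ∣                   ≡⟨ cong (_+ δ * ∣ q ∣) (sym (ℚ.*-identityʳ δ)) ⟩
        δ * 1ℚ + δ * ∣ q ∣              ≡⟨ sym (ℚ.*-distribˡ-+ δ 1ℚ ∣ q ∣) ⟩
        δ * b                           ≡⟨ div-eq ε (1/ b) b ⟩
        ε * (1/ b * b)                  ≡⟨ cong (ε *_) (ℚ.*-inverseˡ b) ⟩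
        ε * 1ℚ                          ≡⟨ ℚ.*-identityʳ ε ⟩
        ε                               ∎
  }

------------------------------------------------------------------------
-- The natural logarithm, ln x = ∫₁ˣ du/u

Σ< : ℕ → (ℕ → ℚ) → ℚ
Σ< zero    f = 0ℚ
Σ< (suc k) f = Σ< k f + f k

private
  ι-toℚᵘ : ∀ n → toℚᵘ (ι n) ℚᵘ.≃ mkℚᵘ (+ n) 0
  ι-toℚᵘ n = ℚ.toℚᵘ-fromℚᵘ (mkℚᵘ (+ n) 0)

  ι-+ : ∀ m n → ι (m ℕ.+ n) ≡ ι m + ι n
  ι-+ m n = ℚ.toℚᵘ-injective (begin
    toℚᵘ (ι (m ℕ.+ n))              ≈⟨ ι-toℚᵘ (m ℕ.+ n) ⟩
    mkℚᵘ (+ (m ℕ.+ n)) 0            ≈⟨ ℚᵘ.*≡* (cong (ℤ._* + 1) (cong₂ ℤ._+_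
                                         (sym (ℤ.*-identityʳ (+ m))) (sym (ℤ.*-identityʳ (+ n))))) ⟩
    mkℚᵘ (+ m) 0 ℚᵘ.+ mkℚᵘ (+ n) 0  ≈⟨ ℚᵘ.+-cong (ι-toℚᵘ m) (ι-toℚᵘ n) ⟨
    toℚᵘ (ι m) ℚᵘ.+ toℚᵘ (ι n)      ≈⟨ ℚ.toℚᵘ-homo-+ (ι m) (ι n) ⟨
    toℚᵘ (ι m + ι n)                ∎)
    where open ℚᵘ.≃-Reasoning

  ι-* : ∀ m n → ι (m ℕ.* n) ≡ ι m * ι n
  ι-* m n = ℚ.toℚᵘ-injective (begin
    toℚᵘ (ι (m ℕ.* n))              ≈⟨ ι-toℚᵘ (m ℕ.* n) ⟩
    mkℚᵘ (+ (m ℕ.* n)) 0            ≈⟨ ℚᵘ.*≡* (cong (ℤ._* + 1) (ℤ.pos-* m n)) ⟩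
    mkℚᵘ (+ m) 0 ℚᵘ.* mkℚᵘ (+ n) 0  ≈⟨ ℚᵘ.*-cong (ι-toℚᵘ m) (ι-toℚᵘ n) ⟨
    toℚᵘ (ι m) ℚᵘ.* toℚᵘ (ι n)      ≈⟨ ℚ.toℚᵘ-homo-* (ι m) (ι n) ⟨
    toℚᵘ (ι m * ι n)                ∎)
    where open ℚᵘ.≃-Reasoning

  ι≥0 : ∀ n → NonNegative (ι n)
  ι≥0 n = ℚ.normalize-nonNeg n 1

  ι>0 : ∀ n .{{_ : ℕ.NonZero n}} → Positive (ι n)
  ι>0 n = ℚ.normalize-pos n 1

  ι-mono : ∀ {m n} → m ℕ.≤ n → ι m ≤ ι n
  ι-mono {m} {n} m≤n = begin
    ι m              ≡⟨ sym (ℚ.+-identityʳ (ι m)) ⟩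
    ι m + 0ℚ         ≤⟨ ℚ.+-monoʳ-≤ (ι m) (ℚ.nonNegative⁻¹ (ι (n ∸ m)) {{ι≥0 (n ∸ m)}}) ⟩
    ι m + ι (n ∸ m)  ≡⟨ sym (ι-+ m (n ∸ m)) ⟩
    ι (m ℕ.+ (n ∸ m)) ≡⟨ cong ι (ℕ.m+[n∸m]≡n m≤n) ⟩
    ι n              ∎
    where open ℚ.≤-Reasoning

  ι-archimedean : ∀ q → ∃[ n ] q ≤ ι n
  ι-archimedean q@(mkℚ n d-1 _) = ℤ.∣ n ∣ , ℚ.toℚᵘ-cancel-≤ (begin
    toℚᵘ q            ≤⟨ ℚᵘ.*≤* bound ⟩
    mkℚᵘ (+ ℤ.∣ n ∣) 0 ≃⟨ ι-toℚᵘ ℤ.∣ n ∣ ⟨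
    toℚᵘ (ι ℤ.∣ n ∣)   ∎)
    where
    open ℚᵘ.≤-Reasoning
    n≤∣n∣ : ∀ n → n ℤ.≤ + ℤ.∣ n ∣
    n≤∣n∣ (+ n)      = ℤ.≤-refl
    n≤∣n∣ (ℤ.-[1+ n ]) = ℤ.-≤+
    bound : n ℤ.* + 1 ℤ.≤ + ℤ.∣ n ∣ ℤ.* + suc d-1
    bound = ℤ.≤-trans (ℤ.≤-reflexive (ℤ.*-identityʳ n)) (ℤ.≤-trans (n≤∣n∣ n)
      (ℤ.≤-trans (ℤ.+≤+ (ℕ.m≤m*n ℤ.∣ n ∣ (suc d-1)))
                 (ℤ.≤-reflexive (ℤ.pos-* ℤ.∣ n ∣ (suc d-1)))))

-- The right-endpoint Riemann sum for the partition of [1, x] (of [x, 1]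
-- when x < 1) into k equal parts has the summands
-- (x-1)/k · 1/(1 + j(x-1)/k) = (x-1)/((k-j) + jx), here with j = i + 1.

private
  D : ℚ → ℕ → ℕ → ℚ
  D x a b = ι a + ι b * x

  D-pos : ∀ x .{{_ : Positive x}} a b .{{_ : ℕ.NonZero b}} → Positive (D x a b)
  D-pos x a b = ℚ.nonNeg+pos⇒pos (ι a) {{ι≥0 a}} (ι b * x)
    {{ℚ.pos*pos⇒pos (ι b) {{ι>0 b}} x}}

riemannTerm : (x : ℚ) .{{_ : Positive x}} → ℕ → ℕ → ℚ
riemannTerm x k i =
  ((x - 1ℚ) ÷ denominator) {{ℚ.pos⇒nonZero denominator {{D-pos x (k ∸ suc i) (suc i)}}}}
  where
  denominator : ℚ
  denominator = ι (k ∸ suc i) + ι (suc i) * x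

riemannSum : (x : ℚ) .{{_ : Positive x}} → ℕ → ℚ
riemannSum x k = Σ< k (riemannTerm x k)

private
  Σ<-mono : ∀ k {f g : ℕ → ℚ} → (∀ i → i ℕ.< k → f i ≤ g i) → Σ< k f ≤ Σ< k g
  Σ<-mono zero    h = ℚ.≤-refl
  Σ<-mono (suc k) h = ℚ.+-mono-≤ (Σ<-mono k λ i i<k → h i (ℕ.m<n⇒m<1+n i<k)) (h k ℕ.≤-refl)

  Σ<-cong : ∀ k {f g : ℕ → ℚ} → (∀ i → f i ≡ g i) → Σ< k f ≡ Σ< k g
  Σ<-cong zero    h = refl
  Σ<-cong (suc k) h = cong₂ _+_ (Σ<-cong k h) (h k)

  Σ<-+ : ∀ m n f → Σ< (m ℕ.+ n) f ≡ Σ< m f + Σ< n (λ i → f (m ℕ.+ i))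
  Σ<-+ m zero f rewrite ℕ.+-identityʳ m = sym (ℚ.+-identityʳ (Σ< m f))
  Σ<-+ m (suc n) f rewrite ℕ.+-suc m n | Σ<-+ m n f = ℚ.+-assoc (Σ< m f) _ _

  Σ<-* : ∀ m n f → Σ< (m ℕ.* n) f ≡ Σ< m (λ j → Σ< n (λ s → f (j ℕ.* n ℕ.+ s)))
  Σ<-* zero    n f = refl
  Σ<-* (suc m) n f rewrite ℕ.+-comm n (m ℕ.* n) | Σ<-+ (m ℕ.* n) n f =
    cong (_+ Σ< n (λ s → f (m ℕ.* n ℕ.+ s))) (Σ<-* m n f)

  Σ<-scale : ∀ k f c → Σ< k (λ i → c * f i) ≡ c * Σ< k f
  Σ<-scale zero    f c = sym (ℚ.*-zeroʳ c)
  Σ<-scale (suc k) f c rewrite Σ<-scale k f c = sym (ℚ.*-distribˡ-+ c (Σ< k f) (f k))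

  Σ<-const : ∀ k c → Σ< k (λ _ → c) ≡ ι k * c
  Σ<-const zero    c = sym (ℚ.*-zeroˡ c)
  Σ<-const (suc k) c = begin
    Σ< k (λ _ → c) + c   ≡⟨ cong (_+ c) (Σ<-const k c) ⟩
    ι k * c + c          ≡⟨ cong (λ z → ι k * c + z) (sym (ℚ.*-identityˡ c)) ⟩
    ι k * c + 1ℚ * c     ≡⟨ sym (ℚ.*-distribʳ-+ c (ι k) 1ℚ) ⟩
    (ι k + ι 1) * c      ≡⟨ cong (_* c) (sym (ι-+ k 1)) ⟩
    ι (k ℕ.+ 1) * c      ≡⟨ cong (λ n → ι n * c) (ℕ.+-comm k 1) ⟩
    ι (suc k) * c        ∎
    where open ≡-Reasoning

  Σ<-shift : ∀ k f → Σ< k f + f k ≡ f 0 + Σ< k (f ∘ suc)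
  Σ<-shift zero    f = ℚ.+-comm 0ℚ (f 0)
  Σ<-shift (suc k) f rewrite Σ<-shift k f = ℚ.+-assoc (f 0) _ _

  frac : (d P : ℚ) .{{_ : Positive P}} → ℚ
  frac d P = (d ÷ P) {{ℚ.pos⇒nonZero P}}

  module _ (d : ℚ) {P Q : ℚ} .{{P>0 : Positive P}} .{{Q>0 : Positive Q}} (l w : ℕ) where
    private
      instance
        _ : NonZero P
        _ = ℚ.pos⇒nonZero P
        _ : NonZero Q
        _ = ℚ.pos⇒nonZero Q

      p q : ℚ
      p = 1/ P
      q = 1/ Q

      square≥0 : ∀ r → NonNegative (r * r)
      square≥0 r with ℚ.≤-total 0ℚ r
      ... | inj₁ 0≤r = ℚ.nonNeg*nonNeg⇒nonNeg r {{nonNegative 0≤r}} r {{nonNegative 0≤r}}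
      ... | inj₂ r≤0 = ℚ.nonPos*nonPos⇒nonPos r {{nonPositive r≤0}} r {{nonPositive r≤0}}

      excess : ℚ
      excess = (d * d) * (ι w * (p * q))

      0≤excess : 0ℚ ≤ excess
      0≤excess = ℚ.nonNegative⁻¹ _
        {{ℚ.nonNeg*nonNeg⇒nonNeg (d * d) {{square≥0 d}} (ι w * (p * q))
          {{ℚ.nonNeg*nonNeg⇒nonNeg (ι w) {{ι≥0 w}} (p * q)
            {{ℚ.pos⇒nonNeg (p * q)
              {{ℚ.pos*pos⇒pos p {{ℚ.1/pos⇒pos P}} q {{ℚ.1/pos⇒pos Q}}}}}}}}}}

      from-difference : ∀ a b → b ≡ a + excess → a ≤ b
      from-difference a b eq = begin
        a           ≡⟨ sym (ℚ.+-identityʳ a) ⟩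
        a + 0ℚ      ≤⟨ ℚ.+-monoʳ-≤ a 0≤excess ⟩
        a + excess  ≡⟨ sym eq ⟩
        b           ∎
        where open ℚ.≤-Reasoning

      open +-*-Solver

      lem₁ : ∀ d p Q q → (d * p) * (Q * q) ≡ (d * (p * q)) * Q
      lem₁ = solve 4 (λ d p Q q → (d :* p) :* (Q :* q) := (d :* (p :* q)) :* Q) refl

      lem₂ : ∀ d p q l P w → (d * (p * q)) * (l * P + d * w)
                           ≡ (l * (d * q)) * (P * p) + (d * d) * (w * (p * q))
      lem₂ = solve 6 (λ d p q l P w → (d :* (p :* q)) :* (l :* P :+ d :* w)
                        := (l :* (d :* q)) :* (P :* p) :+ (d :* d) :* (w :* (p :* q))) refl

      lem₃ : ∀ d p q l P w Q → (l * (d * q)) * (P * p) ≡ (d * (p * q)) * (l * P)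
      lem₃ = solve 7 (λ d p q l P w Q → (l :* (d :* q)) :* (P :* p) := (d :* (p :* q)) :* (l :* P)) refl

      lem₄ : ∀ d p q Q w → (d * (p * q)) * (Q + d * w)
                         ≡ (d * p) * (Q * q) + (d * d) * (w * (p * q))
      lem₄ = solve 5 (λ d p q Q w → (d :* (p :* q)) :* (Q :+ d :* w)
                        := (d :* p) :* (Q :* q) :+ (d :* d) :* (w :* (p :* q))) refl

      unit : ∀ a R .{{_ : NonZero R}} → a * (R * 1/ R) ≡ a
      unit a R = trans (cong (a *_) (ℚ.*-inverseʳ R)) (ℚ.*-identityʳ a)

    frac-upper : ι l * P + d * ι w ≡ Q → ι l * frac d Q ≤ frac d P
    frac-upper eq = from-difference _ _ (begin
      d * p                                      ≡⟨ sym (unit (d * p) Q) ⟩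
      (d * p) * (Q * q)                          ≡⟨ lem₁ d p Q q ⟩
      (d * (p * q)) * Q                          ≡⟨ cong ((d * (p * q)) *_) (sym eq) ⟩
      (d * (p * q)) * (ι l * P + d * ι w)        ≡⟨ lem₂ d p q (ι l) P (ι w) ⟩
      (ι l * (d * q)) * (P * p) + excess         ≡⟨ cong (_+ excess) (unit (ι l * (d * q)) P) ⟩
      ι l * (d * q) + excess                     ∎)
      where open ≡-Reasoning

    frac-lower : Q + d * ι w ≡ ι l * P → frac d P ≤ ι l * frac d Q
    frac-lower eq = from-difference _ _ (begin
      ι l * (d * q)                              ≡⟨ sym (unit (ι l * (d * q)) P) ⟩
      (ι l * (d * q)) * (P * p)                  ≡⟨ lem₃ d p q (ι l) P (ι w) Q ⟩
      (d * (p * q)) * (ι l * P)                  ≡⟨ cong ((d * (p * q)) *_) (sym eq) ⟩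
      (d * (p * q)) * (Q + d * ι w)              ≡⟨ lem₄ d p q Q (ι w) ⟩
      (d * p) * (Q * q) + excess                 ≡⟨ cong (_+ excess) (unit (d * p) Q) ⟩
      d * p + excess                             ∎)
      where open ≡-Reasoning

  frac-cong : ∀ d {P Q} .{{_ : Positive P}} .{{_ : Positive Q}} → P ≡ Q → frac d P ≡ frac d Q
  frac-cong d refl = refl

  module _ (x : ℚ) .{{x>0 : Positive x}} where
    private
      d : ℚ
      d = x - 1ℚ

      D-pos′ : ∀ a b .{{_ : ℕ.NonZero a}} → Positive (D x a b)
      D-pos′ a b = ℚ.pos+nonNeg⇒pos (ι a) {{ι>0 a}} (ι b * x)
        {{ℚ.nonNeg*nonNeg⇒nonNeg (ι b) {{ι≥0 b}} x {{ℚ.pos⇒nonNeg x}}}}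

      -- the summand for the j-th partition point, including the left endpoint
      e : ∀ k .{{_ : ℕ.NonZero k}} → ℕ → ℚ
      e k zero    = frac d (D x k 0) {{D-pos′ k 0}}
      e k (suc j) = riemannTerm x k j

      gap : ∀ k .{{_ : ℕ.NonZero k}} → ℚ
      gap k = e k 0 - e k k

      module _ (a r j s : ℕ) where
        open +-*-Solver

        ι-affine : ∀ m n p → ι (m ℕ.* n ℕ.+ p) ≡ ι m * ι n + ι p
        ι-affine m n p = trans (ι-+ (m ℕ.* n) p) (cong (_+ ι p) (ι-* m n))

        lower-alg : ∀ a r j s x → let l = r + (1ℚ + s) in
          ((a * l + r) + (j * l + (1ℚ + s)) * x) + (x - 1ℚ) * r
            ≡ l * (a + (1ℚ + j) * x)
        lower-alg = solve 5 (λ a r j s x → let one = con 1ℚ; l = r :+ (one :+ s) in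
          ((a :* l :+ r) :+ (j :* l :+ (one :+ s)) :* x) :+ (x :- one) :* r
            := l :* (a :+ (one :+ j) :* x)) refl

        upper-alg : ∀ a r j s x → let l = r + (1ℚ + s) in
          l * ((1ℚ + a) + j * x) + (x - 1ℚ) * (1ℚ + s)
            ≡ (a * l + r) + (j * l + (1ℚ + s)) * x
        upper-alg = solve 5 (λ a r j s x → let one = con 1ℚ; l = r :+ (one :+ s) in
          l :* ((one :+ a) :+ j :* x) :+ (x :- one) :* (one :+ s)
            := (a :* l :+ r) :+ (j :* l :+ (one :+ s)) :* x) refl

        fine : ℚ
        fine = D x (a ℕ.* (r ℕ.+ suc s) ℕ.+ r) (j ℕ.* (r ℕ.+ suc s) ℕ.+ suc s)

        l-eq : ι (r ℕ.+ suc s) ≡ ι r + (1ℚ + ι s)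
        l-eq = trans (ι-+ r (suc s)) (cong (λ z → ι r + z) (ι-+ 1 s))

        fine-eq : let l = ι r + (1ℚ + ι s) in
          fine ≡ (ι a * l + ι r) + (ι j * l + (1ℚ + ι s)) * x
        fine-eq = cong₂ (λ y z → y + z * x)
          (trans (ι-affine a _ r) (cong (λ z → ι a * z + ι r) l-eq))
          (trans (ι-affine j _ (suc s)) (cong₂ (λ y z → ι j * y + z) l-eq (ι-+ 1 s)))

        lower-eq : fine + d * ι r ≡ ι (r ℕ.+ suc s) * D x a (suc j)
        lower-eq = trans (cong (_+ d * ι r) fine-eq)
          (trans (lower-alg (ι a) (ι r) (ι j) (ι s) x)
                 (sym (cong₂ (λ y z → y * (ι a + z * x)) l-eq (ι-+ 1 j))))

        upper-eq : ι (r ℕ.+ suc s) * D x (suc a) j + d * ι (suc s) ≡ fine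
        upper-eq = trans (cong₂ (λ y z → y + d * z)
            (cong₂ (λ y z → y * (z + ι j * x)) l-eq (ι-+ 1 a)) (ι-+ 1 s))
          (trans (upper-alg (ι a) (ι r) (ι j) (ι s) x) (sym fine-eq))

        fine>0 : Positive fine
        fine>0 = D-pos x (a ℕ.* (r ℕ.+ suc s) ℕ.+ r) (j ℕ.* (r ℕ.+ suc s) ℕ.+ suc s)
          {{subst ℕ.NonZero (sym (ℕ.+-suc (j ℕ.* (r ℕ.+ suc s)) s)) _}}

        lower : frac d (D x a (suc j)) {{D-pos x a (suc j)}}
              ≤ ι (r ℕ.+ suc s) * frac d fine {{fine>0}}
        lower = frac-lower d {{D-pos x a (suc j)}} {{fine>0}} (r ℕ.+ suc s) r lower-eq

        upper : ι (r ℕ.+ suc s) * frac d fine {{fine>0}}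
              ≤ frac d (D x (suc a) j) {{D-pos′ (suc a) j}}
        upper = frac-upper d {{D-pos′ (suc a) j}} {{fine>0}} (r ℕ.+ suc s) (suc s) upper-eq

        index-eq : (a ℕ.+ suc j) ℕ.* (r ℕ.+ suc s) ∸ suc (j ℕ.* (r ℕ.+ suc s) ℕ.+ s)
                 ≡ a ℕ.* (r ℕ.+ suc s) ℕ.+ r
        index-eq = trans (cong (_∸ suc (j ℕ.* (r ℕ.+ suc s) ℕ.+ s)) (split a r j s))
                         (ℕ.m+n∸n≡m (a ℕ.* (r ℕ.+ suc s) ℕ.+ r) (suc (j ℕ.* (r ℕ.+ suc s) ℕ.+ s)))
          where
          open Data.Nat.Solver.+-*-Solver using () renaming
            (solve to solveℕ; _:+_ to _:+ℕ_; _:*_ to _:*ℕ_; _:=_ to _:=ℕ_; con to conℕ)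
          split : ∀ a r j s → (a ℕ.+ suc j) ℕ.* (r ℕ.+ suc s)
                ≡ (a ℕ.* (r ℕ.+ suc s) ℕ.+ r) ℕ.+ suc (j ℕ.* (r ℕ.+ suc s) ℕ.+ s)
          split = solveℕ 4 (λ a r j s → let l = r :+ℕ (conℕ 1 :+ℕ s) in
            (a :+ℕ (conℕ 1 :+ℕ j)) :*ℕ l
              :=ℕ (a :*ℕ l :+ℕ r) :+ℕ (conℕ 1 :+ℕ (j :*ℕ l :+ℕ s))) refl

        term-eq : riemannTerm x ((a ℕ.+ suc j) ℕ.* (r ℕ.+ suc s)) (j ℕ.* (r ℕ.+ suc s) ℕ.+ s)
                ≡ frac d fine {{fine>0}}
        term-eq = frac-cong d
          {{D-pos x ((a ℕ.+ suc j) ℕ.* (r ℕ.+ suc s) ∸ suc (j ℕ.* (r ℕ.+ suc s) ℕ.+ s))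
                    (suc (j ℕ.* (r ℕ.+ suc s) ℕ.+ s))}} {{fine>0}}
          (cong₂ (D x) index-eq (sym (ℕ.+-suc (j ℕ.* (r ℕ.+ suc s)) s)))

      module _ (k l : ℕ) .{{_ : ℕ.NonZero k}} .{{_ : ℕ.NonZero l}} where
        f : ℕ → ℕ → ℚ
        f j s = riemannTerm x (k ℕ.* l) (j ℕ.* l ℕ.+ s)

        f-eq : ∀ {j s} → j ℕ.< k → s ℕ.< l →
               (f j s ≡ frac d (fine (k ∸ suc j) (l ∸ suc s) j s)
                          {{fine>0 (k ∸ suc j) (l ∸ suc s) j s}})
        f-eq {j} {s} j<k s<l = trans
          (cong₂ (λ k l → riemannTerm x (k ℕ.* l) (j ℕ.* l ℕ.+ s))
            (sym (ℕ.m∸n+n≡m j<k)) (sym (ℕ.m∸n+n≡m s<l)))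
          (term-eq (k ∸ suc j) (l ∸ suc s) j s)

        e-eq : ∀ {j} → j ℕ.< k →
               e k j ≡ frac d (D x (suc (k ∸ suc j)) j) {{D-pos′ (suc (k ∸ suc j)) j}}
        e-eq {zero} 0<k = frac-cong d {{D-pos′ k 0}} {{D-pos′ (suc (k ∸ 1)) 0}}
          (cong (λ n → D x n 0) (ℕ.+-∸-assoc 1 0<k))
        e-eq {suc j} j<k = frac-cong d {{D-pos x (k ∸ suc j) (suc j)}} {{D-pos′ (suc (k ∸ suc (suc j))) (suc j)}}
          (cong (λ n → D x n (suc j)) (ℕ.+-∸-assoc 1 j<k))

        f-lower : ∀ {j s} → j ℕ.< k → s ℕ.< l → riemannTerm x k j ≤ ι l * f j s
        f-lower {j} {s} j<k s<l = ℚ.≤-trans (lower (k ∸ suc j) (l ∸ suc s) j s)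
          (ℚ.≤-reflexive (cong₂ (λ n z → ι n * z) (ℕ.m∸n+n≡m s<l) (sym (f-eq j<k s<l))))

        f-upper : ∀ {j s} → j ℕ.< k → s ℕ.< l → ι l * f j s ≤ e k j
        f-upper {j} {s} j<k s<l = ℚ.≤-trans
          (ℚ.≤-reflexive (cong₂ (λ n z → ι n * z) (sym (ℕ.m∸n+n≡m s<l)) (f-eq j<k s<l)))
          (ℚ.≤-trans (upper (k ∸ suc j) (l ∸ suc s) j s) (ℚ.≤-reflexive (sym (e-eq j<k))))

        block-lower : ∀ j → j ℕ.< k → riemannTerm x k j ≤ Σ< l (f j)
        block-lower j j<k = ℚ.*-cancelˡ-≤-pos (ι l) {{ι>0 l}} (begin
          ι l * riemannTerm x k j           ≡⟨ sym (Σ<-const l (riemannTerm x k j)) ⟩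
          Σ< l (λ _ → riemannTerm x k j)    ≤⟨ Σ<-mono l (λ s s<l → f-lower j<k s<l) ⟩
          Σ< l (λ s → ι l * f j s)          ≡⟨ Σ<-scale l (f j) (ι l) ⟩
          ι l * Σ< l (f j)                  ∎)
          where open ℚ.≤-Reasoning

        block-upper : ∀ j → j ℕ.< k → Σ< l (f j) ≤ e k j
        block-upper j j<k = ℚ.*-cancelˡ-≤-pos (ι l) {{ι>0 l}} (begin
          ι l * Σ< l (f j)                  ≡⟨ sym (Σ<-scale l (f j) (ι l)) ⟩
          Σ< l (λ s → ι l * f j s)          ≤⟨ Σ<-mono l (λ s s<l → f-upper j<k s<l) ⟩
          Σ< l (λ _ → e k j)                ≡⟨ Σ<-const l (e k j) ⟩
          ι l * e k j                       ∎)
          where open ℚ.≤-Reasoning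

        refine-lower : riemannSum x k ≤ riemannSum x (k ℕ.* l)
        refine-lower = ℚ.≤-trans (Σ<-mono k block-lower)
          (ℚ.≤-reflexive (sym (Σ<-* k l (riemannTerm x (k ℕ.* l)))))

        telescope : Σ< k (e k) ≡ riemannSum x k + gap k
        telescope = begin
          Σ< k (e k)                              ≡⟨ add-sub (Σ< k (e k)) (e k k) ⟩
          (Σ< k (e k) + e k k) - e k k            ≡⟨ cong (_- e k k) (Σ<-shift k (e k)) ⟩
          (e k 0 + riemannSum x k) - e k k        ≡⟨ regroup (e k 0) (riemannSum x k) (e k k) ⟩
          riemannSum x k + gap k                  ∎
          where
          open ≡-Reasoning
          open +-*-Solver
          add-sub : ∀ a b → a ≡ (a + b) - b
          add-sub = solve 2 (λ a b → a := (a :+ b) :- b) refl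
          regroup : ∀ a b c → (a + b) - c ≡ b + (a - c)
          regroup = solve 3 (λ a b c → (a :+ b) :- c := b :+ (a :- c)) refl

        refine-upper : riemannSum x (k ℕ.* l) ≤ riemannSum x k + gap k
        refine-upper = ℚ.≤-trans (ℚ.≤-reflexive (Σ<-* k l (riemannTerm x (k ℕ.* l))))
          (ℚ.≤-trans (Σ<-mono k block-upper) (ℚ.≤-reflexive telescope))

      module _ (k : ℕ) .{{_ : ℕ.NonZero k}} where
        instance
          k≢0 : NonZero (ι k)
          k≢0 = ℚ.pos⇒nonZero (ι k) {{ι>0 k}}
          x≢0 : NonZero x
          x≢0 = ℚ.pos⇒nonZero x
          kx>0 : Positive (ι k * x)
          kx>0 = ℚ.pos*pos⇒pos (ι k) {{ι>0 k}} x
          k0>0 : Positive (D x k 0)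
          k0>0 = D-pos′ k 0
          0k>0 : Positive (D x 0 k)
          0k>0 = D-pos x 0 k

        scale-frac : ∀ e P c .{{_ : Positive P}} → c * P ≡ ι k * x → (ι k * x) * frac e P ≡ c * e
        scale-frac e P c eq = begin
          (ι k * x) * (e * p)  ≡⟨ cong (_* (e * p)) (sym eq) ⟩
          (c * P) * (e * p)    ≡⟨ solve 4 (λ c P e p → (c :* P) :* (e :* p) := (c :* e) :* (P :* p))
                                    refl c P e p ⟩
          (c * e) * (P * p)    ≡⟨ cong ((c * e) *_) (ℚ.*-inverseʳ P) ⟩
          (c * e) * 1ℚ         ≡⟨ ℚ.*-identityʳ (c * e) ⟩
          c * e                ∎
          where
          open ≡-Reasoning
          open +-*-Solver
          instance
            P≢0 : NonZero P
            P≢0 = ℚ.pos⇒nonZero P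
          p : ℚ
          p = 1/ P

        last-eq : e k k ≡ frac d (D x 0 k)
        last-eq = go k
          where
          go : ∀ k .{{_ : ℕ.NonZero k}} → e k k ≡ frac d (D x 0 k) {{D-pos x 0 k}}
          go (suc k) = frac-cong d {{D-pos x (k ∸ k) (suc k)}} {{D-pos x 0 (suc k)}}
            (cong (λ n → D x n (suc k)) (ℕ.n∸n≡0 k))

        gap-eq : (ι k * x) * gap k ≡ d * d
        gap-eq = begin
          (ι k * x) * (e k 0 - e k k)
            ≡⟨ cong (λ z → (ι k * x) * (e k 0 - z)) last-eq ⟩
          (ι k * x) * (frac d (D x k 0) - frac d (D x 0 k))
            ≡⟨ solve 3 (λ a b c → a :* (b :- c) := a :* b :- a :* c) refl
                 (ι k * x) (frac d (D x k 0)) (frac d (D x 0 k)) ⟩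
          (ι k * x) * frac d (D x k 0) - (ι k * x) * frac d (D x 0 k)
            ≡⟨ cong₂ _-_
                 (scale-frac d (D x k 0) x
                   (solve 2 (λ x k → x :* (k :+ con 0ℚ :* x) := k :* x) refl x (ι k)))
                 (scale-frac d (D x 0 k) 1ℚ
                   (solve 2 (λ x k → con 1ℚ :* (con 0ℚ :+ k :* x) := k :* x) refl x (ι k))) ⟩
          x * d - 1ℚ * d
            ≡⟨ solve 1 (λ x → x :* (x :- con 1ℚ) :- con 1ℚ :* (x :- con 1ℚ)
                           := (x :- con 1ℚ) :* (x :- con 1ℚ)) refl x ⟩
          d * d ∎
          where
          open ≡-Reasoning
          open +-*-Solver

        gap-bound : ∀ ε → d * d ≤ (ι k * x) * ε → gap k ≤ ε
        gap-bound ε h = ℚ.*-cancelˡ-≤-pos (ι k * x) (ℚ.≤-trans (ℚ.≤-reflexive gap-eq) h)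

      threshold : ∀ ε → 0ℚ < ε → ∃[ N ] d * d ≤ (ι N * x) * ε
      threshold ε 0<ε = let N , h = ι-archimedean (d * d * y) in N , (begin
        d * d                  ≡⟨ sym (ℚ.*-identityʳ (d * d)) ⟩
        d * d * 1ℚ             ≡⟨ cong (d * d *_) (sym (ℚ.*-inverseˡ (x * ε))) ⟩
        d * d * (y * (x * ε))  ≡⟨ sym (ℚ.*-assoc (d * d) y (x * ε)) ⟩
        d * d * y * (x * ε)    ≤⟨ ℚ.*-monoʳ-≤-nonNeg (x * ε) h ⟩
        ι N * (x * ε)          ≡⟨ sym (ℚ.*-assoc (ι N) x ε) ⟩
        ι N * x * ε            ∎)
        where
        open ℚ.≤-Reasoning
        instance
          xε>0 : Positive (x * ε)
          xε>0 = ℚ.pos*pos⇒pos x ε {{positive 0<ε}}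
          xε≥0 : NonNegative (x * ε)
          xε≥0 = ℚ.pos⇒nonNeg (x * ε)
          xε≢0 : NonZero (x * ε)
          xε≢0 = ℚ.pos⇒nonZero (x * ε)
        y : ℚ
        y = 1/ (x * ε)

    riemannSum-cauchy : ∀ ε → 0ℚ < ε →
      ∃[ N ] (∀ i j → N ℕ.≤ i → N ℕ.≤ j → ∣ riemannSum x i - riemannSum x j ∣ ≤ ε)
    riemannSum-cauchy ε 0<ε = let N , h = threshold ε 0<ε in suc N , λ i j N<i N<j →
      abs-bound (R i) (R j) (half N h i j N<i N<j) (half N h j i N<j N<i)
      where
      R : ℕ → ℚ
      R = riemannSum x

      small : ∀ N → d * d ≤ (ι N * x) * ε → ∀ k .{{_ : ℕ.NonZero k}} → N ℕ.< k → gap k ≤ ε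
      small N h k N<k = gap-bound k ε (ℚ.≤-trans h
        (ℚ.*-monoʳ-≤-nonNeg ε {{nonNegative (ℚ.<⇒≤ 0<ε)}}
          (ℚ.*-monoʳ-≤-nonNeg x {{ℚ.pos⇒nonNeg x}} (ι-mono (ℕ.<⇒≤ N<k)))))

      half : ∀ N → d * d ≤ (ι N * x) * ε → ∀ i j → N ℕ.< i → N ℕ.< j → R i - R j ≤ ε
      half N h i@(suc _) j@(suc _) N<i N<j = begin
        R i - R j              ≤⟨ ℚ.+-monoˡ-≤ (- R j) (refine-lower i j) ⟩
        R (i ℕ.* j) - R j      ≡⟨ cong (λ n → R n - R j) (ℕ.*-comm i j) ⟩
        R (j ℕ.* i) - R j      ≤⟨ ℚ.+-monoˡ-≤ (- R j) (refine-upper j i) ⟩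
        (R j + gap j) - R j    ≡⟨ solve 2 (λ a b → (a :+ b) :- a := b) refl (R j) (gap j) ⟩
        gap j                  ≤⟨ small N h j N<j ⟩
        ε                      ∎
        where
        open ℚ.≤-Reasoning
        open +-*-Solver

      abs-bound : ∀ a b → a - b ≤ ε → b - a ≤ ε → ∣ a - b ∣ ≤ ε
      abs-bound a b h₁ h₂ with ℚ.∣p∣≡p∨∣p∣≡-p (a - b)
      ... | inj₁ eq = ℚ.≤-trans (ℚ.≤-reflexive eq) h₁
      ... | inj₂ eq = ℚ.≤-trans (ℚ.≤-reflexive (trans eq
              (solve 2 (λ a b → :- (a :- b) := b :- a) refl a b))) h₂
        where open +-*-Solver

ln : (x : ℚ) .{{_ : Positive x}} → ℝ
ln x = record { seq = riemannSum x ; cauchy = riemannSum-cauchy x }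

------------------------------------------------------------------------
-- The constants of the theorem

-- Valid for q ≥ 1: for such q and k : ℕ one has log₂ q ≤ k iff q ≤ 2 ^ k,
-- and since 2 ^ k is an integer this is equivalent to ⌈ q ⌉ ≤ 2 ^ k.

⌈log₂_⌉ : ℚ → ℕ
⌈log₂ q ⌉ = ℕ.⌈log₂ ℤ.∣ ceiling q ∣ ⌉

-- 82 · 35 ^ (2 ^ tₒ - 2) · 81 ^ tₑ.  It is rational rather than natural
-- because the exponent of 35 is -1 when tₒ = 0.

ramseyConstant : (tₒ tₑ : ℕ) → ℚ
ramseyConstant tₒ tₑ = + (82 ℕ.* 35 ℕ.^ (2 ℕ.^ tₒ) ℕ.* 81 ℕ.^ tₑ) / (35 ℕ.^ 2)

ramseyConstant>0 : ∀ tₒ tₑ → Positive (ramseyConstant tₒ tₑ)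
ramseyConstant>0 tₒ tₑ =
  ℚ.normalize-pos (82 ℕ.* 35 ℕ.^ (2 ℕ.^ tₒ) ℕ.* 81 ℕ.^ tₑ) (35 ℕ.^ 2) {{_}}
    {{ℕ.m*n≢0 (82 ℕ.* 35 ℕ.^ (2 ℕ.^ tₒ)) (81 ℕ.^ tₑ)
      {{ℕ.m*n≢0 82 (35 ℕ.^ (2 ℕ.^ tₒ)) {{_}} {{ℕ.m^n≢0 35 (2 ℕ.^ tₒ)}}}}
      {{ℕ.m^n≢0 81 tₑ}}}}

maximum : ∀ {t} → Vec ℕ t → ℕ
maximum = foldr′ ℕ._⊔_ 0

#even #odd : ∀ {t} → Vec ℕ t → ℕ
#even = count (2 ∣?_)
#odd  = count (λ n → ¬? (2 ∣? n))

{-# OPTIONS --safe #-}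
-- Call two vertex sets m-joined in a colour if that colour has an edge between any m vertices of
-- one and any m vertices of the other.  If a graph of one colour contains suitable m-joined pairs
-- of sets, each of size at least 13 m or 21 m, then it contains a cycle of every prescribed length
-- ℓ ≤ m that is at least logarithmic (for a bipartite pair: of every even such length): after few
-- vertices are discarded, small sets expand by a factor 3, so trees of logarithmic depth grow from
-- the two ends of a path found by depth-first search, and an edge joins their leaves.  Hence, in a
-- colouring without the required cycles, colour after colour can be eliminated between two sets
-- whose sizes drop by a constant factor per even colour, while an odd colour turns a factor F into
-- 13 F².  With a n vertices at the start, a = oddFactor tₒ * 21 ^ tₑ, two sets of n vertices
-- without any edge between them would remain.  A greedily chosen graph with a² (e + 2) n edges,
-- where a ≤ 2 ^ e ≤ c, has no such pair, and a² (e + 2) ≤ (ln c + 1) c² because 5 c² ≥ 12 a² and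
-- ln c ≥ 9 e / 20.

module Submission where

-- The cycle length can be prescribed exactly because all branches of a tree are equally long: the
-- layer at depth `j` is cut down to exactly `2 ^ j` vertices, so two trees of depth `r` and a path
-- with `k` edges give `2 r + 3 + k` vertices, and `k` absorbs the rest. The factor 3 makes the
-- layers double: of the neighbours of a layer of `s` vertices fewer than `s` are already used, and
-- `2 s` new ones remain. A set that must contain an expanding core needs `8 m` vertices. A side of
-- the path needs `5 m`: up to `2 m` are deleted because they see no core, and the search works in
-- `3 m`. Hence 13 = 5 + 8 and 21 = 5 + 8 + 8. Two definitions shape the rest. The size-Ramsey
-- number has to be exhibited as a minimum, which takes a decision procedure for arrowing and a
-- bound on the number of vertices worth considering. The logarithm is a sequence of Riemann sums,
-- so its lower bound is proved for every sufficiently fine sum.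

open import Defs

-- A lower bound for the natural logarithm

module LogarithmBound where

  open import Data.Integer.Base as ℤ using (ℤ; +_)
  import Data.Integer.DivMod as ℤ
  import Data.Integer.Properties as ℤ
  open import Data.Nat.Base as ℕ using (ℕ; zero; suc; s≤s; z≤n)
  import Data.Nat.Properties as ℕ
  open import Data.Product.Base using (_,_)
  open import Data.Rational.Base
  import Data.Rational.Properties as ℚ
  open import Data.Rational.Solver using (module +-*-Solver)
  open import Data.Rational.Unnormalised.Base as ℚᵘ using (mkℚᵘ)
  import Data.Rational.Unnormalised.Properties as ℚᵘ
  open import Data.Sum.Base using ([_,_]′)
  open import Relation.Binary.PropositionalEquality
  open import Relation.Nullary.Decidable using (yes; no; from-yes)
  open import Relation.Nullary.Negation using (contradiction)

  -- Rational inequalities and the embedding of the natural numbers.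

  0≤*  : ∀ {p q} → 0ℚ ≤ p → 0ℚ ≤ q → 0ℚ ≤ p * q
  0≤* {p} {q} 0≤p 0≤q = ℚ.nonNegative⁻¹ (p * q) {{ℚ.nonNeg*nonNeg⇒nonNeg p {{nonNegative 0≤p}} q {{nonNegative 0≤q}}}}

  0≤+  : ∀ {p q} → 0ℚ ≤ p → 0ℚ ≤ q → 0ℚ ≤ p + q
  0≤+ 0≤p 0≤q = ℚ.+-mono-≤ 0≤p 0≤q

  0≤- : ∀ {p q} → p ≤ q → 0ℚ ≤ q - p
  0≤- {p} {q} p≤q = subst (_≤ q - p) (ℚ.+-inverseʳ p) (ℚ.+-monoˡ-≤ (- p) p≤q)

  -- Most inequalities below are proved by naming the difference `e` in a visibly nonnegative form
  -- and leaving the identity to the ring solver.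
  ≤-by : ∀ {p q e} → 0ℚ ≤ e → q ≡ p + e → p ≤ q
  ≤-by {p} {q} {e} 0≤e q≡p+e = begin
    p       ≡⟨ ℚ.+-identityʳ p ⟨
    p + 0ℚ  ≤⟨ ℚ.+-monoʳ-≤ p 0≤e ⟩
    p + e   ≡⟨ q≡p+e ⟨
    q       ∎
    where open ℚ.≤-Reasoning

  ι-toℚᵘ : ∀ n → toℚᵘ (ι n) ℚᵘ.≃ mkℚᵘ (+ n) 0
  ι-toℚᵘ n = ℚ.toℚᵘ-fromℚᵘ (mkℚᵘ (+ n) 0)

  ι-homo-+ : ∀ m n → ι (m ℕ.+ n) ≡ ι m + ι n
  ι-homo-+ m n = ℚ.toℚᵘ-injective (ℚᵘ.≃-trans (ι-toℚᵘ (m ℕ.+ n)) (ℚᵘ.≃-trans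
    (ℚᵘ.*≡* (cong (ℤ._* + 1) (sym (cong₂ ℤ._+_ (ℤ.*-identityʳ (+ m)) (ℤ.*-identityʳ (+ n))))))
    (ℚᵘ.≃-sym (ℚᵘ.≃-trans (ℚ.toℚᵘ-homo-+ (ι m) (ι n)) (ℚᵘ.+-cong (ι-toℚᵘ m) (ι-toℚᵘ n))))))

  ι-homo-* : ∀ m n → ι (m ℕ.* n) ≡ ι m * ι n
  ι-homo-* m n = ℚ.toℚᵘ-injective (ℚᵘ.≃-trans (ι-toℚᵘ (m ℕ.* n)) (ℚᵘ.≃-trans
    (ℚᵘ.*≡* (cong (ℤ._* + 1) (ℤ.pos-* m n)))
    (ℚᵘ.≃-sym (ℚᵘ.≃-trans (ℚ.toℚᵘ-homo-* (ι m) (ι n)) (ℚᵘ.*-cong (ι-toℚᵘ m) (ι-toℚᵘ n))))))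

  ι-mono-≤ : ∀ {m n} → m ℕ.≤ n → ι m ≤ ι n
  ι-mono-≤ {m} {n} m≤n = ℚ.toℚᵘ-cancel-≤ (ℚᵘ.≤-respʳ-≃ (ℚᵘ.≃-sym (ι-toℚᵘ n)) (ℚᵘ.≤-respˡ-≃ (ℚᵘ.≃-sym (ι-toℚᵘ m))
    (ℚᵘ.*≤* (ℤ.*-monoʳ-≤-nonNeg (+ 1) (ℤ.+≤+ m≤n)))))

  0≤ι : ∀ n → 0ℚ ≤ ι n
  0≤ι n = ι-mono-≤ {0} {n} z≤n

  ι-cancel-/ : ∀ X d .{{_ : ℕ.NonZero d}} → (+ X / d) * ι d ≡ ι X
  ι-cancel-/ X (suc d-1) = ℚ.toℚᵘ-injective (ℚᵘ.≃-trans (ℚ.toℚᵘ-homo-* (+ X / suc d-1) (ι (suc d-1))) (ℚᵘ.≃-trans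
    (ℚᵘ.*-cong (ℚ.toℚᵘ-fromℚᵘ (mkℚᵘ (+ X) d-1)) (ι-toℚᵘ (suc d-1))) (ℚᵘ.≃-trans
    (ℚᵘ.*≡* (trans (ℤ.*-assoc (+ X) (+ suc d-1) (+ 1)) (cong (λ e → + X ℤ.* e) (sym (ℤ.pos-* (suc d-1) 1)))))
    (ℚᵘ.≃-sym (ι-toℚᵘ X)))))

  floor-≤ : ∀ p → floor p ℤ.* ↧ p ℤ.≤ ↥ p
  floor-≤ p@record{} = ℤ.[n/d]*d≤n (↥ p) (↧ p)

  ι-≤-ceiling : ∀ v q → ι v ≤ q → v ℕ.≤ ℤ.∣ ceiling q ∣
  ι-≤-ceiling v q@record{} v≤q = ≤-∣∣ (ℤ.neg-cancel-≤ (subst (ℤ._≤ ℤ.- (+ v)) (sym (ℤ.neg-involutive (floor (- q)))) f≤-v))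
    where
    ≤-∣∣ : ∀ {v i} → + v ℤ.≤ i → v ℕ.≤ ℤ.∣ i ∣
    ≤-∣∣ (ℤ.+≤+ v≤) = v≤
    v*d≤n : + v ℤ.* ↧ q ℤ.≤ ↥ q
    v*d≤n = subst (+ v ℤ.* ↧ q ℤ.≤_) (ℤ.*-identityʳ (↥ q))
      (ℚᵘ.drop-*≤* (ℚᵘ.≤-respˡ-≃ (ι-toℚᵘ v) (ℚ.toℚᵘ-mono-≤ v≤q)))
    f≤-v : floor (- q) ℤ.≤ ℤ.- (+ v)
    f≤-v = ℤ.*-cancelʳ-≤-pos (floor (- q)) (ℤ.- (+ v)) (↧ q) (begin
      floor (- q) ℤ.* ↧ q        ≡⟨ cong (floor (- q) ℤ.*_) (ℚ.↧-neg q) ⟨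
      floor (- q) ℤ.* ↧ (- q)    ≤⟨ floor-≤ (- q) ⟩
      ↥ (- q)                    ≡⟨ ℚ.↥-neg q ⟩
      ℤ.- (↥ q)                  ≤⟨ ℤ.neg-mono-≤ v*d≤n ⟩
      ℤ.- (+ v ℤ.* ↧ q)          ≡⟨ ℤ.neg-distribˡ-* (+ v) (↧ q) ⟩
      ℤ.- (+ v) ℤ.* ↧ q          ∎)
      where open ℤ.≤-Reasoning

  -- Each term t = d / D i satisfies D (i - 1) = D i (1 - t).  The terms are grouped greedily into
  -- blocks of sum r ≤ 1/2; by Π (1 - t) ≥ 1 - Σ t ≥ 1/2 a block at most doubles D, and a closed
  -- block has sum at least 1/2 - 1/20 = 9/20.

  9/20 : ℚ
  9/20 = + 9 / 20

  -- `K` is the initial denominator, `D` the current one and `S` the sum so far. With `B` closed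
  -- blocks and an open block of sum `r`, the denominator is at most `2 ^ B * K / (1 - r)`.
  record Blocks (K D S : ℚ) : Set where
    constructor blocks
    field
      B   : ℕ
      r   : ℚ
      0≤r : 0ℚ ≤ r
      r≤½ : r ≤ ½
      D≤  : D * (1ℚ - r) ≤ ι (2 ℕ.^ B) * K
      S≥  : ι B * 9/20 + r ≤ S

  module _ {K D S d t : ℚ} (0≤K : 0ℚ ≤ K) (0≤D : 0ℚ ≤ D) (0≤d : 0ℚ ≤ d) (0≤t : 0ℚ ≤ t)
           (t≤1/20 : t ≤ ½ - 9/20) (t-eq : (D + d) * t ≡ d) where

    open +-*-Solver

    Blocks-step : Blocks K D S → Blocks K (D + d) (S + t)
    Blocks-step (blocks B r 0≤r r≤½ D≤ S≥) with (r + t) ℚ.≤? ½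
    -- The block stays open. Since `(D + d) * t = d`, one has
    -- `(D + d) (1 - r - t) = D (1 - r) - d r`, so the bound even gains `d r`.
    ... | yes r+t≤½ = record
      { B = B ; r = r + t ; 0≤r = 0≤+ 0≤r 0≤t ; r≤½ = r+t≤½
      ; D≤ = ≤-by (0≤+ (0≤- D≤) (0≤* 0≤d 0≤r)) (begin
          P
            ≡⟨ solve 4 (λ D d r p → p := (D :* (con 1ℚ :- r) :- d :* r) :+ ((p :- D :* (con 1ℚ :- r)) :+ d :* r)) refl D d r P ⟩
          (D * (1ℚ - r) - d * r) + ((P - D * (1ℚ - r)) + d * r)
            ≡⟨ cong (_+ ((P - D * (1ℚ - r)) + d * r)) (begin
              D * (1ℚ - r) - d * r           ≡⟨ solve 3 (λ D d r → D :* (con 1ℚ :- r) :- d :* r := (D :+ d) :* (con 1ℚ :- r) :- d) refl D d r ⟩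
              (D + d) * (1ℚ - r) - d         ≡⟨ cong (λ z → (D + d) * (1ℚ - r) - z) t-eq ⟨
              (D + d) * (1ℚ - r) - (D + d) * t ≡⟨ solve 3 (λ E r t → E :* (con 1ℚ :- r) :- E :* t := E :* (con 1ℚ :- (r :+ t))) refl (D + d) r t ⟩
              (D + d) * (1ℚ - (r + t))       ∎) ⟩
          (D + d) * (1ℚ - (r + t)) + ((P - D * (1ℚ - r)) + d * r) ∎)
      ; S≥ = subst (_≤ S + t) (ℚ.+-assoc (ι B * 9/20) r t) (ℚ.+-monoˡ-≤ t S≥)
      }
      where
      open ≡-Reasoning
      P = ι (2 ℕ.^ B) * K
    -- The block is closed and `t` opens the next one. From `r ≤ ½` follows `D ≤ 2 D (1 - r)`, one
    -- more factor 2, while `(D + d) (1 - t) = D`; and `r > ½ - t` is at least 9/20.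
    ... | no r+t≰½ = record
      { B = suc B ; r = t ; 0≤r = 0≤t ; r≤½ = ℚ.≤-trans t≤1/20 (ℚ.≤ᵇ⇒≤ _)
      ; D≤ = ≤-by (0≤+ (0≤+ (0≤- D≤) (0≤- D≤)) (0≤* 0≤D (0≤+ (0≤- r≤½) (0≤- r≤½)))) (begin
          ι (2 ℕ.^ suc B) * K
            ≡⟨ cong (_* K) (ι-homo-* 2 (2 ℕ.^ B)) ⟩
          ι 2 * ι (2 ℕ.^ B) * K
            ≡⟨ solve 5 (λ D d r p k → con (ι 2) :* p :* k
                := ((D :+ d) :- d) :+ (((p :* k :- D :* (con 1ℚ :- r)) :+ (p :* k :- D :* (con 1ℚ :- r))) :+ D :* ((con ½ :- r) :+ (con ½ :- r))))
                 refl D d r (ι (2 ℕ.^ B)) K ⟩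
          ((D + d) - d) + excess
            ≡⟨ cong (λ z → ((D + d) - z) + excess) t-eq ⟨
          ((D + d) - (D + d) * t) + excess
            ≡⟨ cong (_+ excess) (solve 2 (λ E t → E :- E :* t := E :* (con 1ℚ :- t)) refl (D + d) t) ⟩
          (D + d) * (1ℚ - t) + excess ∎)
      ; S≥ = ℚ.+-monoˡ-≤ t closed
      }
      where
      open ≡-Reasoning
      excess = ((ι (2 ℕ.^ B) * K - D * (1ℚ - r)) + (ι (2 ℕ.^ B) * K - D * (1ℚ - r))) + D * ((½ - r) + (½ - r))
      9/20≤r : 9/20 ≤ r
      9/20≤r = ≤-by (0≤+ (0≤- (ℚ.<⇒≤ (ℚ.≰⇒> r+t≰½))) (0≤- t≤1/20))
        (solve 2 (λ r t → r := con 9/20 :+ (((r :+ t) :- con ½) :+ ((con ½ :- con 9/20) :- t))) refl r t)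
      closed : ι (suc B) * 9/20 ≤ S
      closed = ℚ.≤-trans (≤-by (0≤- 9/20≤r) (trans
        (solve 2 (λ b r → b :* con 9/20 :+ r := (con 1ℚ :+ b) :* con 9/20 :+ (r :- con 9/20)) refl (ι B) r)
        (cong (λ z → z * 9/20 + (r - 9/20)) (sym (ι-homo-+ 1 B))))) S≥

  -- The denominators of the Riemann sum in the form in which they visibly grow by `x - 1`, from
  -- `ι k` to `ι k * x`.
  E : (x : ℚ) (k i : ℕ) → ℚ
  E x k i = ι k + ι i * (x - 1ℚ)

  module _ (x : ℚ) .{{_ : Positive x}} (k : ℕ) (0<k : 0ℚ < ι k) (1≤x : 1ℚ ≤ x) (fine : x - 1ℚ ≤ ι k * (½ - 9/20)) where

    open +-*-Solver
    private
      d = x - 1ℚ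

      0≤d : 0ℚ ≤ d
      0≤d = 0≤- 1≤x

      k≤E : ∀ i → ι k ≤ E x k i
      k≤E i = ≤-by (0≤* (0≤ι i) 0≤d) refl

      E>0 : ∀ i → Positive (E x k i)
      E>0 i = positive (ℚ.<-≤-trans 0<k (k≤E i))

      E-suc : ∀ i → E x k (suc i) ≡ E x k i + d
      E-suc i = trans (cong (λ z → ι k + z * d) (ι-homo-+ 1 i))
        (solve 3 (λ K i d → K :+ (con 1ℚ :+ i) :* d := (K :+ i :* d) :+ d) refl (ι k) (ι i) d)

      E-denominator : ∀ i → i ℕ.≤ k → E x k i ≡ ι (k ℕ.∸ i) + ι i * x
      E-denominator i i≤k = trans
        (cong (λ z → z + ι i * d) (trans (cong ι (sym (ℕ.m∸n+n≡m i≤k))) (ι-homo-+ (k ℕ.∸ i) i)))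
        (solve 3 (λ a i x → (a :+ i) :+ i :* (x :- con 1ℚ) := a :+ i :* x) refl (ι (k ℕ.∸ i)) (ι i) x)

      ÷-cancel : ∀ p q .{{_ : NonZero q}} → q * (p ÷ q) ≡ p
      ÷-cancel p q = trans (solve 3 (λ p q r → q :* (p :* r) := p :* (q :* r)) refl p q (1/ q))
        (trans (cong (p *_) (ℚ.*-inverseʳ q)) (ℚ.*-identityʳ p))

      term-eq : ∀ i → i ℕ.< k → E x k (suc i) * riemannTerm x k i ≡ d
      term-eq i i<k = trans (cong (_* riemannTerm x k i) (E-denominator (suc i) i<k))
        (÷-cancel d (ι (k ℕ.∸ suc i) + ι (suc i) * x)
          {{ℚ.pos⇒nonZero (ι (k ℕ.∸ suc i) + ι (suc i) * x) {{subst Positive (E-denominator (suc i) i<k) (E>0 (suc i))}}}})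

      0≤term : ∀ i → i ℕ.< k → 0ℚ ≤ riemannTerm x k i
      0≤term i i<k = ℚ.*-cancelˡ-≤-pos (E x k (suc i)) {{E>0 (suc i)}}
        (subst₂ _≤_ (sym (ℚ.*-zeroʳ (E x k (suc i)))) (sym (term-eq i i<k)) 0≤d)

      term≤ : ∀ i → i ℕ.< k → riemannTerm x k i ≤ ½ - 9/20
      term≤ i i<k = ℚ.*-cancelˡ-≤-pos (E x k (suc i)) {{E>0 (suc i)}}
        (subst (_≤ E x k (suc i) * (½ - 9/20)) (sym (term-eq i i<k))
          (ℚ.≤-trans fine (ℚ.*-monoʳ-≤-nonNeg (½ - 9/20) (k≤E (suc i)))))

      all-blocks : ∀ i → i ℕ.≤ k → Blocks (ι k) (E x k i) (Σ< i (riemannTerm x k))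
      all-blocks zero _ = record
        { B = 0 ; r = 0ℚ ; 0≤r = ℚ.≤-refl ; r≤½ = ℚ.≤ᵇ⇒≤ _
        ; D≤ = ℚ.≤-reflexive (solve 2 (λ K d → (K :+ con 0ℚ :* d) :* (con 1ℚ :- con 0ℚ) := con 1ℚ :* K) refl (ι k) d)
        ; S≥ = ℚ.≤ᵇ⇒≤ _ }
      all-blocks (suc i) i<k = subst (λ D → Blocks (ι k) D (Σ< (suc i) (riemannTerm x k))) (sym (E-suc i))
        (Blocks-step (0≤ι k) (ℚ.≤-trans (0≤ι k) (k≤E i)) 0≤d (0≤term i i<k) (term≤ i i<k)
          (trans (cong (_* riemannTerm x k i) (sym (E-suc i))) (term-eq i i<k)) (all-blocks i (ℕ.<⇒≤ i<k)))

    -- The last denominator is `ι k * x`, hence `x (1 - r) ≤ 2 ^ B`. If `e > B`, then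
    -- `2 ^ (e - B) ≤ 1 / (1 - r) ≤ 2`, so at most one block is missing; in that case `r ≥ ½`, and
    -- the open block replaces it.
    riemannSum-≥ : ∀ e → ι (2 ℕ.^ e) ≤ x → ι e * 9/20 ≤ riemannSum x k
    riemannSum-≥ e 2^e≤x = ℚ.≤-trans e≤B+r S≥
      where
      open Blocks (all-blocks k ℕ.≤-refl)

      0≤1-r : 0ℚ ≤ 1ℚ - r
      0≤1-r = ℚ.≤-trans (ℚ.≤ᵇ⇒≤ _) (ℚ.+-monoʳ-≤ 1ℚ (ℚ.neg-antimono-≤ r≤½))

      x[1-r]≤2^B : x * (1ℚ - r) ≤ ι (2 ℕ.^ B)
      x[1-r]≤2^B = ℚ.*-cancelˡ-≤-pos (ι k) {{positive 0<k}} (subst₂ _≤_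
        (solve 3 (λ k x r → (k :+ k :* (x :- con 1ℚ)) :* (con 1ℚ :- r) := k :* (x :* (con 1ℚ :- r))) refl (ι k) x r)
        (ℚ.*-comm (ι (2 ℕ.^ B)) (ι k)) D≤)

      2^j[1-r]≤1 : ∀ j → B ℕ.+ j ≡ e → ι (2 ℕ.^ j) * (1ℚ - r) ≤ 1ℚ
      2^j[1-r]≤1 j refl = ℚ.*-cancelˡ-≤-pos (ι (2 ℕ.^ B))
        {{positive (ℚ.<-≤-trans (from-yes (0ℚ ℚ.<? 1ℚ)) (ι-mono-≤ {1} {2 ℕ.^ B} (ℕ.m^n>0 2 B)))}} (begin
          ι (2 ℕ.^ B) * (ι (2 ℕ.^ j) * (1ℚ - r))  ≡⟨ ℚ.*-assoc (ι (2 ℕ.^ B)) (ι (2 ℕ.^ j)) (1ℚ - r) ⟨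
          ι (2 ℕ.^ B) * ι (2 ℕ.^ j) * (1ℚ - r)    ≡⟨ cong (_* (1ℚ - r)) (trans (cong ι (ℕ.^-distribˡ-+-* 2 B j)) (ι-homo-* (2 ℕ.^ B) (2 ℕ.^ j))) ⟨
          ι (2 ℕ.^ (B ℕ.+ j)) * (1ℚ - r)          ≤⟨ ℚ.*-monoʳ-≤-nonNeg (1ℚ - r) {{nonNegative 0≤1-r}} 2^e≤x ⟩
          x * (1ℚ - r)                            ≤⟨ x[1-r]≤2^B ⟩
          ι (2 ℕ.^ B)                             ≡⟨ ℚ.*-identityʳ (ι (2 ℕ.^ B)) ⟨
          ι (2 ℕ.^ B) * 1ℚ                        ∎)
        where open ℚ.≤-Reasoning

      missing : ∀ j → ι (2 ℕ.^ j) * (1ℚ - r) ≤ 1ℚ → ι j * 9/20 ≤ r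
      missing zero    h = 0≤r
      missing (suc zero) h = ≤-by {e = (½ - 9/20) + ½ * (1ℚ - ι 2 * (1ℚ - r))} (0≤+ {½ - 9/20} {½ * (1ℚ - ι 2 * (1ℚ - r))} (ℚ.≤ᵇ⇒≤ _) (0≤* {½} (ℚ.≤ᵇ⇒≤ _) (0≤- h)))
        (solve 1 (λ r → r := con 1ℚ :* con 9/20 :+ ((con ½ :- con 9/20) :+ con ½ :* (con 1ℚ :- con (ι 2) :* (con 1ℚ :- r)))) refl r)
      missing (suc (suc j)) h = contradiction (begin-strict
        1ℚ                                  <⟨ from-yes (1ℚ ℚ.<? ι 4 * ½) ⟩
        ι 4 * ½                             ≤⟨ ℚ.*-monoˡ-≤-nonNeg (ι 4) (ℚ.+-monoʳ-≤ 1ℚ (ℚ.neg-antimono-≤ r≤½)) ⟩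
        ι 4 * (1ℚ - r)                      ≤⟨ ℚ.*-monoʳ-≤-nonNeg (1ℚ - r) {{nonNegative 0≤1-r}}
                                                (ι-mono-≤ {4} {2 ℕ.^ suc (suc j)} (ℕ.^-monoʳ-≤ 2 (s≤s (s≤s (z≤n {j}))))) ⟩
        ι (2 ℕ.^ suc (suc j)) * (1ℚ - r)    ≤⟨ h ⟩
        1ℚ                                  ∎) (ℚ.<-irrefl refl)
        where open ℚ.≤-Reasoning

      e≤B+r : ι e * 9/20 ≤ ι B * 9/20 + r
      e≤B+r = [ below , above ]′ (ℕ.≤-total e B)
        where
        below : e ℕ.≤ B → ι e * 9/20 ≤ ι B * 9/20 + r
        below e≤B = ℚ.≤-trans (ℚ.*-monoʳ-≤-nonNeg 9/20 (ι-mono-≤ {e} {B} e≤B)) (≤-by 0≤r refl)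
        above : B ℕ.≤ e → ι e * 9/20 ≤ ι B * 9/20 + r
        above B≤e =
          let j , eq = ℕ.m≤n⇒∃[o]m+o≡n B≤e
          in ℚ.≤-trans (ℚ.≤-reflexive (trans (cong (λ e → ι e * 9/20) (sym eq))
                         (trans (cong (_* 9/20) (ι-homo-+ B j)) (ℚ.*-distribʳ-+ 9/20 (ι B) (ι j)))))
               (ℚ.+-monoʳ-≤ (ι B * 9/20) (missing j (2^j[1-r]≤1 j eq)))

  -- The order on `ℝ` only concerns late members of the sequence; beyond `20 * X` parts every
  -- summand is at most 1/20, as the block argument requires.
  ln-bound : ∀ c .{{_ : Positive c}} X e a n {m} → c ≤ ι X → ι (2 ℕ.^ e) ≤ c → ι 12 * (ι a * ι a) ≤ ι 5 * (c * c) →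
             m ℕ.≤ a ℕ.* a ℕ.* (e ℕ.+ 2) ℕ.* n → fromℚ (ι m) ≤ᴿ (ln c +ᴿ 1ℚ) *ᴿ (c * c * ι n)
  ln-bound c X e a n {m} c≤X 2^e≤c 12a²≤5c² m≤ ε 0<ε = suc (20 ℕ.* X) , λ k N<k →
    let 0<k = ℚ.<-≤-trans (from-yes (0ℚ ℚ.<? 1ℚ)) (ι-mono-≤ {1} {k} (ℕ.≤-trans (s≤s z≤n) N<k))
        S≥ = riemannSum-≥ c k 0<k 1≤c (fine k (ℕ.<⇒≤ N<k)) e 2^e≤c
    in ℚ.≤-trans (bound (riemannSum c k) S≥) (≤-by (ℚ.<⇒≤ 0<ε) refl)
    where
    open +-*-Solver

    1≤c : 1ℚ ≤ c
    1≤c = ℚ.≤-trans (ι-mono-≤ {1} {2 ℕ.^ e} (ℕ.m^n>0 2 e)) 2^e≤c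

    0≤c : 0ℚ ≤ c
    0≤c = ℚ.≤-trans (ℚ.≤ᵇ⇒≤ _) 1≤c

    fine : ∀ k → 20 ℕ.* X ℕ.≤ k → c - 1ℚ ≤ ι k * (½ - 9/20)
    fine k N≤k = begin
      c - 1ℚ                            ≤⟨ ≤-by {e = 1ℚ} (ℚ.≤ᵇ⇒≤ _) (solve 1 (λ c → c := (c :- con 1ℚ) :+ con 1ℚ) refl c) ⟩
      c                                 ≤⟨ c≤X ⟩
      ι X                               ≡⟨ solve 1 (λ x → x := con (ι 20) :* x :* (con ½ :- con 9/20)) refl (ι X) ⟩
      ι 20 * ι X * (½ - 9/20)           ≡⟨ cong (_* (½ - 9/20)) (ι-homo-* 20 X) ⟨
      ι (20 ℕ.* X) * (½ - 9/20)         ≤⟨ ℚ.*-monoʳ-≤-nonNeg (½ - 9/20) (ι-mono-≤ {20 ℕ.* X} {k} N≤k) ⟩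
      ι k * (½ - 9/20)                  ∎
      where open ℚ.≤-Reasoning

    bound : ∀ S → ι e * 9/20 ≤ S → ι m ≤ (S + 1ℚ) * (c * c * ι n)
    bound S S≥ = begin
      ι m                                        ≤⟨ ι-mono-≤ {m} {a ℕ.* a ℕ.* (e ℕ.+ 2) ℕ.* n} m≤ ⟩
      ι (a ℕ.* a ℕ.* (e ℕ.+ 2) ℕ.* n)            ≡⟨ ι-homo-* (a ℕ.* a ℕ.* (e ℕ.+ 2)) n ⟩
      ι (a ℕ.* a ℕ.* (e ℕ.+ 2)) * ι n            ≡⟨ cong (_* ι n) (trans (ι-homo-* (a ℕ.* a) (e ℕ.+ 2)) (cong₂ _*_ (ι-homo-* a a) (ι-homo-+ e 2))) ⟩
      -- With `S ≥ 9 e / 20` and `c² ≥ 12 a² / 5` the numbers are (9 e / 20 + 1) 12 / 5 = (e + 2) +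
      -- (2 e / 25 + 2 / 5); the three summands of the excess are the losses in these three places.
      ι a * ι a * (ι e + ι 2) * ι n              ≤⟨ ≤-by excess≥0 (solve 5 (λ S c n a e →
          (S :+ con 1ℚ) :* (c :* c :* n)
            := a :* a :* (e :+ con (ι 2)) :* n
             :+ ((S :- e :* con 9/20) :* (c :* c :* n)
             :+ (((e :* con 9/20 :+ con 1ℚ) :* (con (+ 1 / 5) :* (con (ι 5) :* (c :* c) :- con (ι 12) :* (a :* a))) :* n)
             :+ (e :* con (+ 2 / 25) :+ con (+ 2 / 5)) :* (a :* a) :* n))) refl S c (ι n) (ι a) (ι e)) ⟩
      (S + 1ℚ) * (c * c * ι n)                   ∎
      where
      open ℚ.≤-Reasoning
      excess≥0 : 0ℚ ≤ (S - ι e * 9/20) * (c * c * ι n)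
        + (((ι e * 9/20 + 1ℚ) * (+ 1 / 5 * (ι 5 * (c * c) - ι 12 * (ι a * ι a))) * ι n)
        + (ι e * (+ 2 / 25) + + 2 / 5) * (ι a * ι a) * ι n)
      excess≥0 = 0≤+ (0≤* (0≤- S≥) (0≤* (0≤* 0≤c 0≤c) (0≤ι n)))
        (0≤+ (0≤* (0≤* (0≤+ (0≤* (0≤ι e) (ℚ.≤ᵇ⇒≤ _)) (ℚ.≤ᵇ⇒≤ _)) (0≤* {+ 1 / 5} (ℚ.≤ᵇ⇒≤ _) (0≤- 12a²≤5c²))) (0≤ι n))
             (0≤* (0≤* (0≤+ {q = + 2 / 5} (0≤* {q = + 2 / 25} (0≤ι e) (ℚ.≤ᵇ⇒≤ _)) (ℚ.≤ᵇ⇒≤ _)) (0≤* (0≤ι a) (0≤ι a))) (0≤ι n)))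

open LogarithmBound using (0≤*; 0≤+; 0≤-; ≤-by; ι-homo-+; ι-homo-*; ι-mono-≤; 0≤ι; ι-cancel-/; ι-≤-ceiling; ln-bound)
open import Data.Nat using (ℕ; NonZero; _≤_; _+_; _*_)
open import Data.Product using (_×_; ∃-syntax)
open import Data.Rational as ℚ using (1ℚ)
open import Data.Vec using (Vec; lookup)
open import Data.Bool.Base using (Bool; true; false; not; _∧_; _∨_; if_then_else_)
open import Data.Bool.Properties using (∨-comm; T-∧; T-∨; T?; T-irrelevant)
open import Data.Fin.Base using (Fin; zero; suc; toℕ; fromℕ<; inject≤)
import Data.Fin.Properties as Fin
open import Data.Fin.Subset using (Subset; inside; outside; _∈_; _∉_; _⊆_; _∪_; _∩_; _─_; _-_; ⁅_⁆; ∣_∣; ⊤; ⊥)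
open import Data.Fin.Subset.Properties
open import Data.List.Base as List using (List; []; _∷_; _++_; length; reverse; take; filter; filterᵇ; cartesianProduct)
import Data.List.Membership.DecPropositional as List?
import Data.List.Membership.Propositional as List
import Data.List.Membership.Propositional.Properties as List∈
import Data.List.Properties as List
open import Data.List.Relation.Unary.All as All using (All; []; _∷_)
import Data.List.Relation.Unary.All.Properties as All
open import Data.List.Relation.Unary.AllPairs as AllPairs using ([]; _∷_)
open import Data.List.Relation.Unary.Any as Any using (Any; here; there; any?)
import Data.List.Relation.Unary.Any.Properties as Any
open import Data.List.Relation.Unary.Unique.Propositional using (Unique)
import Data.List.Relation.Unary.Unique.Propositional.Properties as Unique
open import Data.Nat.Base using (zero; suc; pred; _∸_; _^_; _<_; _<ᵇ_; _≡ᵇ_; ⌈_/2⌉; ⌊_/2⌋; z≤n; s≤s; s≤s⁻¹; >-nonZero)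
open import Data.Nat.Divisibility using (_∣_; _∣?_; divides; ∣m+n∣m⇒∣n; n∣m*n)
open import Data.Nat.Induction using (<-rec)
open import Data.Nat.ListAction using (sum)
open import Data.Nat.ListAction.Properties using (sum-++)
import Data.Nat.Logarithm as ℕ
import Data.Nat.Properties as ℕ
open import Data.Nat.Solver using (module +-*-Solver)
open import Data.Product.Base as Product using (_,_; proj₁; proj₂; uncurry)
open import Data.Product.Properties using (≡-dec)
open import Data.Rational.Base using (0ℚ; ℚ)
import Data.Integer.Base as ℤ
import Data.Rational.Properties as ℚ
import Data.Rational.Solver as ℚ
open import Data.Sum.Base as Sum using (_⊎_; inj₁; inj₂; [_,_]′; map₂)
open import Data.Vec.Base as Vec using ([]; _∷_; count; here; there)
import Data.Vec.Properties as Vec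
open import Data.Vec.Relation.Unary.All as VecAll using ([]; _∷_)
import Data.Vec.Relation.Unary.All.Properties as VecAll
open import Function.Base using (_∘_; id)
open import Function.Bundles using (Equivalence)
open import Level using (0ℓ)
open import Relation.Binary.Core using (Rel)
open import Relation.Binary.Definitions using (Symmetric; tri<; tri≈; tri>) renaming (Decidable to Decidable₂)
open import Relation.Binary.PropositionalEquality
open import Relation.Nullary.Decidable using (Dec; yes; no; does; dec-true; isYes; toWitness; fromWitness; ¬?; _×-dec_; _⊎-dec_; _→-dec_; map′; decidable-stable)
open import Relation.Nullary.Negation using (contradiction; ¬_)
open import Relation.Unary using (Decidable)
import Data.Empty as Empty

-- Finite sets

⟪_⟫ : ∀ {n} {P : Fin n → Set} → Decidable P → Subset n
⟪ P? ⟫ = Vec.tabulate (does ∘ P?)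

module _ {n} {P : Fin n → Set} (P? : Decidable P) where

  ∈⟪⟫⁺ : ∀ {x} → P x → x ∈ ⟪ P? ⟫
  ∈⟪⟫⁺ {x} px = Vec.lookup⇒[]= x ⟪ P? ⟫ (trans (Vec.lookup∘tabulate (does ∘ P?) x) (dec-true (P? x) px))

  ∈⟪⟫⁻ : ∀ {x} → x ∈ ⟪ P? ⟫ → P x
  ∈⟪⟫⁻ {x} x∈ with P? x in eq
  ... | yes px = px
  ... | no  _  = contradiction
    (trans (sym (Vec.[]=⇒lookup x∈)) (trans (Vec.lookup∘tabulate (does ∘ P?) x) (cong does eq))) λ ()

Disjoint : ∀ {n} → Subset n → Subset n → Set
Disjoint p q = ∀ {x} → x ∈ p → x ∉ q

∣p∪q∣+∣p∩q∣≡∣p∣+∣q∣ : ∀ {n} (p q : Subset n) → ∣ p ∪ q ∣ + ∣ p ∩ q ∣ ≡ ∣ p ∣ + ∣ q ∣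
∣p∪q∣+∣p∩q∣≡∣p∣+∣q∣ []            []            = refl
∣p∪q∣+∣p∩q∣≡∣p∣+∣q∣ (inside ∷ p)  (inside ∷ q)  = cong suc
  (trans (ℕ.+-suc _ _) (trans (cong suc (∣p∪q∣+∣p∩q∣≡∣p∣+∣q∣ p q)) (sym (ℕ.+-suc ∣ p ∣ ∣ q ∣))))
∣p∪q∣+∣p∩q∣≡∣p∣+∣q∣ (inside ∷ p)  (outside ∷ q) = cong suc (∣p∪q∣+∣p∩q∣≡∣p∣+∣q∣ p q)
∣p∪q∣+∣p∩q∣≡∣p∣+∣q∣ (outside ∷ p) (inside ∷ q)  =
  trans (cong suc (∣p∪q∣+∣p∩q∣≡∣p∣+∣q∣ p q)) (sym (ℕ.+-suc ∣ p ∣ ∣ q ∣))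
∣p∪q∣+∣p∩q∣≡∣p∣+∣q∣ (outside ∷ p) (outside ∷ q) = ∣p∪q∣+∣p∩q∣≡∣p∣+∣q∣ p q

∣p∪q∣≤∣p∣+∣q∣ : ∀ {n} (p q : Subset n) → ∣ p ∪ q ∣ ≤ ∣ p ∣ + ∣ q ∣
∣p∪q∣≤∣p∣+∣q∣ p q = ℕ.≤-trans (ℕ.m≤m+n _ _) (ℕ.≤-reflexive (∣p∪q∣+∣p∩q∣≡∣p∣+∣q∣ p q))

x∈p─q⇒x∉q : ∀ {n} {x} (p q : Subset n) → x ∈ p ─ q → x ∉ q
x∈p─q⇒x∉q (_ ∷ p) (inside ∷ q)  (there x∈) (there x∈q) = x∈p─q⇒x∉q p q x∈ x∈q
x∈p─q⇒x∉q (_ ∷ p) (outside ∷ q) (there x∈) (there x∈q) = x∈p─q⇒x∉q p q x∈ x∈q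

cover-size : ∀ {n} {p : Subset n} (q r : Subset n) →
             (∀ {x} → x ∈ p → x ∈ q ⊎ x ∈ r) → ∣ p ∣ ≤ ∣ q ∣ + ∣ r ∣
cover-size q r f = ℕ.≤-trans (p⊆q⇒∣p∣≤∣q∣ (x∈p∪q⁺ ∘ f)) (∣p∪q∣≤∣p∣+∣q∣ q r)

∣p∣≤∣q∣+∣p─q∣ : ∀ {n} (p q : Subset n) → ∣ p ∣ ≤ ∣ q ∣ + ∣ p ─ q ∣
∣p∣≤∣q∣+∣p─q∣ p q = cover-size q (p ─ q) split
  where
  split : ∀ {x} → x ∈ p → x ∈ q ⊎ x ∈ p ─ q
  split {x} x∈p with x ∈? q
  ... | yes x∈q = inj₁ x∈q
  ... | no  x∉q = inj₂ (x∈p∧x∉q⇒x∈p─q x∈p x∉q)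

Disjoint⇒∣p∣+∣q∣≤ : ∀ {n} {p q r : Subset n} → Disjoint p q → p ⊆ r → q ⊆ r → ∣ p ∣ + ∣ q ∣ ≤ ∣ r ∣
Disjoint⇒∣p∣+∣q∣≤ {n} {p}  {q} {r} dis p⊆r q⊆r = begin
  ∣ p ∣ + ∣ q ∣          ≡⟨ ∣p∪q∣+∣p∩q∣≡∣p∣+∣q∣ p q ⟨
  ∣ p ∪ q ∣ + ∣ p ∩ q ∣  ≡⟨ cong (∣ p ∪ q ∣ +_) p∩q≡0 ⟩
  ∣ p ∪ q ∣ + 0          ≡⟨ ℕ.+-identityʳ _ ⟩
  ∣ p ∪ q ∣              ≤⟨ p⊆q⇒∣p∣≤∣q∣ ([ p⊆r , q⊆r ]′ ∘ x∈p∪q⁻ p q) ⟩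
  ∣ r ∣                  ∎
  where
  open ℕ.≤-Reasoning
  p∩q≡0 : ∣ p ∩ q ∣ ≡ 0
  p∩q≡0 = trans (cong ∣_∣ (Empty-unique λ (x , x∈) →
    let x∈p , x∈q = x∈p∩q⁻ p q x∈ in dis x∈p x∈q)) (∣⊥∣≡0 n)

sub-of-size : ∀ {n} (p : Subset n) {k} → k ≤ ∣ p ∣ → ∃[ q ] (q ⊆ p × ∣ q ∣ ≡ k)
sub-of-size []            z≤n = [] , (λ x∈ → x∈) , refl
sub-of-size (outside ∷ p) k≤ = let q , q⊆p , eq = sub-of-size p k≤ in outside ∷ q , out⊆ q⊆p , eq
sub-of-size (inside ∷ p)  {zero} z≤n =
  let q , q⊆p , eq = sub-of-size p z≤n in outside ∷ q , out⊆ q⊆p , eq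
sub-of-size (inside ∷ p)  {suc k} (s≤s k≤) =
  let q , q⊆p , eq = sub-of-size p k≤ in inside ∷ q , in⊆in q⊆p , cong suc eq

nonempty-of-size : ∀ {n} (p : Subset n) → 0 < ∣ p ∣ → ∃[ x ] x ∈ p
nonempty-of-size {n} p 0<∣p∣ with nonempty? p
... | yes x∈p = x∈p
... | no  e   = contradiction (subst (0 <_) (trans (cong ∣_∣ (Empty-unique e)) (∣⊥∣≡0 n)) 0<∣p∣) λ ()

-- Joined pairs of sets and their expanding cores

module _ {n} (R : Rel (Fin n) 0ℓ) where

  Edge : Subset n → Subset n → Set
  Edge S T = ∃[ s ] ∃[ t ] (s ∈ S × t ∈ T × R s t)

  Separated : Subset n → Subset n → Set
  Separated S T = ∀ {s t} → s ∈ S → t ∈ T → ¬ R s t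

  Joined : ℕ → Subset n → Subset n → Set
  Joined m A B = ∀ S T → S ⊆ A → T ⊆ B → m ≤ ∣ S ∣ → m ≤ ∣ T ∣ → Edge S T

  Hole : ℕ → Subset n → Subset n → Set
  Hole m A B = ∃[ S ] ∃[ T ] (S ⊆ A × T ⊆ B × ∣ S ∣ ≡ m × ∣ T ∣ ≡ m × Separated S T)

module _ {n} {R : Rel (Fin n) 0ℓ} where

  Joined-⊆ : ∀ {m A B A′ B′} → A′ ⊆ A → B′ ⊆ B → Joined R m A B → Joined R m A′ B′
  Joined-⊆ A′⊆A B′⊆B joined S T S⊆A′ T⊆B′ = joined S T (A′⊆A ∘ S⊆A′) (B′⊆B ∘ T⊆B′)

  Joined-sym : (∀ {u v} → R u v → R v u) → ∀ {m A B} → Joined R m A B → Joined R m B A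
  Joined-sym R-sym joined S T S⊆B T⊆A m≤S m≤T =
    let t , s , t∈T , s∈S , Rts = joined T S T⊆A S⊆B m≤T m≤S in s , t , s∈S , t∈T , R-sym Rts

module _ {n} {R : Rel (Fin n) 0ℓ} (R? : Decidable₂ R) where

  edge? : ∀ S T → Dec (Edge R S T)
  edge? S T = Fin.any? λ s → Fin.any? λ t → (s ∈? S) ×-dec (t ∈? T) ×-dec R? s t

  separated? : ∀ S T → Dec (Separated R S T)
  separated? S T with edge? S T
  ... | yes (s , t , s∈ , t∈ , Rst) = no λ sep → sep s∈ t∈ Rst
  ... | no ¬edge = yes λ {s} {t} s∈ t∈ Rst → ¬edge (s , t , s∈ , t∈ , Rst)

  -- A violation of joinedness can be shrunk to two sets of exactly `m` vertices, and the pairs of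
  -- subsets can be searched.
  joined-or-hole : ∀ m A B → Joined R m A B ⊎ Hole R m A B
  joined-or-hole m A B with anySubset? (λ S → anySubset? λ T → (S ⊆? A) ×-dec (T ⊆? B)
         ×-dec (∣ S ∣ ℕ.≟ m) ×-dec (∣ T ∣ ℕ.≟ m) ×-dec separated? S T)
  ... | yes hole = inj₂ hole
  ... | no ¬hole = inj₁ λ S T S⊆A T⊆B m≤S m≤T →
    let S′ , S′⊆S , S′≡m = sub-of-size S m≤S
        T′ , T′⊆T , T′≡m = sub-of-size T m≤T
    in decidable-stable (edge? S T) λ ¬edge → ¬hole (S′ , T′ , S⊆A ∘ S′⊆S , T⊆B ∘ T′⊆T , S′≡m , T′≡m
         , λ {s} {t} s∈ t∈ Rst → ¬edge (s , t , S′⊆S s∈ , T′⊆T t∈ , Rst))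

  HasNeighbour : Subset n → Fin n → Set
  HasNeighbour S v = ∃[ u ] (u ∈ S × R u v)

  hasNeighbour? : ∀ S v → Dec (HasNeighbour S v)
  hasNeighbour? S v = Fin.any? λ u → (u ∈? S) ×-dec R? u v

  nb : Subset n → Subset n → Subset n
  nb S B = ⟪ (λ v → (v ∈? B) ×-dec hasNeighbour? S v) ⟫

  nb⁺ : ∀ {S B u v} → u ∈ S → v ∈ B → R u v → v ∈ nb S B
  nb⁺ {S} {B} u∈ v∈ Ruv = ∈⟪⟫⁺ (λ v → (v ∈? B) ×-dec hasNeighbour? S v) (v∈ , _ , u∈ , Ruv)

  nb⁻ : ∀ {S B v} → v ∈ nb S B → v ∈ B × HasNeighbour S v
  nb⁻ {S} {B} = ∈⟪⟫⁻ (λ v → (v ∈? B) ×-dec hasNeighbour? S v)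

  nb-separated : ∀ S B → Separated R S (B ─ nb S B)
  nb-separated S B s∈ t∈ Rst =
    x∈p─q⇒x∉q B (nb S B) t∈ (nb⁺ {S} s∈ (p─q⊆p B (nb S B) t∈) Rst)

  few-without-neighbour : ∀ {m A B} → Joined R m A B → m ≤ ∣ A ∣ → ∣ B ─ nb A B ∣ < m
  few-without-neighbour {m} {A} {B} joined m≤A = ℕ.≰⇒> λ m≤ →
    let s , t , s∈ , t∈ , Rst = joined A (B ─ nb A B) (λ x∈ → x∈) (p─q⊆p B (nb A B)) m≤A m≤
    in nb-separated A B s∈ t∈ Rst

  Expands : ℕ → Subset n → Subset n → Set
  Expands m A B = ∀ S → S ⊆ A → ∣ S ∣ ≤ m → 3 * ∣ S ∣ ≤ ∣ nb S B ∣

  private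
    -- The invariant of the part `X` discarded from `A` while `Y` is discarded from `B`: it sees too
    -- little of the rest of `B` to ever reach `m` vertices.
    record Removable (m : ℕ) (A B X Y : Subset n) : Set where
      constructor removable
      field
        within : X ⊆ A
        small  : ∣ X ∣ < m
        sparse : ∣ nb X (B ─ Y) ∣ ≤ 3 * ∣ X ∣

    -- Discarding more on the other side can only destroy neighbours.
    Removable-grow : ∀ {m A B X Y S} → Removable m B A Y X → Removable m B A Y (X ∪ S)
    Removable-grow {A = A} {X = X} {Y} {S} (removable within small sparse) =
      removable within small (ℕ.≤-trans (p⊆q⇒∣p∣≤∣q∣ sub) sparse)
      where
      sub : nb Y (A ─ (X ∪ S)) ⊆ nb Y (A ─ X)
      sub v∈ with v∈A─ , u , u∈ , Ruv ← nb⁻ {Y} v∈ =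
        nb⁺ {Y} u∈ (x∈p∧x∉q⇒x∈p─q (p─q⊆p A (X ∪ S) v∈A─)
                 (x∈p─q⇒x∉q A (X ∪ S) v∈A─ ∘ x∈p∪q⁺ ∘ inj₁)) Ruv

    Violates : ℕ → (A B X Y S : Subset n) → Set
    Violates m A B X Y S = S ⊆ A ─ X × ∣ S ∣ ≤ m × ∣ nb S (B ─ Y) ∣ < 3 * ∣ S ∣

    violates? : ∀ m A B X Y S → Dec (Violates m A B X Y S)
    violates? m A B X Y S =
      (S ⊆? A ─ X) ×-dec (∣ S ∣ ℕ.≤? m) ×-dec (∣ nb S (B ─ Y) ∣ ℕ.<? 3 * ∣ S ∣)

    module _ {m A B X Y S} (joined : Joined R m A B) (8m≤B : 8 * m ≤ ∣ B ∣) (∣Y∣<m : ∣ Y ∣ < m)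
             (rem : Removable m A B X Y) (viol : Violates m A B X Y S) where

      open Removable rem

      private
        S⊆A─X = proj₁ viol

        union-size : ∣ X ∣ + ∣ S ∣ ≤ ∣ X ∪ S ∣
        union-size = Disjoint⇒∣p∣+∣q∣≤ {p = X} {S} (λ x∈X x∈S → x∈p─q⇒x∉q A X (S⊆A─X x∈S) x∈X)
                       (p⊆p∪q S) (q⊆p∪q X S)

        union⊆A : X ∪ S ⊆ A
        union⊆A = [ within , p─q⊆p A X ∘ S⊆A─X ]′ ∘ x∈p∪q⁻ X S

        union-sparse : ∣ nb (X ∪ S) (B ─ Y) ∣ ≤ 3 * (∣ X ∣ + ∣ S ∣)
        union-sparse = begin
          ∣ nb (X ∪ S) (B ─ Y) ∣                 ≤⟨ cover-size (nb X (B ─ Y)) (nb S (B ─ Y)) split ⟩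
          ∣ nb X (B ─ Y) ∣ + ∣ nb S (B ─ Y) ∣    ≤⟨ ℕ.+-mono-≤ sparse (ℕ.<⇒≤ (proj₂ (proj₂ viol))) ⟩
          3 * ∣ X ∣ + 3 * ∣ S ∣                  ≡⟨ ℕ.*-distribˡ-+ 3 ∣ X ∣ ∣ S ∣ ⟨
          3 * (∣ X ∣ + ∣ S ∣)                    ∎
          where
          open ℕ.≤-Reasoning
          split : ∀ {v} → v ∈ nb (X ∪ S) (B ─ Y) → v ∈ nb X (B ─ Y) ⊎ v ∈ nb S (B ─ Y)
          split v∈ with nb⁻ {X ∪ S} v∈
          ... | v∈B , u , u∈ , Ruv with x∈p∪q⁻ X S u∈
          ...   | inj₁ u∈X = inj₁ (nb⁺ {X} u∈X v∈B Ruv)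
          ...   | inj₂ u∈S = inj₂ (nb⁺ {S} u∈S v∈B Ruv)

        -- `X` and `S` together have at most `2 m` vertices, hence at most `6 m` neighbours outside
        -- `Y`, and `Y` has fewer than `m`. Of the `8 m` vertices of `B` at least `m` are left
        -- without a neighbour in `X ∪ S`, which contradicts joinedness if `X ∪ S` has `m` vertices.
        union-small : ∣ X ∪ S ∣ < m
        union-small = ℕ.≰⇒> λ m≤ →
          let s , t , s∈ , t∈ , Rst = joined (X ∪ S) Z union⊆A
                (p─q⊆p B Y ∘ p─q⊆p (B ─ Y) (nb (X ∪ S) (B ─ Y))) m≤ m≤∣Z∣
          in nb-separated (X ∪ S) (B ─ Y) s∈ t∈ Rst
          where
          Z = (B ─ Y) ─ nb (X ∪ S) (B ─ Y)
          m≤∣Z∣ : m ≤ ∣ Z ∣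
          m≤∣Z∣ = ℕ.+-cancelˡ-≤ (7 * m) m ∣ Z ∣ (begin
            7 * m + m                                       ≡⟨ solve 1 (λ m → con 7 :* m :+ m := con 8 :* m) refl m ⟩
            8 * m                                           ≤⟨ 8m≤B ⟩
            ∣ B ∣                                           ≤⟨ ∣p∣≤∣q∣+∣p─q∣ B Y ⟩
            ∣ Y ∣ + ∣ B ─ Y ∣                               ≤⟨ ℕ.+-mono-≤ (ℕ.<⇒≤ ∣Y∣<m)
                                                                (∣p∣≤∣q∣+∣p─q∣ (B ─ Y) (nb (X ∪ S) (B ─ Y))) ⟩
            m + (∣ nb (X ∪ S) (B ─ Y) ∣ + ∣ Z ∣)            ≤⟨ ℕ.+-monoʳ-≤ m (ℕ.+-monoˡ-≤ ∣ Z ∣ (ℕ.≤-trans union-sparse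
                                                                (ℕ.*-monoʳ-≤ 3 (ℕ.+-mono-≤ (ℕ.<⇒≤ small) (proj₁ (proj₂ viol)))))) ⟩
            m + (3 * (m + m) + ∣ Z ∣)                       ≡⟨ solve 2 (λ m z → m :+ (con 3 :* (m :+ m) :+ z) := con 7 :* m :+ z)
                                                                refl m ∣ Z ∣ ⟩
            7 * m + ∣ Z ∣                                   ∎)
            where
            open ℕ.≤-Reasoning
            open +-*-Solver

      absorb : Removable m A B (X ∪ S) Y
      absorb = removable union⊆A union-small (ℕ.≤-trans union-sparse (ℕ.*-monoʳ-≤ 3 union-size))

      absorb-grows : ∣ X ∣ < ∣ X ∪ S ∣
      absorb-grows = ℕ.≤-trans (ℕ.≤-trans (ℕ.≤-reflexive (ℕ.+-comm 1 ∣ X ∣)) (ℕ.+-monoʳ-≤ ∣ X ∣ 0<S)) union-size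
        where
        0<S : 0 < ∣ S ∣
        0<S = ℕ.*-cancelˡ-< 3 0 ∣ S ∣ (ℕ.≤-trans (s≤s z≤n) (proj₂ (proj₂ viol)))

  module _ {m A B} (A-B : Joined R m A B) (B-A : Joined R m B A)
           (8m≤A : 8 * m ≤ ∣ A ∣) (8m≤B : 8 * m ≤ ∣ B ∣) (0<m : 0 < m) where

    record ExpandingCore : Set where
      constructor core
      field
        A′ B′  : Subset n
        A′⊆A   : A′ ⊆ A
        B′⊆B   : B′ ⊆ B
        m≤A′   : m ≤ ∣ A′ ∣
        m≤B′   : m ≤ ∣ B′ ∣
        A′⇒B′  : Expands m A′ B′
        B′⇒A′  : Expands m B′ A′

    private
      large : ∀ {m} {A X : Subset n} → 8 * m ≤ ∣ A ∣ → ∣ X ∣ < m → m ≤ ∣ A ─ X ∣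
      large {m} {A} {X} 8m≤A X<m = ℕ.+-cancelˡ-≤ m m ∣ A ─ X ∣ (begin
        m + m              ≤⟨ ℕ.m≤m+n (m + m) (6 * m) ⟩
        m + m + 6 * m      ≡⟨ solve 1 (λ m → m :+ m :+ con 6 :* m := con 8 :* m) refl m ⟩
        8 * m              ≤⟨ 8m≤A ⟩
        ∣ A ∣              ≤⟨ ∣p∣≤∣q∣+∣p─q∣ A X ⟩
        ∣ X ∣ + ∣ A ─ X ∣  ≤⟨ ℕ.+-monoˡ-≤ _ (ℕ.<⇒≤ X<m) ⟩
        m + ∣ A ─ X ∣      ∎)
        where
        open ℕ.≤-Reasoning
        open +-*-Solver

      expands : ∀ {m A B X Y} → ¬ (∃[ S ] Violates m A B X Y S) → Expands m (A ─ X) (B ─ Y)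
      expands ¬viol S S⊆ S≤m = ℕ.≮⇒≥ λ lt → ¬viol (S , S⊆ , S≤m , lt)

      -- Discarding on one side may spoil expansion on the other, so both sides are rechecked after
      -- every absorption. Each absorption enlarges `X` or `Y`, and both stay below `m`, so `m + m`
      -- rounds suffice.
      clean : ∀ fuel {X Y} → Removable m A B X Y → Removable m B A Y X →
              m + m ≤ fuel + (∣ X ∣ + ∣ Y ∣) → ExpandingCore
      clean zero remX remY enough = contradiction
        (ℕ.+-mono-< (Removable.small remX) (Removable.small remY)) (ℕ.≤⇒≯ enough)
      clean (suc fuel) {X} {Y} remX remY enough
        with anySubset? (violates? m A B X Y)
      ... | yes (S , viol) = clean fuel (absorb A-B 8m≤B (Removable.small remY) remX viol)
              (Removable-grow {S = S} remY)
              (ℕ.≤-trans enough (ℕ.≤-trans (ℕ.≤-reflexive (sym (ℕ.+-suc fuel _)))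
                (ℕ.+-monoʳ-≤ fuel (ℕ.+-monoˡ-≤ ∣ Y ∣
                  (absorb-grows A-B 8m≤B (Removable.small remY) remX viol)))))
      ... | no ¬violX with anySubset? (violates? m B A Y X)
      ...   | yes (S , viol) = clean fuel (Removable-grow {S = S} remX)
              (absorb B-A 8m≤A (Removable.small remX) remY viol)
              (ℕ.≤-trans enough (ℕ.≤-trans (ℕ.≤-reflexive (sym (ℕ.+-suc fuel _)))
                (ℕ.+-monoʳ-≤ fuel (ℕ.≤-trans (ℕ.≤-reflexive (sym (ℕ.+-suc ∣ X ∣ ∣ Y ∣))) (ℕ.+-monoʳ-≤ ∣ X ∣
                  (absorb-grows B-A 8m≤A (Removable.small remX) remY viol))))))
      ...   | no ¬violY = core (A ─ X) (B ─ Y) (p─q⊆p A X) (p─q⊆p B Y)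
              (large {A = A} {X} 8m≤A (Removable.small remX)) (large {A = B} {Y} 8m≤B (Removable.small remY))
              (expands ¬violX) (expands ¬violY)

      nothing : ∀ {A B} → Removable m A B ⊥ ⊥
      nothing {A} {B} = removable (λ x∈ → contradiction x∈ ∉⊥) (subst (_< m) (sym (∣⊥∣≡0 n)) 0<m)
        (ℕ.≤-trans (ℕ.≤-reflexive (trans (cong ∣_∣ (Empty-unique λ (v , v∈) →
           let _ , u , u∈ , _ = nb⁻ {⊥} v∈ in ∉⊥ u∈)) (∣⊥∣≡0 n))) z≤n)

    expandingCore : ExpandingCore
    expandingCore = clean (m + m) nothing nothing (ℕ.m≤m+n (m + m) _)

-- Paths and branching trees

-- The list contains all vertices of the path, both ends included: `k` edges correspond to length
-- `suc k`.
data Path {V : Set} (R : Rel V 0ℓ) : V → V → List V → Set where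
  [_] : ∀ v → Path R v v (v ∷ [])
  _∷_ : ∀ {u v w xs} → R u v → Path R v w xs → Path R u w (u ∷ xs)

module _ {V : Set} {R : Rel V 0ℓ} where

  Path-join : ∀ {u v w z xs ys} → Path R u v xs → R v w → Path R w z ys → Path R u z (xs ++ ys)
  Path-join [ v ]    Rvw q = Rvw ∷ q
  Path-join (Ru ∷ p) Rvw q = Ru ∷ Path-join p Rvw q

  Path-reverse : Symmetric R → ∀ {u v xs} → Path R u v xs → Path R v u (reverse xs)
  Path-reverse R-sym [ v ] = [ v ]
  Path-reverse R-sym {u} {v} (_∷_ {xs = xs} Ruw p) = subst (Path R v u) (sym (List.unfold-reverse u xs))
    (Path-join (Path-reverse R-sym p) (R-sym Ruw) [ u ])

  Path-take : ∀ {u v xs} → Path R u v xs → ∀ j → j < length xs → ∃[ w ] Path R u w (take (suc j) xs)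
  Path-take {u} [ v ]    zero    j<          = u , [ u ]
  Path-take {u} (Ru ∷ p) zero    j<          = u , [ u ]
  Path-take [ v ]        (suc j) (s≤s ())
  Path-take (Ru ∷ p)     (suc j) (s≤s j<)    = let w , q = Path-take p j j< in w , Ru ∷ q

  Path-map : ∀ {S : Rel V 0ℓ} → (∀ {u v} → R u v → S u v) →
             ∀ {u v xs} → Path R u v xs → Path S u v xs
  Path-map f [ v ]    = [ v ]
  Path-map f (Ru ∷ p) = f Ru ∷ Path-map f p

-- The side on which `k` alternating steps end when they start in `a`.
side : ∀ {A : Set} → ℕ → A → A → A
side zero    a b = a
side (suc k) a b = side k b a

side-map : ∀ {A : Set} (P : A → Set) k {a b} → P a → P b → P (side k a b)
side-map P zero    pa pb = pa
side-map P (suc k) pa pb = side-map P k pb pa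

module _ {n} {R : Rel (Fin n) 0ℓ} (R? : Decidable₂ R) (R-sym : Symmetric R) where

  -- `front` is the layer at distance `depth` from the root and `inner` holds all earlier layers; as
  -- sizes double, `inner` stays smaller than `front`.
  record Layer (A B : Subset n) (root : Fin n) (depth size : ℕ) : Set where
    constructor layer
    field
      front inner : Subset n
      front⊆      : front ⊆ A
      front-size  : ∣ front ∣ ≡ size
      inner⊆      : ∀ {x} → x ∈ inner → x ∈ A ⊎ x ∈ B
      inner-size  : ∣ inner ∣ < size
      path        : ∀ {u} → u ∈ front → ∃[ ys ] (Path R u root (u ∷ ys) × Unique (u ∷ ys)
                                                × All (_∈ inner) ys × length ys ≡ depth)

  rootLayer : ∀ {A B v} → v ∈ A → Layer A B v 0 1
  rootLayer {A} {B} {v} v∈A = record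
    { front = ⁅ v ⁆
    ; inner = ⊥
    ; front⊆ = λ x∈ → subst (_∈ A) (sym (x∈⁅y⁆⇒x≡y v x∈)) v∈A
    ; front-size = ∣⁅x⁆∣≡1 v
    ; inner⊆ = λ x∈ → contradiction x∈ ∉⊥
    ; inner-size = subst (_< 1) (sym (∣⊥∣≡0 n)) (s≤s z≤n)
    ; path = λ {u} u∈ → [] , subst (λ w → Path R u w (u ∷ [])) (x∈⁅y⁆⇒x≡y v u∈) [ u ] , [] ∷ [] , [] , refl
    }

  -- The front has at least `3 s` neighbours in `B`, fewer than `s` of them in `inner`; `2 s` of the
  -- others are chosen. A new vertex differs from its parent because the parent lies in `A`, and
  -- from the rest of the branch because that lies in `inner`.
  nextLayer : ∀ {m A B v d s} → Disjoint A B → Expands R? m A B → s ≤ m →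
              Layer A B v d s → Layer B A v (suc d) (2 * s)
  nextLayer {m} {A} {B} {v} {d} {s} A#B A⇒B s≤m L = record
    { front = C
    ; inner = inner ∪ front
    ; front⊆ = proj₁ ∘ nb⁻ R? {front} ∘ p─q⊆p N inner ∘ C⊆
    ; front-size = C-size
    ; inner⊆ = Sum.swap ∘ [ inner⊆ , inj₁ ∘ front⊆ ]′ ∘ x∈p∪q⁻ inner front
    ; inner-size = begin-strict
        ∣ inner ∪ front ∣      ≤⟨ ∣p∪q∣≤∣p∣+∣q∣ inner front ⟩
        ∣ inner ∣ + ∣ front ∣  ≡⟨ cong (∣ inner ∣ +_) front-size ⟩
        ∣ inner ∣ + s          <⟨ ℕ.+-monoˡ-< s inner-size ⟩
        s + s                  ≡⟨ cong (s +_) (ℕ.+-identityʳ s) ⟨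
        2 * s                  ∎
    ; path = extend
    }
    where
    open Layer L
    open ℕ.≤-Reasoning
    N = nb R? front B

    enough : 2 * s ≤ ∣ N ─ inner ∣
    enough = ℕ.+-cancelˡ-≤ s (2 * s) _ (begin
      3 * s                        ≡⟨ cong (3 *_) front-size ⟨
      3 * ∣ front ∣                ≤⟨ A⇒B front front⊆ (subst (_≤ m) (sym front-size) s≤m) ⟩
      ∣ N ∣                        ≤⟨ ∣p∣≤∣q∣+∣p─q∣ N inner ⟩
      ∣ inner ∣ + ∣ N ─ inner ∣    ≤⟨ ℕ.+-monoˡ-≤ _ (ℕ.<⇒≤ inner-size) ⟩
      s + ∣ N ─ inner ∣            ∎)

    C = proj₁ (sub-of-size (N ─ inner) enough)
    C⊆ = proj₁ (proj₂ (sub-of-size (N ─ inner) enough))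
    C-size = proj₂ (proj₂ (sub-of-size (N ─ inner) enough))

    extend : ∀ {u} → u ∈ C → ∃[ ys ] (Path R u v (u ∷ ys) × Unique (u ∷ ys)
                                    × All (_∈ inner ∪ front) ys × length ys ≡ suc d)
    extend {u} u∈C =
      let u∈N─ = C⊆ u∈C
          u∉inner = x∈p─q⇒x∉q N inner u∈N─
          u∈B , p , p∈ , Rpu = nb⁻ R? {front} {B} (p─q⊆p N inner u∈N─)
          ys , path-p , unique , ys⊆ , len = path p∈
      in p ∷ ys , R-sym Rpu ∷ path-p
         , ((λ u≡p → A#B (front⊆ p∈) (subst (_∈ B) u≡p u∈B))
             ∷ All.map (λ y∈ u≡y → u∉inner (subst (_∈ inner) (sym u≡y) y∈)) ys⊆)
           ∷ unique
         , q⊆p∪q inner front p∈ ∷ All.map (p⊆p∪q front) ys⊆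
         , cong suc len

  -- Expansion holds for sets of at most `m` vertices, and only layers that are extended must be
  -- that small; the last one may have almost `2 m`.
  grow : ∀ {m A B v d s} j → Disjoint A B → Expands R? m A B → Expands R? m B A → s * 2 ^ j < 2 * m →
         Layer A B v d s → Layer (side j A B) (side j B A) v (j + d) (s * 2 ^ j)
  grow {A = A} {B} {v} {d} {s} zero A#B A⇒B B⇒A small L = subst (Layer A B v d) (sym (ℕ.*-identityʳ s)) L
  grow {m} {A} {B} {v} {d} {s} (suc j) A#B A⇒B B⇒A small L =
    subst₂ (Layer (side j B A) (side j A B) v) (ℕ.+-suc j d) (trans (cong (_* 2 ^ j) (ℕ.*-comm 2 s)) (ℕ.*-assoc s 2 (2 ^ j)))
      (grow j (λ x∈B x∈A → A#B x∈A x∈B) B⇒A A⇒B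
        (subst (_< 2 * m) (sym (trans (cong (_* 2 ^ j) (ℕ.*-comm 2 s)) (ℕ.*-assoc s 2 (2 ^ j)))) small)
        (nextLayer A#B A⇒B s≤m L))
    where
    open ℕ.≤-Reasoning
    s≤m : s ≤ m
    s≤m = ℕ.*-cancelˡ-≤ 2 (begin
      2 * s            ≡⟨ ℕ.*-comm 2 s ⟩
      s * 2            ≤⟨ ℕ.*-monoʳ-≤ s (ℕ.m≤m*n 2 (2 ^ j) {{ℕ.m^n≢0 2 j}}) ⟩
      s * 2 ^ suc j    ≤⟨ ℕ.<⇒≤ small ⟩
      2 * m            ∎)

  record Branches (A B : Subset n) (v : Fin n) (r : ℕ) : Set where
    constructor branches
    field
      ends      : Subset n
      ends⊆     : ends ⊆ side r A B
      ends-size : ∣ ends ∣ ≡ 2 ^ r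
      path      : ∀ {u} → u ∈ ends → ∃[ xs ] (Path R u v xs × Unique xs
                                             × All (λ x → x ∈ A ⊎ x ∈ B) xs × length xs ≡ suc r)

  grow-branches : ∀ {m A B v} r → Disjoint A B → Expands R? m A B → Expands R? m B A → 2 ^ r < 2 * m →
                  v ∈ A → Branches A B v r
  grow-branches {m} {A} {B} {v} r A#B A⇒B B⇒A small v∈A = record
    { ends = front
    ; ends⊆ = front⊆
    ; ends-size = trans front-size (ℕ.+-identityʳ (2 ^ r))
    ; path = λ {u} u∈ → let ys , p , unique , ys⊆ , len = path u∈ in
        u ∷ ys , p , unique , back (inj₁ (front⊆ u∈)) ∷ All.map (back ∘ inner⊆) ys⊆
        , cong suc (trans len (ℕ.+-identityʳ r))
    }
    where
    open Layer (grow r A#B A⇒B B⇒A (subst (_< 2 * m) (sym (ℕ.+-identityʳ (2 ^ r))) small) (rootLayer v∈A))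
    back : ∀ {x} → x ∈ side r A B ⊎ x ∈ side r B A → x ∈ A ⊎ x ∈ B
    back {x} = [ side-map (λ S → x ∈ S → x ∈ A ⊎ x ∈ B) r inj₁ inj₂
               , side-map (λ S → x ∈ S → x ∈ A ⊎ x ∈ B) r inj₂ inj₁ ]′

-- Long paths by depth-first search

module _ {n} {R : Rel (Fin n) 0ℓ} (R? : Decidable₂ R) (R-sym : Symmetric R)
  (V : Subset n) (d k : ℕ) (0<d : 0 < d) (d≤V : d ≤ ∣ V ∣)
  (expand : ∀ D U xs → D ⊆ V → ∣ D ∣ ≡ d → length xs ≤ k →
            (∀ {v} → v ∈ V → v ∈ D ⊎ v ∈ U ⊎ v List.∈ xs) → Edge R D U) where

  PathWithin : ℕ → Set
  PathWithin l = ∃[ u ] ∃[ w ] ∃[ xs ]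
    (Path R u w xs × Unique xs × All (_∈ V) xs × length xs ≡ l)

  private
    -- A depth-first search: D holds the abandoned vertices, U the unvisited ones, xs the stack.
    record State (D U : Subset n) (xs : List (Fin n)) : Set where
      field
        D⊆V       : D ⊆ V
        D<d       : ∣ D ∣ < d
        separated : Separated R D U
        unique    : Unique xs
        within    : All (_∈ V) xs
        visited   : All (_∉ U) xs
        cover     : ∀ {v} → v ∈ V → v ∈ D ⊎ v ∈ U ⊎ v List.∈ xs
        U⊆V       : U ⊆ V

    push : ∀ {D U xs x} → x ∈ U → State D U xs → State D (U - x) (x ∷ xs)
    push {D} {U} {xs} {x} x∈U s = record
      { D⊆V = D⊆V
      ; D<d = D<d
      ; separated = λ s∈ → separated s∈ ∘ U-x⊆U
      ; unique = All.map (λ y∉U x≡y → y∉U (subst (_∈ U) x≡y x∈U)) visited ∷ unique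
      ; within = U⊆V x∈U ∷ within
      ; visited = (λ x∈ → x∈p─q⇒x∉q U ⁅ x ⁆ x∈ (x∈⁅x⁆ x)) ∷ All.map (_∘ U-x⊆U) visited
      ; cover = [ inj₁ , [ split , inj₂ ∘ inj₂ ∘ there ]′ ]′ ∘ cover
      ; U⊆V = U⊆V ∘ U-x⊆U
      }
      where
      open State s
      U-x⊆U : U - x ⊆ U
      U-x⊆U = p─q⊆p U ⁅ x ⁆
      split : ∀ {v} → v ∈ U → v ∈ D ⊎ v ∈ U - x ⊎ v List.∈ (x ∷ xs)
      split {v} v∈U with v Fin.≟ x
      ... | yes v≡x = inj₂ (inj₂ (here v≡x))
      ... | no  v≢x = inj₂ (inj₁ (x∈p∧x≢y⇒x∈p-y v∈U v≢x))

    module _ {D U x xs} (len : length xs ≤ k) (stuck : ∀ {v} → v ∈ U → ¬ R x v)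
             (s : State D U (x ∷ xs)) where
      open State s

      private
        D′ = D ∪ ⁅ x ⁆

        D′⊆V : D′ ⊆ V
        D′⊆V = [ D⊆V , (λ v∈ → subst (_∈ V) (sym (x∈⁅y⁆⇒x≡y x v∈)) (All.head within)) ]′ ∘ x∈p∪q⁻ D ⁅ x ⁆

        cover′ : ∀ {v} → v ∈ V → v ∈ D′ ⊎ v ∈ U ⊎ v List.∈ xs
        cover′ = [ inj₁ ∘ p⊆p∪q ⁅ x ⁆ , [ inj₂ ∘ inj₁ , top ]′ ]′ ∘ cover
          where
          top : ∀ {v} → v List.∈ (x ∷ xs) → v ∈ D′ ⊎ v ∈ U ⊎ v List.∈ xs
          top (here refl) = inj₁ (q⊆p∪q D ⁅ x ⁆ (x∈⁅x⁆ x))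
          top (there v∈)  = inj₂ (inj₂ v∈)

        separated′ : Separated R D′ U
        separated′ s∈ t∈ Rst with x∈p∪q⁻ D ⁅ x ⁆ s∈
        ... | inj₁ s∈D = separated s∈D t∈ Rst
        ... | inj₂ s∈x = stuck t∈ (subst (λ y → R y _) (x∈⁅y⁆⇒x≡y x s∈x) Rst)

        D′≤d : ∣ D′ ∣ ≤ d
        D′≤d = ℕ.≤-trans (∣p∪q∣≤∣p∣+∣q∣ D ⁅ x ⁆)
          (ℕ.≤-trans (ℕ.≤-reflexive (trans (cong (∣ D ∣ +_) (∣⁅x⁆∣≡1 x)) (ℕ.+-comm ∣ D ∣ 1))) D<d)

      -- If the abandoned set reached `d` vertices, `expand` would give an edge from it to `U`, but
      -- a vertex is abandoned only when none leads there.
      pop : State D′ U xs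
      pop = record
        { D⊆V = D′⊆V
        ; D<d = ℕ.≤∧≢⇒< D′≤d λ D′≡d →
            let s , t , s∈ , t∈ , Rst = expand D′ U xs D′⊆V D′≡d len cover′ in separated′ s∈ t∈ Rst
        ; separated = separated′
        ; unique = AllPairs.tail unique
        ; within = All.tail within
        ; visited = All.tail visited
        ; cover = cover′
        ; U⊆V = U⊆V
        }

    -- The measure `2 * ∣ U ∣ + length xs` falls with every move: a push turns an unvisited vertex
    -- into a stack entry, a pop removes a stack entry.
    remove-fuel : ∀ {f x} {U : Subset n} l → x ∈ U → 2 * ∣ U ∣ + l ≤ suc f → 2 * ∣ U - x ∣ + suc l ≤ f
    remove-fuel {f} {x} {U} l x∈U enough = s≤s⁻¹ (begin
      suc (2 * ∣ U - x ∣ + suc l)    ≡⟨ cong suc (ℕ.+-suc (2 * ∣ U - x ∣) l) ⟩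
      2 + 2 * ∣ U - x ∣ + l          ≡⟨ cong (_+ l) (ℕ.*-suc 2 ∣ U - x ∣) ⟨
      2 * suc ∣ U - x ∣ + l          ≤⟨ ℕ.+-monoˡ-≤ l (ℕ.*-monoʳ-≤ 2 (x∈p⇒∣p-x∣<∣p∣ x∈U)) ⟩
      2 * ∣ U ∣ + l                  ≤⟨ enough ⟩
      suc f                          ∎)
      where open ℕ.≤-Reasoning

    unvisited : ∀ {D U} → State D U [] → ∃[ x ] x ∈ U
    unvisited {D} {U} s = nonempty-of-size U (ℕ.+-cancelˡ-< ∣ D ∣ 0 _ (begin-strict
      ∣ D ∣ + 0      ≡⟨ ℕ.+-identityʳ ∣ D ∣ ⟩
      ∣ D ∣          <⟨ D<d ⟩
      d              ≤⟨ d≤V ⟩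
      ∣ V ∣          ≤⟨ cover-size D U ([ inj₁ , [ inj₂ , (λ ()) ]′ ]′ ∘ cover) ⟩
      ∣ D ∣ + ∣ U ∣  ∎))
      where
      open State s
      open ℕ.≤-Reasoning

    mutual
      search : ∀ f {D U} → State D U [] → 2 * ∣ U ∣ ≤ f → PathWithin (suc k)
      search f s enough with unvisited s
      search zero {U = U} s enough | x , x∈U =
        contradiction (ℕ.≤-trans (x∈p⇒∣p-x∣<∣p∣ x∈U) (ℕ.≤-trans (ℕ.m≤n*m ∣ U ∣ 2) enough)) λ ()
      search (suc f) {U = U} s enough | x , x∈U = descend f [ x ] (push x∈U s) (s≤s z≤n)
        (remove-fuel 0 x∈U (subst (_≤ suc f) (sym (ℕ.+-identityʳ (2 * ∣ U ∣))) enough))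

      descend : ∀ f {D U u w xs} → Path R u w xs → State D U xs → length xs ≤ suc k →
                2 * ∣ U ∣ + length xs ≤ f → PathWithin (suc k)
      descend f {xs = xs} p s len enough with length xs ℕ.≟ suc k
      ... | yes len≡ = _ , _ , _ , p , State.unique s , State.within s , len≡
      descend zero {U = U} [ _ ] s len enough | no len≢ = Empty.⊥-elim (ℕ.n≮0 (ℕ.m+n≤o⇒n≤o (2 * ∣ U ∣) enough))
      descend zero {U = U} (_ ∷ _) s len enough | no len≢ = Empty.⊥-elim (ℕ.n≮0 (ℕ.m+n≤o⇒n≤o (2 * ∣ U ∣) enough))
      descend (suc f) {D} {U} {u} {xs = xs} p s len enough | no len≢
        with Fin.any? (λ x → (x ∈? U) ×-dec R? u x)
      ... | yes (x , x∈U , Rux) = descend f (R-sym Rux ∷ p) (push x∈U s) (ℕ.≤∧≢⇒< len len≢)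
                                    (remove-fuel (length xs) x∈U enough)
      ... | no ¬ext = backtrack f p s (s≤s⁻¹ (ℕ.≤∧≢⇒< len len≢)) (λ v∈U Ruv → ¬ext (_ , v∈U , Ruv)) enough

      backtrack : ∀ f {D U u w xs} → Path R u w xs → State D U xs → length xs ≤ k →
                  (∀ {v} → v ∈ U → ¬ R u v) → 2 * ∣ U ∣ + length xs ≤ suc f → PathWithin (suc k)
      backtrack f {U = U} [ v ] s len stuck enough = search f (pop z≤n stuck s)
        (s≤s⁻¹ (subst (_≤ suc f) (ℕ.+-comm (2 * ∣ U ∣) 1) enough))
      backtrack f {U = U} (_∷_ {xs = ys} Ruv p) s len stuck enough =
        descend f p (pop (ℕ.<⇒≤ len) stuck s) (ℕ.<⇒≤ (ℕ.m≤n⇒m≤1+n len))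
        (s≤s⁻¹ (subst (_≤ suc f) (ℕ.+-suc (2 * ∣ U ∣) (length ys)) enough))

  -- Fewer than `d ≤ ∣ V ∣` vertices are ever abandoned, so an empty stack can always be restarted
  -- from an unvisited vertex; as the measure keeps falling, the stack must reach `suc k` vertices.
  long-path : PathWithin (suc k)
  long-path = search (2 * ∣ V ∣) start ℕ.≤-refl
    where
    start : State ⊥ V []
    start = record
      { D⊆V = λ x∈ → contradiction x∈ ∉⊥
      ; D<d = subst (_< d) (sym (∣⊥∣≡0 n)) 0<d
      ; separated = λ s∈ → contradiction s∈ ∉⊥
      ; unique = []
      ; within = []
      ; visited = []
      ; cover = inj₂ ∘ inj₁
      ; U⊆V = id
      }

-- Alternating paths between two joined sets.

cover-list-size : ∀ {n} {p : Subset n} (q : Subset n) xs →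
                  (∀ {x} → x ∈ p → x ∈ q ⊎ x List.∈ xs) → ∣ p ∣ ≤ ∣ q ∣ + length xs
cover-list-size {p = p} q [] f =
  ℕ.≤-trans (p⊆q⇒∣p∣≤∣q∣ ([ id , (λ ()) ]′ ∘ f)) (ℕ.m≤m+n ∣ q ∣ 0)
cover-list-size {n} {p} q (x ∷ xs) f = begin
  ∣ p ∣                         ≤⟨ cover-list-size (q ∪ ⁅ x ⁆) xs ([ inj₁ ∘ p⊆p∪q ⁅ x ⁆ , move ]′ ∘ f) ⟩
  ∣ q ∪ ⁅ x ⁆ ∣ + length xs     ≤⟨ ℕ.+-monoˡ-≤ (length xs) (∣p∪q∣≤∣p∣+∣q∣ q ⁅ x ⁆) ⟩
  ∣ q ∣ + ∣ ⁅ x ⁆ ∣ + length xs ≡⟨ cong (λ l → ∣ q ∣ + l + length xs) (∣⁅x⁆∣≡1 x) ⟩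
  ∣ q ∣ + 1 + length xs         ≡⟨ ℕ.+-assoc ∣ q ∣ 1 (length xs) ⟩
  ∣ q ∣ + suc (length xs)       ∎
  where
  open ℕ.≤-Reasoning
  move : ∀ {y} → y List.∈ (x ∷ xs) → y ∈ q ∪ ⁅ x ⁆ ⊎ y List.∈ xs
  move (here refl) = inj₁ (q⊆p∪q q ⁅ x ⁆ (x∈⁅x⁆ x))
  move (there y∈)  = inj₂ y∈

Unique-reverse : ∀ {A : Set} {xs : List A} → Unique xs → Unique (reverse xs)
Unique-reverse {xs = []} [] = []
Unique-reverse {xs = x ∷ xs} (x∉xs ∷ uniq) = subst Unique (sym (List.unfold-reverse x xs))
  (Unique.++⁺ (Unique-reverse uniq) ([] ∷ []) λ where
    (x∈ , here refl) → All.lookup x∉xs (Any.reverse⁻ x∈) refl)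

Cycle : ∀ {V : Set} → Rel V 0ℓ → ℕ → Set
Cycle R ℓ = ∃[ u ] ∃[ v ] ∃[ xs ] (Path R u v xs × R v u × Unique xs × length xs ≡ ℓ)

module _ {n} {R : Rel (Fin n) 0ℓ} (R? : Decidable₂ R) (R-sym : Symmetric R) where

  module _ {m} (0<m : 0 < m) {P Q : Subset n} (P#Q : Disjoint P Q) (P-Q : Joined R m P Q)
           (3m≤P : 3 * m ≤ ∣ P ∣) (3m≤Q : 3 * m ≤ ∣ Q ∣) where

    private
      -- Paths of this relation alternate between `P` and `Q`, so their length determines the side
      -- of the end.
      Across : Rel (Fin n) 0ℓ
      Across u v = R u v × (u ∈ P × v ∈ Q ⊎ u ∈ Q × v ∈ P)

      across? : Decidable₂ Across
      across? u v = R? u v ×-dec (((u ∈? P) ×-dec (v ∈? Q)) ⊎-dec ((u ∈? Q) ×-dec (v ∈? P)))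

      across-sym : Symmetric Across
      across-sym (Ruv , inj₁ (u∈ , v∈)) = R-sym Ruv , inj₂ (v∈ , u∈)
      across-sym (Ruv , inj₂ (u∈ , v∈)) = R-sym Ruv , inj₁ (v∈ , u∈)

      -- Of the `2 m` abandoned vertices at least `m` are in `P`, hence at most `m` in `Q`; the
      -- stack takes at most `m` more, so `m` of the `3 m` vertices of `Q` are unvisited.
      many-unvisited : ∀ {P Q D U : Subset n} {xs} → Disjoint P Q → 3 * m ≤ ∣ Q ∣ → ∣ D ∣ ≡ m + m → length xs ≤ m →
                       (∀ {v} → v ∈ Q → v ∈ D ⊎ v ∈ U ⊎ v List.∈ xs) → m ≤ ∣ D ∩ P ∣ → m ≤ ∣ U ∩ Q ∣
      many-unvisited {P} {Q} {D} {U} {xs} P#Q 3m≤Q D≡2m len cover m≤DP = ℕ.+-cancelˡ-≤ (m + m) m _ (begin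
        m + m + m                          ≡⟨ solve 1 (λ m → m :+ m :+ m := con 3 :* m) refl m ⟩
        3 * m                              ≤⟨ 3m≤Q ⟩
        ∣ Q ∣                              ≤⟨ cover-list-size ((D ∩ Q) ∪ (U ∩ Q)) xs split ⟩
        ∣ (D ∩ Q) ∪ (U ∩ Q) ∣ + length xs  ≤⟨ ℕ.+-mono-≤ (∣p∪q∣≤∣p∣+∣q∣ (D ∩ Q) (U ∩ Q)) len ⟩
        ∣ D ∩ Q ∣ + ∣ U ∩ Q ∣ + m          ≤⟨ ℕ.+-monoˡ-≤ m (ℕ.+-monoˡ-≤ _ DQ≤m) ⟩
        m + ∣ U ∩ Q ∣ + m                  ≡⟨ solve 2 (λ m u → m :+ u :+ m := m :+ m :+ u) refl m ∣ U ∩ Q ∣ ⟩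
        m + m + ∣ U ∩ Q ∣                  ∎)
        where
        open ℕ.≤-Reasoning
        open +-*-Solver
        DQ≤m : ∣ D ∩ Q ∣ ≤ m
        DQ≤m = ℕ.+-cancelˡ-≤ m _ m (begin
          m + ∣ D ∩ Q ∣            ≤⟨ ℕ.+-monoˡ-≤ _ m≤DP ⟩
          ∣ D ∩ P ∣ + ∣ D ∩ Q ∣    ≤⟨ Disjoint⇒∣p∣+∣q∣≤ (λ x∈DP x∈DQ → P#Q (p∩q⊆q D P x∈DP) (p∩q⊆q D Q x∈DQ))
                                       (p∩q⊆p D P) (p∩q⊆p D Q) ⟩
          ∣ D ∣                    ≡⟨ D≡2m ⟩
          m + m                    ∎)
        split : ∀ {v} → v ∈ Q → v ∈ (D ∩ Q) ∪ (U ∩ Q) ⊎ v List.∈ xs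
        split v∈Q with cover v∈Q
        ... | inj₁ v∈D        = inj₁ (p⊆p∪q (U ∩ Q) (x∈p∩q⁺ (v∈D , v∈Q)))
        ... | inj₂ (inj₁ v∈U) = inj₁ (q⊆p∪q (D ∩ Q) (U ∩ Q) (x∈p∩q⁺ (v∈U , v∈Q)))
        ... | inj₂ (inj₂ v∈)  = inj₂ v∈

      expand : ∀ D U xs → D ⊆ P ∪ Q → ∣ D ∣ ≡ m + m → length xs ≤ m →
               (∀ {v} → v ∈ P ∪ Q → v ∈ D ⊎ v ∈ U ⊎ v List.∈ xs) → Edge Across D U
      expand D U xs D⊆ D≡2m len cover with m ℕ.≤? ∣ D ∩ P ∣
      ... | yes m≤DP =
        let s , t , s∈ , t∈ , Rst = P-Q (D ∩ P) (U ∩ Q) (p∩q⊆q D P) (p∩q⊆q U Q) m≤DP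
              (many-unvisited P#Q 3m≤Q D≡2m len (cover ∘ q⊆p∪q P Q) m≤DP)
        in s , t , p∩q⊆p D P s∈ , p∩q⊆p U Q t∈ , Rst , inj₁ (p∩q⊆q D P s∈ , p∩q⊆q U Q t∈)
      ... | no m≰DP =
        let s , t , s∈ , t∈ , Rst = P-Q (U ∩ P) (D ∩ Q) (p∩q⊆q U P) (p∩q⊆q D Q)
              (many-unvisited (λ x∈Q x∈P → P#Q x∈P x∈Q) 3m≤P D≡2m len (cover ∘ p⊆p∪q Q) m≤DQ) m≤DQ
        in t , s , p∩q⊆p D Q t∈ , p∩q⊆p U P s∈ , R-sym Rst , inj₂ (p∩q⊆q D Q t∈ , p∩q⊆q U P s∈)
        where
        open ℕ.≤-Reasoning
        m≤DQ : m ≤ ∣ D ∩ Q ∣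
        m≤DQ = ℕ.+-cancelˡ-≤ m m _ (begin
          m + m                  ≡⟨ D≡2m ⟨
          ∣ D ∣                  ≤⟨ cover-size (D ∩ P) (D ∩ Q)
                                     (λ x∈D → [ (λ x∈P → inj₁ (x∈p∩q⁺ (x∈D , x∈P))) , (λ x∈Q → inj₂ (x∈p∩q⁺ (x∈D , x∈Q))) ]′
                                                (x∈p∪q⁻ P Q (D⊆ x∈D))) ⟩
          ∣ D ∩ P ∣ + ∣ D ∩ Q ∣  ≤⟨ ℕ.+-monoˡ-≤ _ (ℕ.<⇒≤ (ℕ.≰⇒> m≰DP)) ⟩
          m + ∣ D ∩ Q ∣          ∎)

      alternates : ∀ {P Q u w xs k} → Disjoint P Q → (∀ {u v} → Across u v → u ∈ P × v ∈ Q ⊎ u ∈ Q × v ∈ P) →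
                   Path Across u w xs → length xs ≡ suc k → u ∈ P → w ∈ side k P Q
      alternates P#Q cross [ v ] refl u∈P = u∈P
      alternates {k = zero}  P#Q cross (_ ∷ [ _ ]) () u∈P
      alternates {k = zero}  P#Q cross (_ ∷ (_ ∷ _)) () u∈P
      alternates {k = suc k} P#Q cross (Auv ∷ p) len u∈P with cross Auv
      ... | inj₁ (_ , v∈Q) = alternates (λ x∈Q x∈P → P#Q x∈P x∈Q) (Sum.swap ∘ cross) p (ℕ.suc-injective len) v∈Q
      ... | inj₂ (u∈Q , _) = contradiction u∈Q (P#Q u∈P)

      -- The search cannot control the side of the start. One vertex is therefore found in excess:
      -- the last is dropped if the path starts in `P`, the first if it starts in `Q`.
      prune : ∀ {k u w xs} → Path Across u w xs → Unique xs → All (_∈ P ∪ Q) xs → length xs ≡ 2 + k →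
              ∃[ u ] ∃[ w ] ∃[ xs ] (u ∈ P × Path Across u w xs × Unique xs × All (_∈ P ∪ Q) xs × length xs ≡ suc k)
      prune {k} {xs = xs} (Auv@(_ , inj₁ (u∈P , _)) ∷ p) uniq within len =
        let w , q = Path-take (Auv ∷ p) k (subst (k <_) (sym len) (s≤s (ℕ.n≤1+n k)))
        in _ , w , _ , u∈P , q , Unique.take⁺ (suc k) uniq , All.take⁺ (suc k) within
           , trans (List.length-take (suc k) xs) (ℕ.m≤n⇒m⊓n≡m (subst (suc k ≤_) (sym len) (s≤s (ℕ.n≤1+n k))))
      prune ((_ , inj₂ (_ , v∈P)) ∷ p) (_ ∷ uniq) (_ ∷ within) len =
        _ , _ , _ , v∈P , p , uniq , within , ℕ.suc-injective len

    alternating-path : ∀ k → suc k ≤ m → ∃[ x ] ∃[ y ] ∃[ xs ]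
      (x ∈ P × y ∈ side k P Q × Path R x y xs × Unique xs × All (_∈ P ∪ Q) xs × length xs ≡ suc k)
    alternating-path k k<m =
      let _ , _ , _ , p , uniq , within , len = long-path across? across-sym (P ∪ Q) (m + m) (suc k)
            (ℕ.≤-trans 0<m (ℕ.m≤m+n m m)) d≤V
            (λ D U xs D⊆ D≡ len → expand D U xs D⊆ D≡ (ℕ.≤-trans len k<m))
          x , y , xs , x∈P , q , uniq′ , within′ , len′ = prune p uniq within len
      in x , y , xs , x∈P , alternates P#Q proj₂ q len′ x∈P , Path-map proj₁ q , uniq′ , within′ , len′
      where
      open ℕ.≤-Reasoning
      d≤V : m + m ≤ ∣ P ∪ Q ∣
      d≤V = begin
        m + m          ≤⟨ ℕ.+-monoʳ-≤ m (ℕ.m≤m+n m (m + 0)) ⟩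
        3 * m          ≤⟨ 3m≤P ⟩
        ∣ P ∣          ≤⟨ ∣p∣≤∣p∪q∣ P Q ⟩
        ∣ P ∪ Q ∣      ∎

-- Cycles of a prescribed length

side-⊆ : ∀ {n} k {A B A′ B′ : Subset n} → A′ ⊆ A → B′ ⊆ B → side k A′ B′ ⊆ side k A B
side-⊆ zero    A′⊆A B′⊆B = A′⊆A
side-⊆ (suc k) A′⊆A B′⊆B = side-⊆ k B′⊆B A′⊆A

side-─ : ∀ {n} k (A B X : Subset n) → side k (A ─ X) (B ─ X) ≡ side k A B ─ X
side-─ zero    A B X = refl
side-─ (suc k) A B X = side-─ k B A X

module _ {n} {R : Rel (Fin n) 0ℓ} (R? : Decidable₂ R) (R-sym : Symmetric R) where

  -- The cycle runs along a path with k edges in P₁ ∪ Q₁, whose start has a neighbour in Q₂ and whose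
  -- end has one in P₃; from these neighbours branch trees of depth r in P₂ ∪ Q₂ and P₃ ∪ Q₃, and
  -- an edge between their leaves closes it.
  record Gadget (m k r : ℕ) : Set where
    field
      P₁ Q₁ P₂ Q₂ P₃ Q₃ : Subset n
      P₁#Q₁ : Disjoint P₁ Q₁
      P₂#Q₂ : Disjoint P₂ Q₂
      P₃#Q₃ : Disjoint P₃ Q₃
      1#2   : Disjoint (P₁ ∪ Q₁) (P₂ ∪ Q₂)
      1#3   : Disjoint (P₁ ∪ Q₁) (P₃ ∪ Q₃)
      2#3   : Disjoint (P₂ ∪ Q₂) (P₃ ∪ Q₃)
      -- Up to `2 m` vertices without a neighbour in a core are deleted, which leaves the `3 m` of
      -- the search; `8 m` is the requirement of `ExpandingCore`.
      5m≤P₁ : 5 * m ≤ ∣ P₁ ∣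
      5m≤Q₁ : 5 * m ≤ ∣ Q₁ ∣
      8m≤P₂ : 8 * m ≤ ∣ P₂ ∣
      8m≤Q₂ : 8 * m ≤ ∣ Q₂ ∣
      8m≤P₃ : 8 * m ≤ ∣ P₃ ∣
      8m≤Q₃ : 8 * m ≤ ∣ Q₃ ∣
      P₁-Q₁ : Joined R m P₁ Q₁
      P₂-Q₂ : Joined R m P₂ Q₂
      P₃-Q₃ : Joined R m P₃ Q₃
      Q₂-P₁ : Joined R m Q₂ P₁
      P₃-end : Joined R m P₃ (side k P₁ Q₁)
      -- The trees are rooted in `Q₂` and `P₃`, which determines the sides of their leaves.
      tips  : Joined R m (side r Q₂ P₂) (side r P₃ Q₃)

  module _ {m k r} (0<m : 0 < m) (k<m : suc k ≤ m) (m≤2^r : m ≤ 2 ^ r) (2^r<2m : 2 ^ r < 2 * m)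
           (G : Gadget m k r) where

    open Gadget G

    module WithCores
      (core₂ : ExpandingCore R? P₂-Q₂ (Joined-sym R-sym P₂-Q₂) 8m≤P₂ 8m≤Q₂ 0<m)
      (core₃ : ExpandingCore R? P₃-Q₃ (Joined-sym R-sym P₃-Q₃) 8m≤P₃ 8m≤Q₃ 0<m) where

      open ExpandingCore core₂ using () renaming
        (A′ to P₂′; B′ to Q₂′; A′⊆A to P₂′⊆; B′⊆B to Q₂′⊆; m≤B′ to m≤Q₂′; A′⇒B′ to P₂⇒Q₂; B′⇒A′ to Q₂⇒P₂)
      open ExpandingCore core₃ using () renaming
        (A′ to P₃′; B′ to Q₃′; A′⊆A to P₃′⊆; B′⊆B to Q₃′⊆; m≤A′ to m≤P₃′; A′⇒B′ to P₃⇒Q₃; B′⇒A′ to Q₃⇒P₃)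

      -- Possible starts without a neighbour in `Q₂′` and possible ends without one in `P₃′`. Once
      -- they are gone, every alternating path has roots for both trees next to its ends.
      Y X₂ X₃ X : Subset n
      Y = side k P₁ Q₁
      X₂ = P₁ ─ nb R? Q₂′ P₁
      X₃ = Y ─ nb R? P₃′ Y
      X = X₂ ∪ X₃

      X≤2m : ∣ X ∣ ≤ m + m
      X≤2m = ℕ.≤-trans (∣p∪q∣≤∣p∣+∣q∣ X₂ X₃) (ℕ.+-mono-≤
        (ℕ.<⇒≤ (few-without-neighbour R? (Joined-⊆ Q₂′⊆ id Q₂-P₁) m≤Q₂′))
        (ℕ.<⇒≤ (few-without-neighbour R? (Joined-⊆ P₃′⊆ id P₃-end) m≤P₃′)))

      still-large : ∀ {P} → 5 * m ≤ ∣ P ∣ → 3 * m ≤ ∣ P ─ X ∣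
      still-large {P} 5m≤P = ℕ.+-cancelˡ-≤ (m + m) (3 * m) _ (begin
        m + m + 3 * m         ≡⟨ solve 1 (λ m → m :+ m :+ con 3 :* m := con 5 :* m) refl m ⟩
        5 * m                 ≤⟨ 5m≤P ⟩
        ∣ P ∣                 ≤⟨ ∣p∣≤∣q∣+∣p─q∣ P X ⟩
        ∣ X ∣ + ∣ P ─ X ∣     ≤⟨ ℕ.+-monoˡ-≤ _ X≤2m ⟩
        m + m + ∣ P ─ X ∣     ∎)
        where
        open ℕ.≤-Reasoning
        open +-*-Solver

      rescue : ∀ {P N : Subset n} {v} → v ∈ P → v ∉ P ─ N → v ∈ N
      rescue {P} {N} {v} v∈P v∉ with v ∈? N
      ... | yes v∈N = v∈N
      ... | no v∉N = contradiction (x∈p∧x∉q⇒x∈p─q v∈P v∉N) v∉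

      Rim : Fin n → Fin n → Set
      Rim x y = ∃[ xs ] (Path R x y xs × Unique xs × All (_∈ P₁ ∪ Q₁) xs × length xs ≡ suc k)

      Branch : (A B : Subset n) (v u : Fin n) → Set
      Branch A B v u = ∃[ xs ] (Path R u v xs × Unique xs × All (λ x → x ∈ A ⊎ x ∈ B) xs × length xs ≡ suc r)

      close : ∀ {x y a b u w} → Rim x y → Branch Q₂′ P₂′ a u → Branch P₃′ Q₃′ b w → R a x → R b y → R u w →
              Cycle R (suc r + (suc k + suc r))
      close {u = u} {w} (xs , x→y , uniq , xs⊆ , len) (ys , u→a , uniq-ys , ys⊆ , len-ys)
            (zs , w→b , uniq-zs , zs⊆ , len-zs) Rax Rby Ruw =
        u , w , ys ++ (xs ++ reverse zs)
        , Path-join u→a Rax (Path-join x→y (R-sym Rby) (Path-reverse R-sym w→b))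
        , R-sym Ruw
        , Unique.++⁺ uniq-ys (Unique.++⁺ uniq (Unique-reverse uniq-zs)
            (λ (v∈xs , v∈zs) → 1#3 (All.lookup xs⊆ v∈xs) (in₃ v∈zs)))
            (λ (v∈ys , v∈) → [ (λ v∈xs → 1#2 (All.lookup xs⊆ v∈xs) (in₂ v∈ys))
                             , (λ v∈zs → 2#3 (in₂ v∈ys) (in₃ v∈zs)) ]′ (List∈.∈-++⁻ xs v∈))
        , trans (List.length-++ ys) (cong₂ _+_ len-ys (trans (List.length-++ xs)
            (cong₂ _+_ len (trans (List.length-reverse zs) len-zs))))
        where
        in₂ : ∀ {v} → v List.∈ ys → v ∈ P₂ ∪ Q₂
        in₂ v∈ = [ q⊆p∪q P₂ Q₂ ∘ Q₂′⊆ , p⊆p∪q Q₂ ∘ P₂′⊆ ]′ (All.lookup ys⊆ v∈)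
        in₃ : ∀ {v} → v List.∈ reverse zs → v ∈ P₃ ∪ Q₃
        in₃ v∈ = [ p⊆p∪q Q₃ ∘ P₃′⊆ , q⊆p∪q P₃ Q₃ ∘ Q₃′⊆ ]′ (All.lookup zs⊆ (Any.reverse⁻ v∈))

      connect : ∀ {x y a b} → Rim x y → Branches R? R-sym Q₂′ P₂′ a r → Branches R? R-sym P₃′ Q₃′ b r →
                R a x → R b y → Cycle R (suc r + (suc k + suc r))
      connect rim B₂ B₃ Rax Rby =
        let u , w , u∈ , w∈ , Ruw = tips (ends B₂) (ends B₃)
              (side-⊆ r Q₂′⊆ P₂′⊆ ∘ ends⊆ B₂) (side-⊆ r P₃′⊆ Q₃′⊆ ∘ ends⊆ B₃)
              (subst (m ≤_) (sym (ends-size B₂)) m≤2^r) (subst (m ≤_) (sym (ends-size B₃)) m≤2^r)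
        in close rim (path B₂ u∈) (path B₃ w∈) Rax Rby Ruw
        where open Branches

      attach : (∃[ x ] ∃[ y ] ∃[ xs ] (x ∈ P₁ ─ X × y ∈ side k (P₁ ─ X) (Q₁ ─ X) × Path R x y xs × Unique xs
                  × All (_∈ (P₁ ─ X) ∪ (Q₁ ─ X)) xs × length xs ≡ suc k)) →
               Cycle R (suc r + (suc k + suc r))
      attach (x , y , xs , x∈ , y∈ , x→y , uniq , within , len) =
        let _ , a , a∈ , Rax = nb⁻ R? {Q₂′} {P₁} (rescue (p─q⊆p P₁ X x∈) (x∈p─q⇒x∉q P₁ X x∈ ∘ p⊆p∪q X₃))
            _ , b , b∈ , Rby = nb⁻ R? {P₃′} {Y} (rescue (p─q⊆p Y X y∈′) (x∈p─q⇒x∉q Y X y∈′ ∘ q⊆p∪q X₂ X₃))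
        in connect (xs , x→y , uniq , All.map within-rim within , len)
             (grow-branches R? R-sym r (λ v∈Q v∈P → P₂#Q₂ (P₂′⊆ v∈P) (Q₂′⊆ v∈Q)) Q₂⇒P₂ P₂⇒Q₂ 2^r<2m a∈)
             (grow-branches R? R-sym r (λ v∈P v∈Q → P₃#Q₃ (P₃′⊆ v∈P) (Q₃′⊆ v∈Q)) P₃⇒Q₃ Q₃⇒P₃ 2^r<2m b∈)
             Rax Rby
        where
        y∈′ : y ∈ Y ─ X
        y∈′ = subst (y ∈_) (side-─ k P₁ Q₁ X) y∈
        within-rim : ∀ {v} → v ∈ (P₁ ─ X) ∪ (Q₁ ─ X) → v ∈ P₁ ∪ Q₁
        within-rim v∈ = [ p⊆p∪q Q₁ ∘ p─q⊆p P₁ X , q⊆p∪q P₁ Q₁ ∘ p─q⊆p Q₁ X ]′ (x∈p∪q⁻ (P₁ ─ X) (Q₁ ─ X) v∈)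

      attached : Cycle R (suc r + (suc k + suc r))
      attached = attach (alternating-path R? R-sym 0<m {P₁ ─ X} {Q₁ ─ X}
            (λ v∈P v∈Q → P₁#Q₁ (p─q⊆p P₁ X v∈P) (p─q⊆p Q₁ X v∈Q))
            (Joined-⊆ (p─q⊆p P₁ X) (p─q⊆p Q₁ X) P₁-Q₁)
            (still-large {P₁} 5m≤P₁) (still-large {Q₁} 5m≤Q₁) k k<m)

    gadget-cycle : Cycle R (suc r + (suc k + suc r))
    gadget-cycle = WithCores.attached (expandingCore R? P₂-Q₂ (Joined-sym R-sym P₂-Q₂) 8m≤P₂ 8m≤Q₂ 0<m)
                                       (expandingCore R? P₃-Q₃ (Joined-sym R-sym P₃-Q₃) 8m≤P₃ 8m≤Q₃ 0<m)

-- Separating all colours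

carve : ∀ {n} (A : Subset n) a b → a + b ≤ ∣ A ∣ →
        ∃[ B ] ∃[ C ] (B ⊆ A × C ⊆ A × Disjoint B C × a ≤ ∣ B ∣ × b ≤ ∣ C ∣)
carve A a b a+b≤A =
  let B , B⊆A , B≡a = sub-of-size A (ℕ.m+n≤o⇒m≤o a a+b≤A)
  in B , A ─ B , B⊆A , p─q⊆p A B , (λ x∈B x∈A─B → x∈p─q⇒x∉q A B x∈A─B x∈B) , ℕ.≤-reflexive (sym B≡a)
     , ℕ.+-cancelˡ-≤ a b _ (ℕ.≤-trans a+b≤A (ℕ.≤-trans (∣p∣≤∣q∣+∣p─q∣ A B) (ℕ.≤-reflexive (cong (_+ ∣ A ─ B ∣) B≡a))))

dyadic : ∀ m → 0 < m → ∃[ r ] (m ≤ 2 ^ r × 2 ^ r < 2 * m)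
dyadic (suc zero) _ = 0 , ℕ.≤-refl , ℕ.≤-refl
dyadic (suc m@(suc _)) _ with dyadic m (s≤s z≤n)
... | r , m≤2^r , 2^r<2m with suc m ℕ.≤? 2 ^ r
...   | yes m<2^r = r , m<2^r , ℕ.≤-trans 2^r<2m (ℕ.*-monoʳ-≤ 2 (ℕ.n≤1+n m))
...   | no  m≮2^r = suc r , subst (λ z → suc m ≤ 2 * z) m≡2^r (s≤s (ℕ.≤-trans (ℕ.≤-reflexive (ℕ.+-comm 1 _))
                       (ℕ.+-monoʳ-≤ _ (s≤s z≤n)))) , subst (λ z → 2 * z < 2 * suc m) m≡2^r (ℕ.*-monoʳ-< 2 (ℕ.n<1+n m))
  where
  m≡2^r : m ≡ 2 ^ r
  m≡2^r = ℕ.≤-antisym m≤2^r (s≤s⁻¹ (ℕ.≰⇒> m≮2^r))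

side-even : ∀ {A : Set} j (a b : A) → side (j * 2) a b ≡ a
side-even zero    a b = refl
side-even (suc j) a b = side-even j a b

-- From `2 ^ r < 2 m ≤ 13 m ≤ 2 ^ d` follows `r < d`, so `2 d + 2 ≤ ℓ` leaves at least one vertex
-- for the path beside the `2 (r + 1)` of the two branches.
split-length : ∀ {m d ℓ} → 0 < m → 13 * m ≤ 2 ^ d → 2 * d + 2 ≤ ℓ → ℓ ≤ m →
               ∃[ r ] ∃[ k ] (m ≤ 2 ^ r × 2 ^ r < 2 * m × suc k ≤ m × suc r + (suc k + suc r) ≡ ℓ)
split-length {m} {d} {ℓ} 0<m 13m≤2^d 2d+2≤ℓ ℓ≤m =
  let r , m≤2^r , 2^r<2m = dyadic m 0<m
      k , eq = ℕ.m≤n⇒∃[o]m+o≡n (enough r 2^r<2m)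
      eq′ = trans (solve 2 (λ r k → (con 1 :+ r) :+ ((con 1 :+ k) :+ (con 1 :+ r)) := con 2 :* r :+ con 3 :+ k)
               refl r k) eq
  in r , k , m≤2^r , 2^r<2m
     , ℕ.≤-trans (ℕ.≤-trans (ℕ.m≤m+n (suc k) (suc r)) (ℕ.m≤n+m (suc k + suc r) (suc r))) (ℕ.≤-trans (ℕ.≤-reflexive eq′) ℓ≤m)
     , eq′
  where
  open +-*-Solver
  open ℕ.≤-Reasoning
  r<d : ∀ r → 2 ^ r < 2 * m → suc r ≤ d
  r<d r 2^r<2m = ℕ.≰⇒> λ d≤r → ℕ.<-irrefl refl (begin-strict
    13 * m     ≤⟨ 13m≤2^d ⟩
    2 ^ d      ≤⟨ ℕ.^-monoʳ-≤ 2 d≤r ⟩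
    2 ^ r      <⟨ 2^r<2m ⟩
    2 * m      ≤⟨ ℕ.*-monoˡ-≤ m {2} {13} (s≤s (s≤s z≤n)) ⟩
    13 * m     ∎)
  enough : ∀ r → 2 ^ r < 2 * m → 2 * r + 3 ≤ ℓ
  enough r 2^r<2m = begin
    2 * r + 3        ≤⟨ ℕ.n≤1+n _ ⟩
    suc (2 * r + 3)  ≡⟨ solve 1 (λ r → con 1 :+ (con 2 :* r :+ con 3) := con 2 :* (con 1 :+ r) :+ con 2) refl r ⟩
    2 * suc r + 2    ≤⟨ ℕ.+-monoˡ-≤ 2 (ℕ.*-monoʳ-≤ 2 (r<d r 2^r<2m)) ⟩
    2 * d + 2        ≤⟨ 2d+2≤ℓ ⟩
    ℓ                ∎

odd-rim : ∀ {ℓ} r k → 2 ∣ ℓ → suc r + (suc k + suc r) ≡ ℓ → ∃[ j ] k ≡ suc (j * 2)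
odd-rim r k 2∣ℓ refl = from-divisor (∣m+n∣m⇒∣n (subst (2 ∣_) regroup 2∣ℓ) (n∣m*n r))
  where
  regroup : suc r + (suc k + suc r) ≡ r * 2 + (3 + k)
  regroup = solve 2 (λ r k → (con 1 :+ r) :+ ((con 1 :+ k) :+ (con 1 :+ r)) := r :* con 2 :+ (con 3 :+ k)) refl r k
    where open +-*-Solver
  from-divisor : 2 ∣ 3 + k → ∃[ j ] k ≡ suc (j * 2)
  from-divisor (divides (suc (suc j)) eq) = j , ℕ.suc-injective (ℕ.suc-injective (ℕ.suc-injective eq))
  from-divisor (divides zero ())
  from-divisor (divides (suc zero) ())

module _ {A : Set} {P : A → Set} (P? : Decidable P) where

  count-yes : ∀ {k x} {xs : Vec A k} → P x → count P? (x ∷ xs) ≡ suc (count P? xs)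
  count-yes {x = x} px with P? x
  ... | yes _  = refl
  ... | no ¬px = contradiction px ¬px

  count-no : ∀ {k x} {xs : Vec A k} → ¬ P x → count P? (x ∷ xs) ≡ count P? xs
  count-no {x = x} ¬px with P? x
  ... | yes px = contradiction px ¬px
  ... | no _   = refl

-- The value 2 cuts a set into two of `m` vertices each. The square arises because `odd-pair` uses
-- its induction hypothesis again inside the sets that it has produced.
oddFactor : ℕ → ℕ
oddFactor zero    = 2
oddFactor (suc t) = 13 * (oddFactor t * oddFactor t)

oddFactor>0 : ∀ t → 0 < oddFactor t
oddFactor>0 zero    = s≤s z≤n
oddFactor>0 (suc t) = ℕ.*-mono-≤ {1} {13} (s≤s z≤n) (ℕ.*-mono-≤ (oddFactor>0 t) (oddFactor>0 t))

module _ {v t} (E : Fin t → Rel (Fin v) 0ℓ) (E? : ∀ i → Decidable₂ (E i)) (E-sym : ∀ i → Symmetric (E i))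
         (ℓ : Fin t → ℕ) (d n : ℕ) (0<n : 0 < n) (v≤2^d : v ≤ 2 ^ d)
         (ℓ≥ : ∀ i → 2 * d + 2 ≤ ℓ i) (ℓ≤n : ∀ i → ℓ i ≤ n) where

  Found : Set
  Found = ∃[ i ] Cycle (E i) (ℓ i)

  Odd Even : Fin t → Set
  Odd  i = ¬ 2 ∣ ℓ i
  Even i = 2 ∣ ℓ i

  -- `P` is `Odd` or `Even`: colours of the other parity impose no condition, so both phases run
  -- over the same vector of all colours.
  record Pair (P : Fin t → Set) {k} (is : Vec (Fin t) k) (m : ℕ) (A B : Subset v) : Set where
    constructor pair
    field
      S T : Subset v
      S⊆A : S ⊆ A
      T⊆B : T ⊆ B
      S#T : Disjoint S T
      m≤S : m ≤ ∣ S ∣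
      m≤T : m ≤ ∣ T ∣
      separated : VecAll.All (λ i → P i → Separated (E i) S T) is

  private
    module _ {m} (n≤m : n ≤ m) (13m≤v : 13 * m ≤ v) (i : Fin t) where
      length-split : ∃[ r ] ∃[ k ] (m ≤ 2 ^ r × 2 ^ r < 2 * m × suc k ≤ m × suc r + (suc k + suc r) ≡ ℓ i)
      length-split = split-length {d = d} (ℕ.≤-trans 0<n n≤m) (ℕ.≤-trans 13m≤v v≤2^d) (ℓ≥ i) (ℕ.≤-trans (ℓ≤n i) n≤m)

      found : (∀ {r k} → m ≤ 2 ^ r → suc r + (suc k + suc r) ≡ ℓ i → Gadget (E? i) (E-sym i) m k r) → Found
      found gadget =
        let r , k , m≤2^r , 2^r<2m , k<m , eq = length-split
        in i , subst (Cycle (E i)) eq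
                 (gadget-cycle (E? i) (E-sym i) (ℕ.≤-trans 0<n n≤m) k<m m≤2^r 2^r<2m (gadget m≤2^r eq))

    Disjoint-∪ : ∀ {A B C D : Subset v} → Disjoint A C → Disjoint A D → Disjoint B C → Disjoint B D →
                 Disjoint (A ∪ B) (C ∪ D)
    Disjoint-∪ {A} {B} {C} {D} A#C A#D B#C B#D x∈ y∈ with x∈p∪q⁻ A B x∈ | x∈p∪q⁻ C D y∈
    ... | inj₁ x∈A | inj₁ x∈C = A#C x∈A x∈C
    ... | inj₁ x∈A | inj₂ x∈D = A#D x∈A x∈D
    ... | inj₂ x∈B | inj₁ x∈C = B#C x∈B x∈C
    ... | inj₂ x∈B | inj₂ x∈D = B#D x∈B x∈D

    Disjoint-⊆ : ∀ {A B A′ B′ : Subset v} → A′ ⊆ A → B′ ⊆ B → Disjoint A B → Disjoint A′ B′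
    Disjoint-⊆ A′⊆A B′⊆B A#B x∈A′ x∈B′ = A#B (A′⊆A x∈A′) (B′⊆B x∈B′)

    Disjoint-sym : ∀ {A B : Subset v} → Disjoint A B → Disjoint B A
    Disjoint-sym A#B x∈B x∈A = A#B x∈A x∈B

    joined-sides : ∀ {R : Rel (Fin v) 0ℓ} {m} r {A B C D} → Joined R m A C → Joined R m B D →
                   Joined R m (side r A B) (side r C D)
    joined-sides zero    A-C B-D = A-C
    joined-sides (suc r) A-C B-D = joined-sides r B-D A-C

    separated-⊆ : ∀ {P : Fin t → Set} {k} {is : Vec (Fin t) k} {A B A′ B′} → A′ ⊆ A → B′ ⊆ B →
                  VecAll.All (λ i → P i → Separated (E i) A B) is → VecAll.All (λ i → P i → Separated (E i) A′ B′) is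
    separated-⊆ {P} {A = A} {B} {A′} {B′} A′⊆ B′⊆ = VecAll.map weaken
      where
      weaken : ∀ {i} → (P i → Separated (E i) A B) → P i → Separated (E i) A′ B′
      weaken sep Pi s∈ t∈ = sep Pi (A′⊆ s∈) (B′⊆ t∈)

    restrict : ∀ {P : Fin t → Set} {k} {is : Vec (Fin t) k} {m A B} → (p : Pair P is m A B) → ∀ {A′ B′} → A′ ⊆ Pair.S p → B′ ⊆ Pair.T p →
               VecAll.All (λ i → P i → Separated (E i) A′ B′) is
    restrict {P} p A′⊆ B′⊆ = separated-⊆ {P} A′⊆ B′⊆ (Pair.separated p)

    extend : ∀ {P : Fin t → Set} {k} {is : Vec (Fin t) k} {m A B i} → ¬ P i → Pair P is m A B → Pair P (i ∷ is) m A B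
    extend ¬Pi (pair S T S⊆A T⊆B S#T m≤S m≤T sep) =
      pair S T S⊆A T⊆B S#T m≤S m≤T ((λ Pi → contradiction Pi ¬Pi) ∷ sep)

    shrink : ∀ {P : Fin t → Set} {k} {is : Vec (Fin t) k} {m i X Y A B} → X ⊆ A → Y ⊆ B → Disjoint X Y →
             VecAll.All (λ i → P i → Separated (E i) X Y) is → Hole (E i) m X Y → Pair P (i ∷ is) m A B
    shrink {P} X⊆A Y⊆B X#Y sep (S , T , S⊆X , T⊆Y , S≡m , T≡m , hole) =
      pair S T (X⊆A ∘ S⊆X) (Y⊆B ∘ T⊆Y) (λ s∈ t∈ → X#Y (S⊆X s∈) (T⊆Y t∈))
        (ℕ.≤-reflexive (sym S≡m)) (ℕ.≤-reflexive (sym T≡m))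
        ((λ _ → hole) ∷ separated-⊆ {P} S⊆X T⊆Y sep)

  -- In the gadget used here all edges run between S and T; ℓ i being even forces k to be odd, so
  -- that the path ends in T, which is joined to P₃.
  even-pair : ∀ {k} (is : Vec (Fin t) k) {m A B} → n ≤ m → Disjoint A B →
              21 ^ count (2 ∣?_) (Vec.map ℓ is) * m ≤ ∣ A ∣ → 21 ^ count (2 ∣?_) (Vec.map ℓ is) * m ≤ ∣ B ∣ →
              Found ⊎ Pair Even is m A B
  even-pair [] {m} {A} {B} n≤m A#B A≥ B≥ = inj₂ (pair A B id id A#B
    (subst (_≤ ∣ A ∣) (ℕ.+-identityʳ m) A≥) (subst (_≤ ∣ B ∣) (ℕ.+-identityʳ m) B≥) [])
  even-pair (i ∷ is) {m} {A} {B} n≤m A#B A≥ B≥ = decide (2 ∣? ℓ i)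
    where
    f = 21 ^ count (2 ∣?_) (Vec.map ℓ is)
    regroup : 21 * f * m ≡ f * (21 * m)
    regroup = solve 2 (λ f m → con 21 :* f :* m := f :* (con 21 :* m)) refl f m
      where open +-*-Solver

    step : Even i → Pair Even is (21 * m) A B → Found ⊎ Pair Even (i ∷ is) m A B
    step even (pair S T S⊆A T⊆B S#T 21m≤S 21m≤T sep) with joined-or-hole (E? i) m S T
    ... | inj₂ hole = inj₂ (shrink S⊆A T⊆B S#T sep hole)
    ... | inj₁ S-T = inj₁ (gadget
        (carve S (5 * m) (8 * m + 8 * m) (subst (_≤ ∣ S ∣) three 21m≤S))
        (carve T (5 * m) (8 * m + 8 * m) (subst (_≤ ∣ T ∣) three 21m≤T)))
      where
      -- One piece for the path and one for each of the two trees, on either side.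
      three : 21 * m ≡ 5 * m + (8 * m + 8 * m)
      three = solve 1 (λ m → con 21 :* m := con 5 :* m :+ (con 8 :* m :+ con 8 :* m)) refl m
        where open +-*-Solver
      13m≤v : 13 * m ≤ v
      13m≤v = ℕ.≤-trans (ℕ.*-monoˡ-≤ m (ℕ.m≤m+n 13 8)) (ℕ.≤-trans 21m≤S (∣p∣≤n S))
      Carving : Subset v → ℕ → ℕ → Set
      Carving A a b = ∃[ B ] ∃[ C ] (B ⊆ A × C ⊆ A × Disjoint B C × a ≤ ∣ B ∣ × b ≤ ∣ C ∣)
      gadget : Carving S (5 * m) (8 * m + 8 * m) → Carving T (5 * m) (8 * m + 8 * m) → Found
      gadget (P₁ , S′ , P₁⊆S , S′⊆S , P₁#S′ , P₁≥ , S′≥) (Q₁ , T′ , Q₁⊆T , T′⊆T , Q₁#T′ , Q₁≥ , T′≥)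
        with carve S′ (8 * m) (8 * m) S′≥ | carve T′ (8 * m) (8 * m) T′≥
      ... | P₂ , P₃ , P₂⊆S′ , P₃⊆S′ , P₂#P₃ , P₂≥ , P₃≥ | Q₂ , Q₃ , Q₂⊆T′ , Q₃⊆T′ , Q₂#Q₃ , Q₂≥ , Q₃≥ =
        found n≤m 13m≤v i λ {r} {k} _ len → record
          { P₁ = P₁ ; Q₁ = Q₁ ; P₂ = P₂ ; Q₂ = Q₂ ; P₃ = P₃ ; Q₃ = Q₃
          ; P₁#Q₁ = Disjoint-⊆ P₁⊆S Q₁⊆T S#T
          ; P₂#Q₂ = Disjoint-⊆ P₂⊆S Q₂⊆T S#T
          ; P₃#Q₃ = Disjoint-⊆ P₃⊆S Q₃⊆T S#T
          ; 1#2 = Disjoint-∪ (Disjoint-⊆ id P₂⊆S′ P₁#S′) (Disjoint-⊆ P₁⊆S Q₂⊆T S#T)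
                    (Disjoint-⊆ Q₁⊆T P₂⊆S (Disjoint-sym S#T)) (Disjoint-⊆ id Q₂⊆T′ Q₁#T′)
          ; 1#3 = Disjoint-∪ (Disjoint-⊆ id P₃⊆S′ P₁#S′) (Disjoint-⊆ P₁⊆S Q₃⊆T S#T)
                    (Disjoint-⊆ Q₁⊆T P₃⊆S (Disjoint-sym S#T)) (Disjoint-⊆ id Q₃⊆T′ Q₁#T′)
          ; 2#3 = Disjoint-∪ P₂#P₃ (Disjoint-⊆ P₂⊆S Q₃⊆T S#T)
                    (Disjoint-⊆ Q₂⊆T P₃⊆S (Disjoint-sym S#T)) Q₂#Q₃
          ; 5m≤P₁ = P₁≥ ; 5m≤Q₁ = Q₁≥ ; 8m≤P₂ = P₂≥ ; 8m≤Q₂ = Q₂≥ ; 8m≤P₃ = P₃≥ ; 8m≤Q₃ = Q₃≥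
          ; P₁-Q₁ = Joined-⊆ P₁⊆S Q₁⊆T S-T
          ; P₂-Q₂ = Joined-⊆ P₂⊆S Q₂⊆T S-T
          ; P₃-Q₃ = Joined-⊆ P₃⊆S Q₃⊆T S-T
          ; Q₂-P₁ = Joined-⊆ Q₂⊆T P₁⊆S T-S
          ; P₃-end = let j , k≡ = odd-rim r k even len in
              subst (Joined (E i) m P₃) (sym (trans (cong (λ k → side k P₁ Q₁) k≡) (side-even j Q₁ P₁)))
                (Joined-⊆ P₃⊆S Q₁⊆T S-T)
          ; tips = joined-sides r (Joined-⊆ Q₂⊆T P₃⊆S T-S) (Joined-⊆ P₂⊆S Q₃⊆T S-T)
          }
        where
        P₂⊆S : P₂ ⊆ S
        P₂⊆S = S′⊆S ∘ P₂⊆S′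
        P₃⊆S : P₃ ⊆ S
        P₃⊆S = S′⊆S ∘ P₃⊆S′
        Q₂⊆T : Q₂ ⊆ T
        Q₂⊆T = T′⊆T ∘ Q₂⊆T′
        Q₃⊆T : Q₃ ⊆ T
        Q₃⊆T = T′⊆T ∘ Q₃⊆T′
        T-S : Joined (E i) m T S
        T-S = Joined-sym (E-sym i) S-T

    decide : Dec (Even i) → Found ⊎ Pair Even (i ∷ is) m A B
    decide (no odd) = map₂ (extend odd) (even-pair is n≤m A#B
      (subst (λ e → 21 ^ e * m ≤ ∣ A ∣) (count-no (2 ∣?_) {xs = Vec.map ℓ is} odd) A≥)
      (subst (λ e → 21 ^ e * m ≤ ∣ B ∣) (count-no (2 ∣?_) {xs = Vec.map ℓ is} odd) B≥))
    -- The other colours are treated first with `21 * m` in place of `m`, which leaves room for the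
    -- gadget in colour `i`.
    decide (yes even) = [ inj₁ , step even ]′ (even-pair is (ℕ.≤-trans n≤m (ℕ.m≤n*m m 21)) A#B
      (subst (_≤ ∣ A ∣) regroup (subst (λ e → 21 ^ e * m ≤ ∣ A ∣) (count-yes (2 ∣?_) {xs = Vec.map ℓ is} even) A≥))
      (subst (_≤ ∣ B ∣) regroup (subst (λ e → 21 ^ e * m ≤ ∣ B ∣) (count-yes (2 ∣?_) {xs = Vec.map ℓ is} even) B≥)))

  -- Applying the induction hypothesis twice yields four sets, any two of which are separated in the
  -- earlier colours; with four pairwise joined sets no parity condition on ℓ i is needed.
  odd-pair : ∀ {k} (is : Vec (Fin t) k) {m A} → n ≤ m →
             oddFactor (count (¬? ∘ (2 ∣?_)) (Vec.map ℓ is)) * m ≤ ∣ A ∣ → Found ⊎ Pair Odd is m A A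
  odd-pair [] {m} {A} n≤m A≥ =
    let B , C , B⊆A , C⊆A , B#C , B≥ , C≥ = carve A m m (subst (_≤ ∣ A ∣) (cong (m +_) (ℕ.+-identityʳ m)) A≥)
    in inj₂ (pair B C B⊆A C⊆A B#C B≥ C≥ [])
  odd-pair (i ∷ is) {m} {A} n≤m A≥ = decide (2 ∣? ℓ i)
    where
    odd? = ¬? ∘ (2 ∣?_)
    f = oddFactor (count (¬? ∘ (2 ∣?_)) (Vec.map ℓ is))
    n≤13m : n ≤ 13 * m
    n≤13m = ℕ.≤-trans n≤m (ℕ.m≤n*m m 13)
    n≤f13m : n ≤ f * (13 * m)
    n≤f13m = ℕ.≤-trans n≤13m (ℕ.m≤n*m (13 * m) f {{>-nonZero (oddFactor>0 (count (¬? ∘ (2 ∣?_)) (Vec.map ℓ is)))}})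
    regroup : 13 * (f * f) * m ≡ f * (f * (13 * m))
    regroup = solve 2 (λ f m → con 13 :* (f :* f) :* m := f :* (f :* (con 13 :* m))) refl f m
      where open +-*-Solver

    step : Pair Odd is (f * (13 * m)) A A → Found ⊎ Pair Odd (i ∷ is) m A A
    step p@(pair S T S⊆A T⊆A S#T f13m≤S f13m≤T _) =
      -- The induction hypothesis is used once inside `S` and once inside `T`; a set in `S` and a
      -- set in `T` inherit the separation of `S` from `T`.
      [ inj₁ , (λ q → [ inj₁ , four q ]′ (odd-pair is n≤13m f13m≤T)) ]′ (odd-pair is n≤13m f13m≤S)
      where
      four : Pair Odd is (13 * m) S S → Pair Odd is (13 * m) T T → Found ⊎ Pair Odd (i ∷ is) m A A
      four q@(pair S₁ S₂ S₁⊆S S₂⊆S S₁#S₂ 13m≤S₁ 13m≤S₂ _) q′@(pair T₁ T₂ T₁⊆T T₂⊆T T₁#T₂ 13m≤T₁ 13m≤T₂ _) =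
        -- Each test gives either a hole, which with the inherited separations is the required pair,
        -- or one more joined pair for the gadget.
        joined-else-pair S₁⊆A S₂⊆A S₁#S₂ (restrict q id id) λ S₁-S₂ →
        joined-else-pair T₁⊆A T₂⊆A T₁#T₂ (restrict q′ id id) λ T₁-T₂ →
        joined-else-pair S₁⊆A T₁⊆A S₁#T₁ (restrict p S₁⊆S T₁⊆T) λ S₁-T₁ →
        joined-else-pair S₁⊆A T₂⊆A S₁#T₂ (restrict p S₁⊆S T₂⊆T) λ S₁-T₂ →
        joined-else-pair S₂⊆A T₁⊆A S₂#T₁ (restrict p S₂⊆S T₁⊆T) λ S₂-T₁ →
        gadget S₁-S₂ T₁-T₂ S₁-T₁ S₁-T₂ S₂-T₁
          (carve S₁ (5 * m) (8 * m) (subst (_≤ ∣ S₁ ∣) two 13m≤S₁))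
          (carve T₂ (5 * m) (8 * m) (subst (_≤ ∣ T₂ ∣) two 13m≤T₂))
        where
        -- `S₁` is cut into `P₁` and `P₂`, `T₂` into `Q₁` and `Q₃`; `S₂` and `T₁` serve whole as
        -- `Q₂` and `P₃`.
        two : 13 * m ≡ 5 * m + 8 * m
        two = ℕ.*-distribʳ-+ m 5 8
        8m≤13m : 8 * m ≤ 13 * m
        8m≤13m = ℕ.*-monoˡ-≤ m (ℕ.m≤m+n 8 5)
        13m≤v : 13 * m ≤ v
        13m≤v = ℕ.≤-trans 13m≤S₁ (∣p∣≤n S₁)
        S₁⊆A : S₁ ⊆ A
        S₁⊆A = S⊆A ∘ S₁⊆S
        S₂⊆A : S₂ ⊆ A
        S₂⊆A = S⊆A ∘ S₂⊆S
        T₁⊆A : T₁ ⊆ A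
        T₁⊆A = T⊆A ∘ T₁⊆T
        T₂⊆A : T₂ ⊆ A
        T₂⊆A = T⊆A ∘ T₂⊆T
        S₁#T₁ : Disjoint S₁ T₁
        S₁#T₁ = Disjoint-⊆ S₁⊆S T₁⊆T S#T
        S₁#T₂ : Disjoint S₁ T₂
        S₁#T₂ = Disjoint-⊆ S₁⊆S T₂⊆T S#T
        S₂#T₁ : Disjoint S₂ T₁
        S₂#T₁ = Disjoint-⊆ S₂⊆S T₁⊆T S#T
        S₂#T₂ : Disjoint S₂ T₂
        S₂#T₂ = Disjoint-⊆ S₂⊆S T₂⊆T S#T

        joined-else-pair : ∀ {X Y} → X ⊆ A → Y ⊆ A → Disjoint X Y →
                           VecAll.All (λ i → Odd i → Separated (E i) X Y) is →
                           (Joined (E i) m X Y → Found ⊎ Pair Odd (i ∷ is) m A A) → Found ⊎ Pair Odd (i ∷ is) m A A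
        joined-else-pair {X} {Y} X⊆A Y⊆A X#Y sep continue with joined-or-hole (E? i) m X Y
        ... | inj₁ X-Y  = continue X-Y
        ... | inj₂ hole = inj₂ (shrink X⊆A Y⊆A X#Y sep hole)

        Carving : Subset v → ℕ → ℕ → Set
        Carving A a b = ∃[ B ] ∃[ C ] (B ⊆ A × C ⊆ A × Disjoint B C × a ≤ ∣ B ∣ × b ≤ ∣ C ∣)

        gadget : Joined (E i) m S₁ S₂ → Joined (E i) m T₁ T₂ → Joined (E i) m S₁ T₁ → Joined (E i) m S₁ T₂ →
                 Joined (E i) m S₂ T₁ → Carving S₁ (5 * m) (8 * m) → Carving T₂ (5 * m) (8 * m) →
                 Found ⊎ Pair Odd (i ∷ is) m A A
        gadget S₁-S₂ T₁-T₂ S₁-T₁ S₁-T₂ S₂-T₁ (P₁ , P₂ , P₁⊆ , P₂⊆ , P₁#P₂ , P₁≥ , P₂≥)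
               (Q₁ , Q₃ , Q₁⊆ , Q₃⊆ , Q₁#Q₃ , Q₁≥ , Q₃≥) = inj₁ (found n≤m 13m≤v i λ {r} {k} _ _ → record
          { P₁ = P₁ ; Q₁ = Q₁ ; P₂ = P₂ ; Q₂ = S₂ ; P₃ = T₁ ; Q₃ = Q₃
          ; P₁#Q₁ = Disjoint-⊆ P₁⊆ Q₁⊆ S₁#T₂
          ; P₂#Q₂ = Disjoint-⊆ P₂⊆ id S₁#S₂
          ; P₃#Q₃ = Disjoint-⊆ id Q₃⊆ T₁#T₂
          ; 1#2 = Disjoint-∪ P₁#P₂ (Disjoint-⊆ P₁⊆ id S₁#S₂)
                    (Disjoint-⊆ Q₁⊆ P₂⊆ (Disjoint-sym S₁#T₂)) (Disjoint-⊆ Q₁⊆ id (Disjoint-sym S₂#T₂))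
          ; 1#3 = Disjoint-∪ (Disjoint-⊆ P₁⊆ id S₁#T₁) (Disjoint-⊆ P₁⊆ Q₃⊆ S₁#T₂)
                    (Disjoint-⊆ Q₁⊆ id (Disjoint-sym T₁#T₂)) Q₁#Q₃
          ; 2#3 = Disjoint-∪ (Disjoint-⊆ P₂⊆ id S₁#T₁) (Disjoint-⊆ P₂⊆ Q₃⊆ S₁#T₂)
                    S₂#T₁ (Disjoint-⊆ id Q₃⊆ S₂#T₂)
          ; 5m≤P₁ = P₁≥ ; 5m≤Q₁ = Q₁≥ ; 8m≤P₂ = P₂≥ ; 8m≤Q₂ = ℕ.≤-trans 8m≤13m 13m≤S₂
          ; 8m≤P₃ = ℕ.≤-trans 8m≤13m 13m≤T₁ ; 8m≤Q₃ = Q₃≥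
          ; P₁-Q₁ = Joined-⊆ P₁⊆ Q₁⊆ S₁-T₂
          ; P₂-Q₂ = Joined-⊆ P₂⊆ id S₁-S₂
          ; P₃-Q₃ = Joined-⊆ id Q₃⊆ T₁-T₂
          ; Q₂-P₁ = Joined-⊆ id P₁⊆ (Joined-sym (E-sym i) S₁-S₂)
          ; P₃-end = side-map (Joined (E i) m T₁) k (Joined-⊆ id P₁⊆ (Joined-sym (E-sym i) S₁-T₁))
                                                  (Joined-⊆ id Q₁⊆ T₁-T₂)
          ; tips = joined-sides r S₂-T₁ (Joined-⊆ P₂⊆ Q₃⊆ S₁-T₂)
          })

    decide : Dec (Even i) → Found ⊎ Pair Odd (i ∷ is) m A A
    decide (yes even) = map₂ (extend (λ odd → odd even)) (odd-pair is n≤m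
      (subst (λ o → oddFactor o * m ≤ ∣ A ∣) (count-no odd? {xs = Vec.map ℓ is} (λ odd → odd even)) A≥))
    decide (no odd) = [ inj₁ , step ]′ (odd-pair is n≤f13m
      (subst (_≤ ∣ A ∣) regroup (subst (λ o → oddFactor o * m ≤ ∣ A ∣) (count-yes odd? {xs = Vec.map ℓ is} odd) A≥)))

  -- The odd colours come first, since `odd-pair` starts from a single set; `even-pair` then refines
  -- the disjoint pair so obtained, and separation passes to subsets.
  found-or-separated : let ℓs = Vec.map ℓ (Vec.allFin t) in ∀ {A} →
    oddFactor (count (¬? ∘ (2 ∣?_)) ℓs) * (21 ^ count (2 ∣?_) ℓs * n) ≤ ∣ A ∣ →
    Found ⊎ ∃[ S ] ∃[ T ] (Disjoint S T × ∣ S ∣ ≡ n × ∣ T ∣ ≡ n × (∀ i → Separated (E i) S T))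
  found-or-separated {A} A≥ = [ inj₁ , after-odd ]′ (odd-pair (Vec.allFin t) (ℕ.m≤n*m n f {{ℕ.m^n≢0 21 (count (2 ∣?_) (Vec.map ℓ (Vec.allFin t)))}}) A≥)
    where
    f = 21 ^ count (2 ∣?_) (Vec.map ℓ (Vec.allFin t))
    Separation = ∃[ S ] ∃[ T ] (Disjoint S T × ∣ S ∣ ≡ n × ∣ T ∣ ≡ n × (∀ i → Separated (E i) S T))

    after-even : (p : Pair Odd (Vec.allFin t) (f * n) A A) → Pair Even (Vec.allFin t) n (Pair.S p) (Pair.T p) → Separation
    after-even p@(pair _ _ _ _ _ _ _ odd) (pair S T S⊆ T⊆ S#T n≤S n≤T even) =
      let S′ , S′⊆S , S′≡n = sub-of-size S n≤S
          T′ , T′⊆T , T′≡n = sub-of-size T n≤T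
      in S′ , T′ , Disjoint-⊆ S′⊆S T′⊆T S#T , S′≡n , T′≡n
         , λ i s∈ t∈ → separated i (2 ∣? ℓ i) (S⊆ (S′⊆S s∈)) (T⊆ (T′⊆T t∈)) (S′⊆S s∈) (T′⊆T t∈)
      where
      separated : ∀ i → Dec (2 ∣ ℓ i) → ∀ {s t} → s ∈ Pair.S p → t ∈ Pair.T p → s ∈ S → t ∈ T → ¬ E i s t
      separated i (yes 2∣ℓ) s∈ t∈ s∈′ t∈′ = VecAll.tabulate⁻ even i 2∣ℓ s∈′ t∈′
      separated i (no 2∤ℓ)  s∈ t∈ s∈′ t∈′ = VecAll.tabulate⁻ odd i 2∤ℓ s∈ t∈

    after-odd : Pair Odd (Vec.allFin t) (f * n) A A → Found ⊎ Separation
    after-odd p = map₂ (after-even p) (even-pair (Vec.allFin t) ℕ.≤-refl (Pair.S#T p) (Pair.m≤S p) (Pair.m≤T p))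

open import Data.Bool.Base using (T)

-- Sparse graphs without large holes

[m*n]^k≡m^k*n^k : ∀ m n k → (m * n) ^ k ≡ m ^ k * n ^ k
[m*n]^k≡m^k*n^k m n zero    = refl
[m*n]^k≡m^k*n^k m n (suc k) = trans (cong (m * n *_) ([m*n]^k≡m^k*n^k m n k))
  (solve 4 (λ m n p q → m :* n :* (p :* q) := m :* p :* (n :* q)) refl m n (m ^ k) (n ^ k))
  where open +-*-Solver

module _ {A : Set} where

  sum-map-+ : ∀ (f g : A → ℕ) xs → sum (List.map (λ x → f x + g x) xs) ≡ sum (List.map f xs) + sum (List.map g xs)
  sum-map-+ f g []       = refl
  sum-map-+ f g (x ∷ xs) = trans (cong (f x + g x +_) (sum-map-+ f g xs))
    (solve 4 (λ a b c d → a :+ b :+ (c :+ d) := a :+ c :+ (b :+ d)) refl (f x) (g x) (sum (List.map f xs)) (sum (List.map g xs)))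
    where open +-*-Solver

  sum-map-* : ∀ k (f : A → ℕ) xs → sum (List.map (λ x → k * f x) xs) ≡ k * sum (List.map f xs)
  sum-map-* k f []       = sym (ℕ.*-zeroʳ k)
  sum-map-* k f (x ∷ xs) = trans (cong (k * f x +_) (sum-map-* k f xs)) (sym (ℕ.*-distribˡ-+ k (f x) _))

  sum-map-0 : ∀ (xs : List A) → sum (List.map (λ _ → 0) xs) ≡ 0
  sum-map-0 []       = refl
  sum-map-0 (_ ∷ xs) = sum-map-0 xs

  sum-lower : ∀ {k} {f : A → ℕ} {xs} → All (λ x → k ≤ f x) xs → length xs * k ≤ sum (List.map f xs)
  sum-lower []       = z≤n
  sum-lower (k≤ ∷ h) = ℕ.+-mono-≤ k≤ (sum-lower h)

  sum-upper : ∀ {k} {f : A → ℕ} {xs} → All (λ x → f x < k) xs → length xs + sum (List.map f xs) ≤ length xs * k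
  sum-upper [] = z≤n
  sum-upper {k} {f} {x ∷ xs} (fx<k ∷ h) = ℕ.≤-trans (ℕ.≤-reflexive
    (solve 3 (λ l a s → con 1 :+ l :+ (a :+ s) := con 1 :+ a :+ (l :+ s)) refl (length xs) (f x) (sum (List.map f xs))))
    (ℕ.+-mono-≤ fx<k (sum-upper h))
    where open +-*-Solver

sum-swap : ∀ {A B : Set} (w : A → B → ℕ) xs ys →
           sum (List.map (λ x → sum (List.map (w x) ys)) xs) ≡ sum (List.map (λ y → sum (List.map (λ x → w x y) xs)) ys)
sum-swap w []       ys = sym (sum-map-0 ys)
sum-swap w (x ∷ xs) ys = trans (cong (sum (List.map (w x) ys) +_) (sum-swap w xs ys))
  (sym (sum-map-+ (w x) (λ y → sum (List.map (λ x → w x y) xs)) ys))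

-- This is `(1 + 1/g) ^ (1 + g) ≥ 2`, from Bernoulli's inequality `(1 + 1/g) ^ k ≥ 1 + k/g`.
2*g^[1+g]≤[1+g]^[1+g] : ∀ g → 0 < g → 2 * g ^ suc g ≤ suc g ^ suc g
2*g^[1+g]≤[1+g]^[1+g] g 0<g = ℕ.*-cancelˡ-≤ g {{>-nonZero 0<g}} (begin
  g * (2 * g ^ suc g)      ≡⟨ solve 2 (λ g p → g :* (con 2 :* p) := (g :+ g) :* p) refl g (g ^ suc g) ⟩
  (g + g) * g ^ suc g      ≤⟨ ℕ.*-monoˡ-≤ (g ^ suc g) (ℕ.+-monoʳ-≤ g (ℕ.n≤1+n g)) ⟩
  (g + suc g) * g ^ suc g  ≤⟨ bernoulli (suc g) ⟩
  g * suc g ^ suc g        ∎)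
  where
  open ℕ.≤-Reasoning
  open +-*-Solver
  bernoulli : ∀ k → (g + k) * g ^ k ≤ g * suc g ^ k
  bernoulli zero    = ℕ.≤-reflexive (cong (_* 1) (ℕ.+-identityʳ g))
  bernoulli (suc k) = begin
    (g + suc k) * (g * g ^ k)          ≤⟨ ℕ.m≤m+n _ (k * g ^ k) ⟩
    (g + suc k) * (g * g ^ k) + k * g ^ k ≡⟨ solve 3 (λ g k p → (g :+ (con 1 :+ k)) :* (g :* p) :+ k :* p :=
                                               (con 1 :+ g) :* ((g :+ k) :* p)) refl g k (g ^ k) ⟩
    suc g * ((g + k) * g ^ k)          ≤⟨ ℕ.*-monoʳ-≤ (suc g) (bernoulli k) ⟩
    suc g * (g * suc g ^ k)            ≡⟨ solve 2 (λ g p → (con 1 :+ g) :* (g :* p) := g :* ((con 1 :+ g) :* p)) refl g (suc g ^ k) ⟩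
    g * (suc g * suc g ^ k)            ∎

-- The method of conditional expectations: a random choice of M elements of es misses a fixed
-- test with probability at most (1 - 1/h) ^ M, so some element is hit by a 1/h fraction of the
-- tests that remain.

module _ {E T : Set} (w : E → T → ℕ) (es : List E) (nonempty : 0 < length es)
         {g q : ℕ} (0<g : 0 < g) (dense : length es ≤ suc g * q) where

  IsTest : T → Set
  IsTest f = (∀ e → w e f ≤ 1) × q ≤ sum (List.map (λ e → w e f) es)

  private
    missed : E → List T → List T
    missed e = filter (λ f → w e f ℕ.≟ 0)

    missed-size : ∀ e {F} → All IsTest F → length (missed e F) + sum (List.map (w e) F) ≤ length F
    missed-size e [] = z≤n
    missed-size e {f ∷ F} ((w≤1 , _) ∷ tests) = decide (w e f ℕ.≟ 0)
      where
      open ℕ.≤-Reasoning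
      open +-*-Solver
      decide : Dec (w e f ≡ 0) → length (missed e (f ∷ F)) + (w e f + sum (List.map (w e) F)) ≤ suc (length F)
      decide (yes w≡0) = begin
        length (missed e (f ∷ F)) + (w e f + sum (List.map (w e) F))
          ≡⟨ cong₂ (λ l x → length l + (x + sum (List.map (w e) F))) (List.filter-accept (λ f → w e f ℕ.≟ 0) w≡0) w≡0 ⟩
        suc (length (missed e F) + sum (List.map (w e) F))
          ≤⟨ s≤s (missed-size e tests) ⟩
        suc (length F) ∎
      decide (no w≢0) = begin
        length (missed e (f ∷ F)) + (w e f + sum (List.map (w e) F))
          ≡⟨ cong (λ l → length l + (w e f + sum (List.map (w e) F))) (List.filter-reject (λ f → w e f ℕ.≟ 0) w≢0) ⟩
        length (missed e F) + (w e f + sum (List.map (w e) F))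
          ≡⟨ solve 3 (λ a b c → a :+ (b :+ c) := b :+ (a :+ c)) refl (length (missed e F)) (w e f) (sum (List.map (w e) F)) ⟩
        w e f + (length (missed e F) + sum (List.map (w e) F))
          ≤⟨ ℕ.+-mono-≤ (w≤1 e) (missed-size e tests) ⟩
        suc (length F) ∎

    good-element : ∀ {F} → All IsTest F → ∃[ e ] length F ≤ suc g * sum (List.map (w e) F)
    good-element {F} tests with any? (λ e → length F ℕ.≤? suc g * sum (List.map (w e) F)) es
    ... | yes found = Any.satisfied found
    ... | no ¬found = contradiction (begin-strict
      length es * length F                                     ≤⟨ ℕ.*-monoˡ-≤ (length F) dense ⟩
      suc g * q * length F                                     ≡⟨ solve 3 (λ h q f → h :* q :* f := h :* (f :* q)) refl (suc g) q (length F) ⟩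
      suc g * (length F * q)                                   ≤⟨ ℕ.*-monoʳ-≤ (suc g) (sum-lower (All.map proj₂ tests)) ⟩
      suc g * sum (List.map (λ f → sum (List.map (λ e → w e f) es)) F)   ≡⟨ cong (suc g *_) (sum-swap w es F) ⟨
      suc g * sum (List.map (λ e → sum (List.map (w e) F)) es)           ≡⟨ sum-map-* (suc g) (λ e → sum (List.map (w e) F)) es ⟨
      -- Every element falls short by at least 1; as `es` is nonempty, the total is strictly too
      -- small for the double count.
      sum (List.map (λ e → suc g * sum (List.map (w e) F)) es)           <⟨ ℕ.m<n+m _ nonempty ⟩
      length es + sum (List.map (λ e → suc g * sum (List.map (w e) F)) es) ≤⟨ sum-upper (All.map ℕ.≰⇒> (All.¬Any⇒All¬ es ¬found)) ⟩
      length es * length F                                     ∎) (ℕ.<-irrefl refl)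
      where
      open ℕ.≤-Reasoning
      open +-*-Solver

    choose : ∀ s {F} → All IsTest F → ∃[ sel ] ∃[ rest ] (length sel ≡ s ×
             (∀ {f} → f List.∈ F → f List.∈ rest ⊎ ∃[ e ] (e List.∈ sel × w e f ≢ 0)) ×
             suc g ^ s * length rest ≤ g ^ s * length F)
    choose zero {F} tests = [] , F , refl , inj₁ , ℕ.≤-refl
    choose (suc s) {F} tests =
      let e , good = good-element tests
          sel , rest , len , covers , small = choose s (All.filter⁺ (λ f → w e f ℕ.≟ 0) tests)
      in e ∷ sel , rest , cong suc len
         , (λ {f} f∈ → cover e sel rest covers f∈)
         , shrink e (length rest) (missed-size e tests) good small
      where
      open ℕ.≤-Reasoning
      open +-*-Solver

      cover : ∀ e sel rest → (∀ {f} → f List.∈ missed e F → f List.∈ rest ⊎ ∃[ e ] (e List.∈ sel × w e f ≢ 0)) →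
              ∀ {f} → f List.∈ F → f List.∈ rest ⊎ ∃[ e′ ] (e′ List.∈ e ∷ sel × w e′ f ≢ 0)
      cover e sel rest covers {f} f∈ with w e f ℕ.≟ 0
      ... | no w≢0 = inj₂ (e , here refl , w≢0)
      ... | yes w≡0 with covers (List∈.∈-filter⁺ (λ f → w e f ℕ.≟ 0) f∈ w≡0)
      ...   | inj₁ f∈rest = inj₁ f∈rest
      ...   | inj₂ (e′ , e′∈ , w≢0) = inj₂ (e′ , there e′∈ , w≢0)

      shrink : ∀ e r → length (missed e F) + sum (List.map (w e) F) ≤ length F → length F ≤ suc g * sum (List.map (w e) F) →
               suc g ^ s * r ≤ g ^ s * length (missed e F) → suc g * suc g ^ s * r ≤ g * g ^ s * length F
      shrink e r total good small = begin
        suc g * suc g ^ s * r        ≡⟨ ℕ.*-assoc (suc g) (suc g ^ s) r ⟩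
        suc g * (suc g ^ s * r)      ≤⟨ ℕ.*-monoʳ-≤ (suc g) small ⟩
        suc g * (g ^ s * u)          ≡⟨ solve 3 (λ h p u → h :* (p :* u) := p :* (h :* u)) refl (suc g) (g ^ s) u ⟩
        g ^ s * (suc g * u)          ≤⟨ ℕ.*-monoʳ-≤ (g ^ s) u-small ⟩
        g ^ s * (g * length F)       ≡⟨ solve 3 (λ g p l → p :* (g :* l) := g :* p :* l) refl g (g ^ s) (length F) ⟩
        g * g ^ s * length F         ∎
        where
        u = length (missed e F)
        u-small : suc g * u ≤ g * length F
        u-small = ℕ.+-cancelˡ-≤ (length F) _ _ (begin
          length F + suc g * u                          ≤⟨ ℕ.+-monoˡ-≤ (suc g * u) good ⟩
          suc g * sum (List.map (w e) F) + suc g * u         ≡⟨ solve 3 (λ h a b → h :* a :+ h :* b := h :* (b :+ a)) refl (suc g) (sum (List.map (w e) F)) u ⟩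
          suc g * (u + sum (List.map (w e) F))               ≤⟨ ℕ.*-monoʳ-≤ (suc g) total ⟩
          suc g * length F                              ∎)

  -- By `halving`, each `suc g` selected elements halve the bound on the number of missed tests, so
  -- after `suc g * B` elements fewer than one of the original tests remains.
  hitting-set : ∀ B {F} → All IsTest F → length F < 2 ^ B →
                ∃[ sel ] (length sel ≡ suc g * B × (∀ {f} → f List.∈ F → ∃[ e ] (e List.∈ sel × w e f ≢ 0)))
  hitting-set B {F} tests F<2^B = finish (choose (suc g * B) tests)
    where
    open ℕ.≤-Reasoning
    s = suc g * B
    halving : 2 ^ B * g ^ s ≤ suc g ^ s
    halving = begin
      2 ^ B * g ^ (suc g * B)      ≡⟨ cong (2 ^ B *_) (ℕ.^-*-assoc g (suc g) B) ⟨
      2 ^ B * (g ^ suc g) ^ B      ≡⟨ [m*n]^k≡m^k*n^k 2 (g ^ suc g) B ⟨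
      (2 * g ^ suc g) ^ B          ≤⟨ ℕ.^-monoˡ-≤ B (2*g^[1+g]≤[1+g]^[1+g] g 0<g) ⟩
      (suc g ^ suc g) ^ B          ≡⟨ ℕ.^-*-assoc (suc g) (suc g) B ⟩
      suc g ^ (suc g * B)          ∎
    no-rest : ∀ r → suc g ^ s * r ≤ g ^ s * length F → r ≡ 0
    no-rest zero    _     = refl
    no-rest (suc r) small = contradiction (begin-strict
      2 ^ B * g ^ s          ≤⟨ halving ⟩
      suc g ^ s              ≤⟨ ℕ.m≤m*n (suc g ^ s) (suc r) ⟩
      suc g ^ s * suc r      ≤⟨ small ⟩
      g ^ s * length F       <⟨ ℕ.*-monoʳ-< (g ^ s) {{ℕ.m^n≢0 g s {{>-nonZero 0<g}}}} F<2^B ⟩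
      g ^ s * 2 ^ B          ≡⟨ ℕ.*-comm (g ^ s) (2 ^ B) ⟩
      2 ^ B * g ^ s          ∎) (ℕ.<-irrefl refl)
    finish : ∃[ sel ] ∃[ rest ] (length sel ≡ s ×
             (∀ {f} → f List.∈ F → f List.∈ rest ⊎ ∃[ e ] (e List.∈ sel × w e f ≢ 0)) ×
             suc g ^ s * length rest ≤ g ^ s * length F) →
             ∃[ sel ] (length sel ≡ s × (∀ {f} → f List.∈ F → ∃[ e ] (e List.∈ sel × w e f ≢ 0)))
    finish (sel , [] , len , covers , small) = sel , len , λ f∈ → [ (λ ()) , id ]′ (covers f∈)
    finish (sel , r ∷ rest , len , covers , small) = contradiction (no-rest (suc (length rest)) small) λ ()

-- An injection given as a relation, since an edge may be listed in either orientation. The partner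
-- of the first element is removed and the induction continues.
length-≤-by-matching : ∀ {A B : Set} (G : A → B → Set) {xs ys} → Unique xs →
  (∀ {x} → x List.∈ xs → ∃[ y ] (y List.∈ ys × G x y)) →
  (∀ {x x′ y} → x List.∈ xs → x′ List.∈ xs → G x y → G x′ y → x ≡ x′) →
  length xs ≤ length ys
length-≤-by-matching G {[]}     [] match inj = z≤n
length-≤-by-matching G {x ∷ xs} {ys} (x∉xs ∷ unique) match inj with match (here refl)
... | y , y∈ys , Gxy = ℕ.≤-trans
  (s≤s (length-≤-by-matching G unique match′ (λ x∈ x′∈ → inj (there x∈) (there x′∈))))
  (ℕ.≤-reflexive (sym (List.length-removeAt′ ys (Any.index y∈ys))))
  where
  remove : ∀ {y z ys} (y∈ : y List.∈ ys) → z List.∈ ys → z ≡ y ⊎ z List.∈ (ys Any.─ y∈)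
  remove (here refl) (here refl) = inj₁ refl
  remove (here refl) (there z∈)  = inj₂ z∈
  remove (there y∈)  (here refl) = inj₂ (here refl)
  remove (there y∈)  (there z∈)  = Sum.map₂ there (remove y∈ z∈)

  match′ : ∀ {x′} → x′ List.∈ xs → ∃[ y′ ] (y′ List.∈ (ys Any.─ y∈ys) × G x′ y′)
  match′ x′∈ with match (there x′∈)
  ... | y′ , y′∈ , Gx′y′ with remove y∈ys y′∈
  ...   | inj₂ y′∈─ = y′ , y′∈─ , Gx′y′
  ...   | inj₁ refl = contradiction (inj (here refl) (there x′∈) Gxy Gx′y′) (All.lookup x∉xs x′∈)

-- Edge lists, and graphs given by Boolean functions.

module _ (G : Graph) where
  open Graph G

  edges : List (Vertex × Vertex)
  edges = filterᵇ (uncurry λ u v → (toℕ u <ᵇ toℕ v) ∧ adj u v) (cartesianProduct (List.allFin order) (List.allFin order))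

  edges-unique : Unique edges
  edges-unique = Unique.filter⁺ (T? ∘ uncurry λ u v → (toℕ u <ᵇ toℕ v) ∧ adj u v)
    (Unique.cartesianProduct⁺ (Unique.allFin⁺ order) (Unique.allFin⁺ order))

  ∈-edges⁻ : ∀ {u v} → (u , v) List.∈ edges → toℕ u < toℕ v × u ~ v
  ∈-edges⁻ {u} {v} e∈ =
    let _ , holds = List∈.∈-filter⁻ (T? ∘ uncurry λ u v → (toℕ u <ᵇ toℕ v) ∧ adj u v) {xs = cartesianProduct (List.allFin order) (List.allFin order)} e∈
        u<v , u~v = Equivalence.to (T-∧ {toℕ u <ᵇ toℕ v}) holds
    in ℕ.<ᵇ⇒< (toℕ u) (toℕ v) u<v , u~v

  ∈-edges⁺ : ∀ {u v} → toℕ u < toℕ v → u ~ v → (u , v) List.∈ edges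
  ∈-edges⁺ {u} {v} u<v u~v = List∈.∈-filter⁺ (T? ∘ uncurry λ u v → (toℕ u <ᵇ toℕ v) ∧ adj u v)
    (List∈.∈-cartesianProduct⁺ (List∈.∈-allFin u) (List∈.∈-allFin v))
    (Equivalence.from T-∧ (ℕ.<⇒<ᵇ u<v , u~v))

SameEdge : ∀ {A : Set} → A × A → A × A → Set
SameEdge e e′ = e′ ≡ e ⊎ e′ ≡ Product.swap e

SameEdge-ordered : ∀ {k} {u v u′ v′ : Fin k} {e} → toℕ u < toℕ v → toℕ u′ < toℕ v′ →
                   SameEdge (u , v) e → SameEdge (u′ , v′) e → (u , v) ≡ (u′ , v′)
SameEdge-ordered u<v u′<v′ (inj₁ refl) (inj₁ refl) = refl
SameEdge-ordered u<v u′<v′ (inj₁ refl) (inj₂ refl) = contradiction u′<v′ (ℕ.<-asym u<v)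
SameEdge-ordered u<v u′<v′ (inj₂ refl) (inj₁ refl) = contradiction u′<v′ (ℕ.<-asym u<v)
SameEdge-ordered u<v u′<v′ (inj₂ refl) (inj₂ refl) = refl

module _ (G : Graph) where
  open Graph G

  size-≤-length : (es : List (Vertex × Vertex)) →
                  (∀ {u v} → u ~ v → (u , v) List.∈ es ⊎ (v , u) List.∈ es) → size ≤ length es
  size-≤-length es listed = length-≤-by-matching SameEdge (edges-unique G)
    (λ {(u , v)} e∈ → [ (λ e∈es → (u , v) , e∈es , inj₁ refl) , (λ e∈es → (v , u) , e∈es , inj₂ refl) ]′
       (listed (proj₂ (∈-edges⁻ G e∈))))
    (λ {(u , v)} {(u′ , v′)} e∈ e′∈ → SameEdge-ordered (proj₁ (∈-edges⁻ G e∈)) (proj₁ (∈-edges⁻ G e′∈)))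

  adjacent-distinct : ∀ {u v} → u ~ v → u ≢ v
  adjacent-distinct u~v refl = subst T (irreflexive _) u~v

  ∈-edges : ∀ {u v} → u ~ v → (u , v) List.∈ edges G ⊎ (v , u) List.∈ edges G
  ∈-edges {u} {v} u~v with ℕ.<-cmp (toℕ u) (toℕ v)
  ... | tri< u<v _ _ = inj₁ (∈-edges⁺ G u<v u~v)
  ... | tri≈ _ u≡v _ = contradiction (Fin.toℕ-injective u≡v) (adjacent-distinct u~v)
  ... | tri> _ _ v<u = inj₂ (∈-edges⁺ G v<u (subst T (symmetric u v) u~v))

-- Symmetrising and deleting loops turns any Boolean function into a graph, so neither property has
-- to be maintained when graphs are built or searched.
graphOf : ∀ k → (Fin k → Fin k → Bool) → Graph
graphOf k f = record
  { order       = k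
  ; adj         = λ u v → not (does (u Fin.≟ v)) ∧ (f u v ∨ f v u)
  ; symmetric   = λ u v → cong₂ _∧_ (cong not (≟-sym u v)) (∨-comm (f u v) (f v u))
  ; irreflexive = λ u → cong (λ b → not b ∧ (f u u ∨ f u u)) (≟-refl u)
  }
  where
  ≟-sym : ∀ (u v : Fin k) → does (u Fin.≟ v) ≡ does (v Fin.≟ u)
  ≟-sym u v with u Fin.≟ v | v Fin.≟ u
  ... | yes _   | yes _   = refl
  ... | no _    | no _    = refl
  ... | yes u≡v | no v≢u  = contradiction (sym u≡v) v≢u
  ... | no u≢v  | yes v≡u = contradiction (sym v≡u) u≢v
  ≟-refl : ∀ (u : Fin k) → does (u Fin.≟ u) ≡ true
  ≟-refl u with u Fin.≟ u
  ... | yes _  = refl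
  ... | no u≢u = contradiction refl u≢u

module _ {k} (f : Fin k → Fin k → Bool) where
  open Graph (graphOf k f)

  graphOf⁻ : ∀ {u v} → u ~ v → T (f u v) ⊎ T (f v u)
  graphOf⁻ {u} {v} u~v = Equivalence.to T-∨ (proj₂ (Equivalence.to (T-∧ {not (does (u Fin.≟ v))}) u~v))

  graphOf⁺ : ∀ {u v} → u ≢ v → T (f u v) ⊎ T (f v u) → u ~ v
  graphOf⁺ {u} {v} u≢v fuv = Equivalence.from T-∧ (distinct , Equivalence.from T-∨ fuv)
    where
    distinct : T (not (does (u Fin.≟ v)))
    distinct with u Fin.≟ v
    ... | yes u≡v = contradiction u≡v u≢v
    ... | no _    = _

-- Counting subsets, and vertex pairs between two sets.

subsetsOfSize : ∀ v → ℕ → List (Subset v)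
subsetsOfSize zero    zero    = [] ∷ []
subsetsOfSize zero    (suc k) = []
subsetsOfSize (suc v) zero    = List.map (outside ∷_) (subsetsOfSize v zero)
subsetsOfSize (suc v) (suc k) = List.map (inside ∷_) (subsetsOfSize v k) ++ List.map (outside ∷_) (subsetsOfSize v (suc k))

∈-subsetsOfSize : ∀ {v} (A : Subset v) {k} → ∣ A ∣ ≡ k → A List.∈ subsetsOfSize v k
∈-subsetsOfSize []            refl = here refl
∈-subsetsOfSize (inside ∷ A)  refl = List∈.∈-++⁺ˡ (List∈.∈-map⁺ (inside ∷_) (∈-subsetsOfSize A refl))
∈-subsetsOfSize (outside ∷ A) {zero}  eq = List∈.∈-map⁺ (outside ∷_) (∈-subsetsOfSize A eq)
∈-subsetsOfSize (_∷_ {v} outside A) {suc k} eq = List∈.∈-++⁺ʳ (List.map (inside ∷_) (subsetsOfSize v k))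
  (List∈.∈-map⁺ (outside ∷_) (∈-subsetsOfSize A eq))

subsetsOfSize-size : ∀ v k → All (λ A → ∣ A ∣ ≡ k) (subsetsOfSize v k)
subsetsOfSize-size zero    zero    = refl ∷ []
subsetsOfSize-size zero    (suc k) = []
subsetsOfSize-size (suc v) zero    = All.map⁺ (subsetsOfSize-size v zero)
subsetsOfSize-size (suc v) (suc k) =
  All.++⁺ (All.map⁺ (All.map (cong suc) (subsetsOfSize-size v k))) (All.map⁺ (subsetsOfSize-size v (suc k)))

-- The k-th term of the binomial expansion of (1 + y) ^ v, bounded by the whole sum.
length-subsetsOfSize : ∀ y v k → length (subsetsOfSize v k) * y ^ v ≤ suc y ^ v * y ^ k
length-subsetsOfSize y zero    zero    = ℕ.≤-refl
length-subsetsOfSize y zero    (suc k) = z≤n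
length-subsetsOfSize y (suc v) zero    = begin
  length (List.map (outside ∷_) L) * (y * y ^ v)  ≡⟨ cong (_* (y * y ^ v)) (List.length-map (outside ∷_) L) ⟩
  length L * (y * y ^ v)                     ≡⟨ solve 3 (λ l y p → l :* (y :* p) := y :* (l :* p)) refl (length L) y (y ^ v) ⟩
  y * (length L * y ^ v)                     ≤⟨ ℕ.*-mono-≤ (ℕ.n≤1+n y) (length-subsetsOfSize y v zero) ⟩
  suc y * (suc y ^ v * 1)                    ≡⟨ ℕ.*-assoc (suc y) (suc y ^ v) 1 ⟨
  suc y * suc y ^ v * 1                      ∎
  where
  open ℕ.≤-Reasoning
  open +-*-Solver
  L = subsetsOfSize v zero
length-subsetsOfSize y (suc v) (suc k) = begin
  length (List.map (inside ∷_) L ++ List.map (outside ∷_) L′) * (y * y ^ v)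
    ≡⟨ cong (_* (y * y ^ v)) (trans (List.length-++ (List.map (inside ∷_) L)) (cong₂ _+_ (List.length-map _ L) (List.length-map _ L′))) ⟩
  (length L + length L′) * (y * y ^ v)
    ≡⟨ solve 4 (λ l l′ y p → (l :+ l′) :* (y :* p) := y :* (l :* p) :+ y :* (l′ :* p)) refl (length L) (length L′) y (y ^ v) ⟩
  y * (length L * y ^ v) + y * (length L′ * y ^ v)
    ≤⟨ ℕ.+-mono-≤ (ℕ.*-monoʳ-≤ y (length-subsetsOfSize y v k)) (ℕ.*-monoʳ-≤ y (length-subsetsOfSize y v (suc k))) ⟩
  y * (suc y ^ v * y ^ k) + y * (suc y ^ v * (y * y ^ k))
    ≡⟨ solve 3 (λ y p q → y :* (p :* q) :+ y :* (p :* (y :* q)) := (con 1 :+ y) :* p :* (y :* q)) refl y (suc y ^ v) (y ^ k) ⟩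
  suc y * suc y ^ v * (y * y ^ k) ∎
  where
  open ℕ.≤-Reasoning
  open +-*-Solver
  L = subsetsOfSize v k
  L′ = subsetsOfSize v (suc k)

indicator : ∀ {v} → Subset v → Fin v → ℕ
indicator A u = if lookup A u then 1 else 0

indicator⁻ : ∀ {v} (A : Subset v) u → indicator A u ≢ 0 → u ∈ A
indicator⁻ A u ≢0 with lookup A u in eq
... | true  = Vec.lookup⇒[]= u A eq
... | false = contradiction refl ≢0

indicator≤1 : ∀ {v} (A : Subset v) u → indicator A u ≤ 1
indicator≤1 A u with lookup A u
... | true  = ℕ.≤-refl
... | false = z≤n

sum-indicator : ∀ {v} (A : Subset v) → sum (List.map (indicator A) (List.allFin v)) ≡ ∣ A ∣
sum-indicator A = trans (cong sum (List.map-tabulate id (indicator A))) (go A)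
  where
  go : ∀ {v} (A : Subset v) → sum (List.tabulate (indicator A)) ≡ ∣ A ∣
  go []            = refl
  go (inside ∷ A)  = cong suc (go A)
  go (outside ∷ A) = go A

sum-cartesianProduct : ∀ {A B : Set} (g : A × B → ℕ) xs ys →
  sum (List.map g (cartesianProduct xs ys)) ≡ sum (List.map (λ x → sum (List.map (λ y → g (x , y)) ys)) xs)
sum-cartesianProduct g []       ys = refl
sum-cartesianProduct g (x ∷ xs) ys = trans (cong sum (List.map-++ g (List.map (x ,_) ys) _))
  (trans (sum-++ (List.map g (List.map (x ,_) ys)) _)
    (cong₂ _+_ (cong sum (sym (List.map-∘ ys))) (sum-cartesianProduct g xs ys)))

length-cartesianProduct : ∀ {A B : Set} (xs : List A) (ys : List B) →
                          length (cartesianProduct xs ys) ≡ length xs * length ys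
length-cartesianProduct []       ys = refl
length-cartesianProduct (x ∷ xs) ys = trans (List.length-++ (List.map (x ,_) ys))
  (cong₂ _+_ (List.length-map (x ,_) ys) (length-cartesianProduct xs ys))

module _ {v : ℕ} where

  -- Both orientations of a vertex pair count as a hit; for disjoint `A` and `B` at most one of them
  -- occurs.
  weight : Fin v × Fin v → Subset v × Subset v → ℕ
  weight (u , w) (A , B) = indicator A u * indicator B w + indicator B u * indicator A w

  weight≤1 : ∀ {A B} → Disjoint A B → ∀ e → weight e (A , B) ≤ 1
  weight≤1 {A} {B} A#B (u , w) with indicator A u ℕ.≟ 0
  ... | yes A≡0 = begin
    indicator A u * indicator B w + indicator B u * indicator A w
      ≡⟨ cong (λ a → a * indicator B w + indicator B u * indicator A w) A≡0 ⟩
    indicator B u * indicator A w  ≤⟨ ℕ.*-mono-≤ (indicator≤1 B u) (indicator≤1 A w) ⟩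
    1 * 1 ∎
    where open ℕ.≤-Reasoning
  ... | no A≢0 with indicator B u ℕ.≟ 0
  ...   | yes B≡0 = begin
    indicator A u * indicator B w + indicator B u * indicator A w
      ≡⟨ cong (λ b → indicator A u * indicator B w + b * indicator A w) B≡0 ⟩
    indicator A u * indicator B w + 0  ≡⟨ ℕ.+-identityʳ _ ⟩
    indicator A u * indicator B w  ≤⟨ ℕ.*-mono-≤ (indicator≤1 A u) (indicator≤1 B w) ⟩
    1 * 1 ∎
    where open ℕ.≤-Reasoning
  ...   | no B≢0 = contradiction (indicator⁻ B u B≢0) (A#B (indicator⁻ A u A≢0))

  weight⁻ : ∀ {u w A B} → weight (u , w) (A , B) ≢ 0 → (u ∈ A × w ∈ B) ⊎ (u ∈ B × w ∈ A)
  weight⁻ {u} {w} {A} {B} ≢0 with indicator A u * indicator B w ℕ.≟ 0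
  ... | no AB≢0 = inj₁ (indicator⁻ A u (λ A≡0 → AB≢0 (cong (_* indicator B w) A≡0))
                      , indicator⁻ B w (λ B≡0 → AB≢0 (trans (cong (indicator A u *_) B≡0) (ℕ.*-zeroʳ (indicator A u)))))
  ... | yes AB≡0 = inj₂ (indicator⁻ B u (λ B≡0 → BA≢0 (cong (_* indicator A w) B≡0))
                       , indicator⁻ A w (λ A≡0 → BA≢0 (trans (cong (indicator B u *_) A≡0) (ℕ.*-zeroʳ (indicator B u)))))
    where
    BA≢0 : indicator B u * indicator A w ≢ 0
    BA≢0 BA≡0 = ≢0 (cong₂ _+_ AB≡0 BA≡0)

  vertexPairs : List (Fin v × Fin v)
  vertexPairs = cartesianProduct (List.allFin v) (List.allFin v)

  length-vertexPairs : length vertexPairs ≡ v * v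
  length-vertexPairs = trans (length-cartesianProduct (List.allFin v) (List.allFin v))
    (cong₂ _*_ (List.length-tabulate {n = v} id) (List.length-tabulate {n = v} id))

  sum-weight : ∀ A B → sum (List.map (λ e → weight e (A , B)) vertexPairs) ≡ 2 * (∣ A ∣ * ∣ B ∣)
  sum-weight A B = begin
    sum (List.map (λ e → weight e (A , B)) vertexPairs)
      ≡⟨ sum-cartesianProduct (λ e → weight e (A , B)) vs vs ⟩
    sum (List.map (λ u → sum (List.map (λ w → weight (u , w) (A , B)) vs)) vs)
      ≡⟨ cong sum (List.map-cong row vs) ⟩
    sum (List.map (λ u → ∣ B ∣ * indicator A u + ∣ A ∣ * indicator B u) vs)
      ≡⟨ sum-map-+ (λ u → ∣ B ∣ * indicator A u) (λ u → ∣ A ∣ * indicator B u) vs ⟩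
    sum (List.map (λ u → ∣ B ∣ * indicator A u) vs) + sum (List.map (λ u → ∣ A ∣ * indicator B u) vs)
      ≡⟨ cong₂ _+_ (sum-map-* ∣ B ∣ (indicator A) vs) (sum-map-* ∣ A ∣ (indicator B) vs) ⟩
    ∣ B ∣ * sum (List.map (indicator A) vs) + ∣ A ∣ * sum (List.map (indicator B) vs)
      ≡⟨ cong₂ (λ a b → ∣ B ∣ * a + ∣ A ∣ * b) (sum-indicator A) (sum-indicator B) ⟩
    ∣ B ∣ * ∣ A ∣ + ∣ A ∣ * ∣ B ∣
      ≡⟨ solve 2 (λ a b → b :* a :+ a :* b := con 2 :* (a :* b)) refl (∣ A ∣) (∣ B ∣) ⟩
    2 * (∣ A ∣ * ∣ B ∣) ∎
    where
    open ≡-Reasoning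
    open +-*-Solver
    vs = List.allFin v
    row : ∀ u → sum (List.map (λ w → weight (u , w) (A , B)) vs) ≡ ∣ B ∣ * indicator A u + ∣ A ∣ * indicator B u
    row u = trans (sum-map-+ (λ w → indicator A u * indicator B w) (λ w → indicator B u * indicator A w) vs)
      (cong₂ _+_
        (trans (sum-map-* (indicator A u) (indicator B) vs) (trans (cong (indicator A u *_) (sum-indicator B)) (ℕ.*-comm (indicator A u) _)))
        (trans (sum-map-* (indicator B u) (indicator A) vs) (trans (cong (indicator B u *_) (sum-indicator A)) (ℕ.*-comm (indicator B u) _))))

-- With `k = 2 j` this is `(1 + 1/k) ^ j < 2`. It follows from Bernoulli's inequality in the form
-- `(k / (k + 1)) ^ i ≥ 1 - i / (k + 1)` at `i = j`.
[1+k]^j<2k^j : ∀ j → 0 < j → suc (2 * j) ^ j < 2 * (2 * j) ^ j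
[1+k]^j<2k^j j 0<j = ℕ.*-cancelˡ-< (suc j) _ _ (begin-strict
  suc j * suc k ^ j          ≤⟨ bernoulli j (suc j) (cong suc (solve 1 (λ j → j :+ j := con 2 :* j) refl j)) ⟩
  suc k * k ^ j              <⟨ ℕ.*-monoˡ-< (k ^ j) {{ℕ.m^n≢0 k j {{>-nonZero (ℕ.*-mono-≤ {1} {2} (s≤s z≤n) 0<j)}}}} (ℕ.n<1+n (suc k)) ⟩
  (2 + k) * k ^ j            ≡⟨ solve 2 (λ j p → (con 2 :+ con 2 :* j) :* p := (con 1 :+ j) :* (con 2 :* p)) refl j (k ^ j) ⟩
  suc j * (2 * k ^ j)        ∎)
  where
  open ℕ.≤-Reasoning
  open +-*-Solver
  k = 2 * j
  bernoulli : ∀ i a → a + i ≡ suc k → a * suc k ^ i ≤ suc k * k ^ i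
  bernoulli zero    a eq = ℕ.≤-reflexive (cong (_* 1) (trans (sym (ℕ.+-identityʳ a)) eq))
  bernoulli (suc i) a eq = begin
    a * (suc k * suc k ^ i)    ≡⟨ ℕ.*-assoc a (suc k) (suc k ^ i) ⟨
    a * suc k * suc k ^ i      ≤⟨ ℕ.*-monoˡ-≤ (suc k ^ i) a[1+k]≤k[1+a] ⟩
    k * suc a * suc k ^ i      ≡⟨ ℕ.*-assoc k (suc a) (suc k ^ i) ⟩
    k * (suc a * suc k ^ i)    ≤⟨ ℕ.*-monoʳ-≤ k (bernoulli i (suc a) (trans (sym (ℕ.+-suc a i)) eq)) ⟩
    k * (suc k * k ^ i)        ≡⟨ solve 2 (λ k p → k :* ((con 1 :+ k) :* p) := (con 1 :+ k) :* (k :* p)) refl k (k ^ i) ⟩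
    suc k * (k * k ^ i)        ∎
    where
    a≤k : a ≤ k
    a≤k = ℕ.≤-trans (ℕ.m≤m+n a i) (ℕ.≤-reflexive (ℕ.suc-injective (trans (sym (ℕ.+-suc a i)) eq)))
    a[1+k]≤k[1+a] : a * suc k ≤ k * suc a
    a[1+k]≤k[1+a] = begin
      a * suc k     ≡⟨ ℕ.*-suc a k ⟩
      a + a * k     ≤⟨ ℕ.+-monoˡ-≤ (a * k) a≤k ⟩
      k + a * k     ≡⟨ cong (k +_) (ℕ.*-comm a k) ⟩
      k + k * a     ≡⟨ ℕ.*-suc k a ⟨
      k * suc a     ∎

-- The binomial bound with `y = k = 2 j` gives at most `((1 + 1/k) ^ k * k) ^ n` sets, and
-- `(1 + 1/k) ^ k < 4` is the square of the preceding inequality.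
few-subsets : ∀ j n b → 0 < j → 0 < n → 4 * (2 * j) ≤ 2 ^ b → length (subsetsOfSize (2 * j * n) n) < 2 ^ (b * n)
few-subsets j n b 0<j 0<n 4k≤2^b = ℕ.<-≤-trans (ℕ.*-cancelʳ-< (k ^ v) L ((4 * k) ^ n) (begin-strict
  L * k ^ v                            ≤⟨ length-subsetsOfSize k v n ⟩
  suc k ^ v * k ^ n                    ≡⟨ cong (_* k ^ n) (ℕ.^-*-assoc (suc k) k n) ⟨
  (suc k ^ k) ^ n * k ^ n              <⟨ ℕ.*-monoˡ-< (k ^ n) {{ℕ.m^n≢0 k n}} (ℕ.^-monoˡ-< n {{>-nonZero 0<n}} base) ⟩
  (4 * k ^ k) ^ n * k ^ n              ≡⟨ cong (_* k ^ n) ([m*n]^k≡m^k*n^k 4 (k ^ k) n) ⟩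
  4 ^ n * (k ^ k) ^ n * k ^ n          ≡⟨ cong (λ z → 4 ^ n * z * k ^ n) (ℕ.^-*-assoc k k n) ⟩
  4 ^ n * k ^ v * k ^ n                ≡⟨ solve 3 (λ a b c → a :* b :* c := a :* c :* b) refl (4 ^ n) (k ^ v) (k ^ n) ⟩
  4 ^ n * k ^ n * k ^ v                ≡⟨ cong (_* k ^ v) ([m*n]^k≡m^k*n^k 4 k n) ⟨
  (4 * k) ^ n * k ^ v                  ∎))
  (begin
  (4 * k) ^ n                          ≤⟨ ℕ.^-monoˡ-≤ n 4k≤2^b ⟩
  (2 ^ b) ^ n                          ≡⟨ ℕ.^-*-assoc 2 b n ⟩
  2 ^ (b * n)                          ∎)
  where
  open ℕ.≤-Reasoning
  open +-*-Solver
  k = 2 * j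
  v = k * n
  L = length (subsetsOfSize v n)
  instance
    k≢0 : NonZero k
    k≢0 = >-nonZero (ℕ.*-mono-≤ {1} {2} (s≤s z≤n) 0<j)
  base : suc k ^ k < 4 * k ^ k
  base = begin-strict
    suc k ^ (2 * j)                  ≡⟨ cong (suc k ^_) (ℕ.*-comm 2 j) ⟩
    suc k ^ (j * 2)                  ≡⟨ ℕ.^-*-assoc (suc k) j 2 ⟨
    (suc k ^ j) ^ 2                  <⟨ ℕ.^-monoˡ-< 2 ([1+k]^j<2k^j j 0<j) ⟩
    (2 * k ^ j) ^ 2                  ≡⟨ [m*n]^k≡m^k*n^k 2 (k ^ j) 2 ⟩
    4 * (k ^ j) ^ 2                  ≡⟨ cong (4 *_) (ℕ.^-*-assoc k j 2) ⟩
    4 * k ^ (j * 2)                  ≡⟨ cong (λ e → 4 * k ^ e) (ℕ.*-comm j 2) ⟩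
    4 * k ^ (2 * j)                  ∎

-- The tests are the disjoint pairs of `n`-sets, fewer than `2 ^ (2 b n)` of them. Each is hit by
-- `2 n²` of the `(2 j n)²` ordered vertex pairs, a fraction `1 / (2 j²)`, so `2 j² * 2 b n` pairs
-- suffice.
sparse-joining-graph : ∀ j n b → 0 < j → 0 < n → 4 * (2 * j) ≤ 2 ^ b →
  ∃[ f ] (let G = graphOf (2 * j * n) f in
          Graph.size G ≤ 2 * j * (2 * j) * b * n ×
          (∀ A B → Disjoint A B → ∣ A ∣ ≡ n → ∣ B ∣ ≡ n → ∃[ u ] ∃[ w ] (u ∈ A × w ∈ B × Graph._~_ G u w)))
sparse-joining-graph j n b 0<j 0<n 4k≤2^b = fromHittingSet
  (hitting-set weight vertexPairs nonempty (ℕ.≤-trans 0<j j≤g) dense (b * n + b * n) tests few)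
  where
  k = 2 * j
  v = k * n
  g = pred (2 * (j * j))
  q = 2 * (n * n)

  jj>0 : 0 < j * j
  jj>0 = ℕ.*-mono-≤ 0<j 0<j

  suc-g : suc g ≡ 2 * (j * j)
  suc-g = ℕ.suc-pred (2 * (j * j)) {{>-nonZero (ℕ.*-mono-≤ {1} {2} (s≤s z≤n) jj>0)}}

  j≤g : j ≤ g
  j≤g = s≤s⁻¹ (begin
    suc j                 ≡⟨ ℕ.+-comm 1 j ⟩
    j + 1                 ≤⟨ ℕ.+-mono-≤ (ℕ.m≤m*n j j {{>-nonZero 0<j}}) jj>0 ⟩
    j * j + j * j         ≡⟨ cong (j * j +_) (ℕ.+-identityʳ (j * j)) ⟨
    2 * (j * j)           ≡⟨ suc-g ⟨
    suc g                 ∎)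
    where open ℕ.≤-Reasoning

  nonempty : 0 < length (vertexPairs {v})
  nonempty = subst (0 <_) (sym (length-vertexPairs {v})) (ℕ.*-mono-≤ v>0 v>0)
    where
    v>0 : 0 < v
    v>0 = ℕ.*-mono-≤ (ℕ.*-mono-≤ {1} {2} (s≤s z≤n) 0<j) 0<n

  dense : length (vertexPairs {v}) ≤ suc g * q
  dense = ℕ.≤-reflexive (trans (length-vertexPairs {v}) (trans
    (solve 2 (λ j n → con 2 :* j :* n :* (con 2 :* j :* n) := con 2 :* (j :* j) :* (con 2 :* (n :* n))) refl j n)
    (cong (_* q) (sym suc-g))))
    where open +-*-Solver

  disjoint? : ∀ ((A , B) : Subset v × Subset v) → Dec (Disjoint A B)
  disjoint? (A , B) with Fin.any? (λ x → (x ∈? A) ×-dec (x ∈? B))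
  ... | yes (x , x∈A , x∈B) = no λ A#B → A#B x∈A x∈B
  ... | no ¬meet = yes λ x∈A x∈B → ¬meet (_ , x∈A , x∈B)

  ns : List (Subset v)
  ns = subsetsOfSize v n

  F : List (Subset v × Subset v)
  F = filter disjoint? (cartesianProduct ns ns)

  tests : All (IsTest weight vertexPairs nonempty (ℕ.≤-trans 0<j j≤g) dense) F
  tests = All.tabulate λ {(A , B)} f∈ →
    let AB∈ , A#B = List∈.∈-filter⁻ disjoint? {xs = cartesianProduct ns ns} f∈
        A∈ , B∈ = List∈.∈-cartesianProduct⁻ ns ns AB∈
    in weight≤1 A#B , ℕ.≤-reflexive (sym (trans (sum-weight A B)
         (cong₂ (λ a b → 2 * (a * b)) (All.lookup (subsetsOfSize-size v n) A∈) (All.lookup (subsetsOfSize-size v n) B∈))))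

  few : length F < 2 ^ (b * n + b * n)
  few = begin-strict
    length F                                   ≤⟨ List.length-filter disjoint? (cartesianProduct ns ns) ⟩
    length (cartesianProduct ns ns)            ≡⟨ length-cartesianProduct ns ns ⟩
    length ns * length ns                      <⟨ ℕ.*-mono-< (few-subsets j n b 0<j 0<n 4k≤2^b) (few-subsets j n b 0<j 0<n 4k≤2^b) ⟩
    2 ^ (b * n) * 2 ^ (b * n)                  ≡⟨ ℕ.^-distribˡ-+-* 2 (b * n) (b * n) ⟨
    2 ^ (b * n + b * n)                        ∎
    where open ℕ.≤-Reasoning

  open List? (≡-dec (Fin._≟_ {v}) (Fin._≟_ {v})) using () renaming (_∈?_ to _∈ᴸ?_)

  fromHittingSet : ∃[ sel ] (length sel ≡ suc g * (b * n + b * n) ×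
                             (∀ {f} → f List.∈ F → ∃[ e ] (e List.∈ sel × weight e f ≢ 0))) →
    ∃[ f ] (let G = graphOf (2 * j * n) f in
          Graph.size G ≤ 2 * j * (2 * j) * b * n ×
          (∀ A B → Disjoint A B → ∣ A ∣ ≡ n → ∣ B ∣ ≡ n → ∃[ u ] ∃[ w ] (u ∈ A × w ∈ B × Graph._~_ G u w)))
  fromHittingSet (sel , len , hits) = f , small , joins
    where
    f : Fin v → Fin v → Bool
    f u w = isYes ((u , w) ∈ᴸ? sel)

    small : Graph.size (graphOf v f) ≤ k * k * b * n
    small = ℕ.≤-trans (size-≤-length (graphOf v f) sel (Sum.map toWitness toWitness ∘ graphOf⁻ f))
      (ℕ.≤-reflexive (trans len (trans (cong (_* (b * n + b * n)) suc-g)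
        (solve 3 (λ j b n → con 2 :* (j :* j) :* (b :* n :+ b :* n) := con 2 :* j :* (con 2 :* j) :* b :* n) refl j b n))))
      where open +-*-Solver

    joins : ∀ A B → Disjoint A B → ∣ A ∣ ≡ n → ∣ B ∣ ≡ n → ∃[ u ] ∃[ w ] (u ∈ A × w ∈ B × Graph._~_ (graphOf v f) u w)
    joins A B A#B A≡n B≡n with hits (List∈.∈-filter⁺ disjoint?
      (List∈.∈-cartesianProduct⁺ (∈-subsetsOfSize A A≡n) (∈-subsetsOfSize B B≡n)) A#B)
    ... | (u , w) , e∈ , hit with weight⁻ {u = u} {w} {A} {B} hit
    ...   | inj₁ (u∈A , w∈B) = u , w , u∈A , w∈B , graphOf⁺ f (λ u≡w → A#B u∈A (subst (_∈ B) (sym u≡w) w∈B)) (inj₁ (fromWitness e∈))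
    ...   | inj₂ (u∈B , w∈A) = w , u , w∈A , u∈B , graphOf⁺ f (λ w≡u → A#B w∈A (subst (_∈ B) (sym w≡u) u∈B)) (inj₂ (fromWitness e∈))

-- The least number of edges

-- Colourings, graphs and vertex maps are searched as tables: without function extensionality a
-- predicate on functions need not respect pointwise equality.
Searchable : Set → Set₁
Searchable A = ∀ {P : A → Set} → Decidable P → Dec (∃[ x ] P x)

searchable-Bool : Searchable Bool
searchable-Bool P? with P? true | P? false
... | yes p | _     = yes (true , p)
... | no _  | yes p = yes (false , p)
... | no ¬t | no ¬f = no λ { (true , p) → ¬t p ; (false , p) → ¬f p }

searchable-Vec : ∀ {A} → Searchable A → ∀ k → Searchable (Vec A k)
searchable-Vec any?A zero    P? = map′ (λ p → [] , p) (λ { ([] , p) → p }) (P? [])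
searchable-Vec any?A (suc k) P? = map′ (λ (x , xs , p) → x ∷ xs , p) (λ { (x ∷ xs , p) → x , xs , p })
  (any?A λ x → searchable-Vec any?A k λ xs → P? (x ∷ xs))

Matrix : Set → ℕ → Set
Matrix A k = Vec (Vec A k) k

entry : ∀ {A k} → Matrix A k → Fin k → Fin k → A
entry M u v = lookup (lookup M u) v

matrix : ∀ {A k} → (Fin k → Fin k → A) → Matrix A k
matrix f = Vec.tabulate λ u → Vec.tabulate (f u)

entry-matrix : ∀ {A k} (f : Fin k → Fin k → A) u v → entry (matrix f) u v ≡ f u v
entry-matrix f u v = trans (cong (λ row → lookup row v) (Vec.lookup∘tabulate (λ u → Vec.tabulate (f u)) u))
                           (Vec.lookup∘tabulate (f u) v)

searchable-Matrix : ∀ {A} → Searchable A → ∀ k → Searchable (Matrix A k)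
searchable-Matrix any?A k = searchable-Vec (searchable-Vec any?A k) k

least : ∀ {P : ℕ → Set} → Decidable P → ∀ {n} → P n → ∃[ m ] (P m × (∀ {m′} → P m′ → m ≤ m′))
least P? {n} pn with P? 0
... | yes p0 = 0 , p0 , λ _ → z≤n
least P? {zero}  pn | no ¬p0 = contradiction pn ¬p0
least {P} P? {suc n} pn | no ¬p0 =
  let m , pm , least-m = least (P? ∘ suc) pn in suc m , pm , λ {m′} → above m least-m m′
  where
  above : ∀ m → (∀ {m′} → P (suc m′) → m ≤ m′) → ∀ m′ → P m′ → suc m ≤ m′
  above m least-m zero     p = contradiction p ¬p0
  above m least-m (suc m′) p = s≤s (least-m p)

module _ {H : Graph} {t} (χ : EdgeColouring H t) where
  open Graph H
  open EdgeColouring χ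

  colour-cong : ∀ {u v u′ v′} (e : u ~ v) (e′ : u′ ~ v′) → u ≡ u′ → v ≡ v′ → colour e ≡ colour e′
  colour-cong e e′ refl refl = cong colour (T-irrelevant e e′)

  colouredEdge? : ∀ i u v → Dec (∃[ e ] colour {u} {v} e ≡ i)
  colouredEdge? i u v with T? (adj u v)
  ... | no ¬e = no λ (e , _) → ¬e e
  ... | yes e = map′ (e ,_) (λ (e′ , eq) → trans (colour-cong e e′ refl refl) eq) (colour e Fin.≟ i)

  module _ (G : Graph) (i : Fin t) where
    private module G = Graph G

    -- A form of `MonochromaticCopy` that is decidable for fixed `φ` and invariant under pointwise
    -- equality.
    IsCopy : (G.Vertex → Vertex) → Set
    IsCopy φ = (∀ x y → φ x ≡ φ y → x ≡ y) × (∀ x y → x G.~ y → ∃[ e ] colour {φ x} {φ y} e ≡ i)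

    isCopy? : ∀ φ → Dec (IsCopy φ)
    isCopy? φ = (Fin.all? λ x → Fin.all? λ y → (φ x Fin.≟ φ y) →-dec (x Fin.≟ y))
      ×-dec (Fin.all? λ x → Fin.all? λ y → T? (G.adj x y) →-dec colouredEdge? i (φ x) (φ y))

    IsCopy-cong : ∀ {φ ψ} → (∀ x → φ x ≡ ψ x) → IsCopy φ → IsCopy ψ
    IsCopy-cong φ≗ψ (inj , mono) =
      (λ x y eq → inj x y (trans (φ≗ψ x) (trans eq (sym (φ≗ψ y))))) ,
      λ x y x~y → let e , eq = mono x y x~y
                      e′ = subst₂ _~_ (φ≗ψ x) (φ≗ψ y) e
                  in e′ , trans (colour-cong e′ e (sym (φ≗ψ x)) (sym (φ≗ψ y))) eq

    fromIsCopy : ∀ {φ} → IsCopy φ → MonochromaticCopy G H χ i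
    fromIsCopy {φ} (inj , mono) = record
      { φ = φ ; injective = λ {x} {y} → inj x y
      ; homomorphism = λ {x} {y} e → proj₁ (mono x y e)
      ; monochromatic = λ {x} {y} e → proj₂ (mono x y e)
      }

    toIsCopy : (copy : MonochromaticCopy G H χ i) → IsCopy (MonochromaticCopy.φ copy)
    toIsCopy copy = (λ x y → injective) , λ x y e → homomorphism e , monochromatic e
      where open MonochromaticCopy copy

    copy? : Dec (MonochromaticCopy G H χ i)
    copy? = map′ (fromIsCopy ∘ proj₂)
      (λ copy → Vec.tabulate (MonochromaticCopy.φ copy) , IsCopy-cong (λ x → sym (Vec.lookup∘tabulate _ x)) (toIsCopy copy))
      (searchable-Vec Fin.any? G.order λ φ → isCopy? (lookup φ))

module _ (H : Graph) {t : ℕ} where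
  open Graph H

  matrixColouring : (C : Matrix (Fin t) order) → (∀ u v → entry C u v ≡ entry C v u) → EdgeColouring H t
  matrixColouring C C-sym = record { colour = λ {u} {v} _ → entry C u v ; colour-sym = λ {u} {v} _ _ → C-sym u v }

  module _ (i₀ : Fin t) (χ : EdgeColouring H t) where
    open EdgeColouring χ

    private
      colourOf : Vertex → Vertex → Fin t
      colourOf u v with T? (adj u v)
      ... | yes e = colour e
      -- Non-edges have no colour; the table is filled with an arbitrary one.
      ... | no _  = i₀

      colourOf-sym : ∀ u v → colourOf u v ≡ colourOf v u
      colourOf-sym u v with T? (adj u v) | T? (adj v u)
      ... | yes e | yes e′ = colour-sym e e′
      ... | no ¬e | no ¬e′ = refl
      ... | yes e | no ¬e′ = contradiction (subst T (symmetric u v) e) ¬e′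
      ... | no ¬e | yes e′ = contradiction (subst T (symmetric v u) e′) ¬e

      colourOf-edge : ∀ {u v} (e : u ~ v) → colourOf u v ≡ colour e
      colourOf-edge {u} {v} e with T? (adj u v)
      ... | yes e′ = colour-cong χ e′ e refl refl
      ... | no ¬e  = contradiction e ¬e

    colourMatrix : Matrix (Fin t) order
    colourMatrix = matrix colourOf

    colourMatrix-sym : ∀ u v → entry colourMatrix u v ≡ entry colourMatrix v u
    colourMatrix-sym u v = trans (entry-matrix colourOf u v) (trans (colourOf-sym u v) (sym (entry-matrix colourOf v u)))

    recolour : ∀ {G i} → MonochromaticCopy G H (matrixColouring colourMatrix colourMatrix-sym) i → MonochromaticCopy G H χ i
    recolour copy = record
      { φ = φ ; injective = injective ; homomorphism = homomorphism
      ; monochromatic = λ e → trans (sym (trans (entry-matrix colourOf _ _) (colourOf-edge (homomorphism e)))) (monochromatic e)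
      }
      where open MonochromaticCopy copy

  arrows? : Fin t → (Gs : Fin t → Graph) → Dec (Arrows H Gs)
  arrows? i₀ Gs = map′ fromMatrices toMatrices (¬? (searchable-Matrix Fin.any? order bad?))
    where
    Bad : Matrix (Fin t) order → Set
    Bad C = ∃[ C-sym ] ¬ (∃[ i ] MonochromaticCopy (Gs i) H (matrixColouring C C-sym) i)

    bad? : ∀ C → Dec (Bad C)
    bad? C with Fin.all? (λ u → Fin.all? λ v → entry C u v Fin.≟ entry C v u)
    ... | no ¬C-sym = no (¬C-sym ∘ proj₁)
    ... | yes C-sym = map′ (C-sym ,_)
      -- The two colourings differ only in their proofs of symmetry, so the copy can be rebuilt from
      -- its underlying map.
      (λ (C-sym′ , none) (i , copy) → none (i , fromIsCopy _ _ _ (toIsCopy (matrixColouring C C-sym) (Gs i) i copy)))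
      (¬? (Fin.any? λ i → copy? (matrixColouring C C-sym) (Gs i) i))

    fromMatrices : ¬ (∃[ C ] Bad C) → Arrows H Gs
    fromMatrices ¬bad χ =
      let C-sym = colourMatrix-sym i₀ χ
          χ′ = matrixColouring (colourMatrix i₀ χ) C-sym
          i , copy = decidable-stable (Fin.any? λ i → copy? χ′ (Gs i) i) λ none → ¬bad (colourMatrix i₀ χ , C-sym , none)
      in i , recolour i₀ χ copy

    toMatrices : Arrows H Gs → ¬ (∃[ C ] Bad C)
    toMatrices arrows (C , C-sym , none) = none (arrows (matrixColouring C C-sym))

-- Drawing graphs on few vertices.

NoIsolated : Graph → Set
NoIsolated G = ∀ u → ∃[ v ] Graph._~_ G u v

module _ {H H′ : Graph} (f : Graph.Vertex H → Graph.Vertex H′)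
         (hom : ∀ {u v} → Graph._~_ H u v → Graph._~_ H′ (f u) (f v))
         (inj : ∀ {u v u′ v′} → Graph._~_ H u u′ → Graph._~_ H v v′ → f u ≡ f v → u ≡ v) where

  -- `f` may identify isolated vertices of `H`. A copy of a graph without isolated vertices avoids
  -- them, so it stays injective after composition with `f`.
  transfer-arrows : ∀ {t} (Gs : Fin t → Graph) → (∀ i → NoIsolated (Gs i)) → Arrows H Gs → Arrows H′ Gs
  transfer-arrows Gs full arrows χ =
    let i , copy = arrows pulled
        open MonochromaticCopy copy
    in i , record
      { φ = f ∘ φ
      ; injective = λ {x} {y} eq → injective (inj (homomorphism (proj₂ (full i x))) (homomorphism (proj₂ (full i y))) eq)
      ; homomorphism = hom ∘ homomorphism
      ; monochromatic = monochromatic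
      }
    where
    open EdgeColouring χ
    pulled : EdgeColouring H _
    pulled = record { colour = colour ∘ hom ; colour-sym = λ e e′ → colour-sym (hom e) (hom e′) }

-- Only the endpoints of edges matter, so a graph with at most M edges can be drawn on 2M + 1 vertices.
module _ (H : Graph) (M : ℕ) (size≤M : Graph.size H ≤ M) where
  open Graph H
  private
    K : ℕ
    K = suc (M + M)

    endpoints : List Vertex
    endpoints = List.map proj₁ (edges H) ++ List.map proj₂ (edges H)

    open List? (Fin._≟_ {order}) using () renaming (_∈?_ to _∈ᴸ?_)

    endpoint : ∀ {u v} → u ~ v → u List.∈ endpoints
    endpoint {u} {v} u~v with ∈-edges H u~v
    ... | inj₁ e∈ = List∈.∈-++⁺ˡ (List∈.∈-map⁺ proj₁ e∈)
    ... | inj₂ e∈ = List∈.∈-++⁺ʳ (List.map proj₁ (edges H)) (List∈.∈-map⁺ proj₂ e∈)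

    length-endpoints : length endpoints ≤ M + M
    length-endpoints = ℕ.≤-trans (ℕ.≤-reflexive (trans (List.length-++ (List.map proj₁ (edges H)))
      (cong₂ _+_ (List.length-map proj₁ (edges H)) (List.length-map proj₂ (edges H))))) (ℕ.+-mono-≤ size≤M size≤M)

    place : ∀ u → Dec (u List.∈ endpoints) → Fin K
    place u (yes u∈) = suc (inject≤ (Any.index u∈) length-endpoints)
    -- All isolated vertices share the one additional place.
    place u (no _)   = zero

    place-injective : ∀ {u v} → u List.∈ endpoints → v List.∈ endpoints → ∀ du dv → place u du ≡ place v dv → u ≡ v
    place-injective {u} {v} u∈ v∈ (yes p) (yes q) eq =
      trans (Any.lookup-index p) (trans (cong (List.lookup endpoints)
        (Fin.inject≤-injective length-endpoints length-endpoints (Any.index p) (Any.index q) (Fin.suc-injective eq))) (sym (Any.lookup-index q)))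
    place-injective u∈ v∈ (no u∉) _ eq = contradiction u∈ u∉
    place-injective u∈ v∈ _ (no v∉) eq = contradiction v∈ v∉

    f : Vertex → Fin K
    f u = place u (u ∈ᴸ? endpoints)

    f-injective : ∀ {u v u′ v′} → u ~ u′ → v ~ v′ → f u ≡ f v → u ≡ v
    f-injective {u} {v} u~ v~ = place-injective (endpoint u~) (endpoint v~) (u ∈ᴸ? endpoints) (v ∈ᴸ? endpoints)

    image? : ∀ x y → Dec (∃[ u ] ∃[ v ] (u ~ v × x ≡ f u × y ≡ f v))
    image? x y = Fin.any? λ u → Fin.any? λ v → T? (adj u v) ×-dec (x Fin.≟ f u) ×-dec (y Fin.≟ f v)

  compressed : Matrix Bool K
  compressed = matrix λ x y → isYes (image? x y)

  compressedGraph : Graph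
  compressedGraph = graphOf K (entry compressed)

  private
    compressed⁻ : ∀ {x y} → T (entry compressed x y) → ∃[ u ] ∃[ v ] (u ~ v × x ≡ f u × y ≡ f v)
    compressed⁻ {x} {y} = toWitness ∘ subst T (entry-matrix (λ x y → isYes (image? x y)) x y)

    compressed-edge : ∀ {x y} → Graph._~_ compressedGraph x y → ∃[ u ] ∃[ v ] (u ~ v × x ≡ f u × y ≡ f v)
    compressed-edge {x} {y} x~y with graphOf⁻ (entry compressed) {x} {y} x~y
    ... | inj₁ xy = compressed⁻ {x} {y} xy
    ... | inj₂ yx = let u , v , u~v , y≡ , x≡ = compressed⁻ {y} {x} yx in v , u , subst T (symmetric u v) u~v , x≡ , y≡

    f-hom : ∀ {u v} → u ~ v → Graph._~_ compressedGraph (f u) (f v)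
    f-hom {u} {v} u~v = graphOf⁺ (entry compressed)
      (λ fu≡fv → adjacent-distinct H u~v (f-injective u~v (subst T (symmetric u v) u~v) fu≡fv))
      (inj₁ (subst T (sym (entry-matrix (λ x y → isYes (image? x y)) (f u) (f v))) (fromWitness (u , v , u~v , refl , refl))))

  compressed-size : Graph.size compressedGraph ≤ size
  compressed-size = ℕ.≤-trans (size-≤-length compressedGraph images listed)
    (ℕ.≤-reflexive (List.length-map (λ (u , v) → f u , f v) (edges H)))
    where
    images : List (Fin K × Fin K)
    images = List.map (λ (u , v) → f u , f v) (edges H)
    listed : ∀ {x y} → Graph._~_ compressedGraph x y → (x , y) List.∈ images ⊎ (y , x) List.∈ images
    listed {x} {y} x~y with compressed-edge {x} {y} x~y
    ... | u , v , u~v , refl , refl = Sum.map (List∈.∈-map⁺ _) (List∈.∈-map⁺ _) (∈-edges H u~v)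

  compressed-arrows : ∀ {t} (Gs : Fin t → Graph) → (∀ i → NoIsolated (Gs i)) → Arrows H Gs → Arrows compressedGraph Gs
  compressed-arrows = transfer-arrows f f-hom f-injective

-- The minimum is taken over graphs on `suc (M + M)` vertices, `M` being the size of `H`. A
-- competitor with at most `M` edges can be compressed to that order without gaining edges; a larger
-- one cannot beat `H`.
sizeRamseyNumber-≤ : ∀ {t} (Gs : Fin t → Graph) → Fin t → (∀ i → NoIsolated (Gs i)) → ∀ H → Arrows H Gs →
                     ∃[ m ] (IsSizeRamseyNumber Gs m × m ≤ Graph.size H)
sizeRamseyNumber-≤ Gs i₀ full H arrows =
  let m , (A , size≡m , A-arrows) , least-m = least arrowing? (compress H ℕ.≤-refl arrows)
      m≤ = ℕ.≤-trans (least-m (compress H ℕ.≤-refl arrows)) (compressed-size H M ℕ.≤-refl)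
  in m , ((graphOf K (entry A) , size≡m , A-arrows) , minimal least-m m≤) , m≤
  where
  M K : ℕ
  M = Graph.size H
  K = suc (M + M)

  Arrowing : ℕ → Set
  Arrowing m = ∃[ A ] (Graph.size (graphOf K (entry A)) ≡ m × Arrows (graphOf K (entry A)) Gs)

  arrowing? : ∀ m → Dec (Arrowing m)
  arrowing? m = searchable-Matrix searchable-Bool K λ A →
    (Graph.size (graphOf K (entry A)) ℕ.≟ m) ×-dec arrows? (graphOf K (entry A)) i₀ Gs

  compress : ∀ H′ (small : Graph.size H′ ≤ M) → Arrows H′ Gs → Arrowing (Graph.size (compressedGraph H′ M small))
  compress H′ small H′-arrows = compressed H′ M small , refl , compressed-arrows H′ M small Gs full H′-arrows

  minimal : ∀ {m} → (∀ {m′} → Arrowing m′ → m ≤ m′) → m ≤ M → ∀ m′ → HasArrowingGraphOfSize Gs m′ → m ≤ m′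
  minimal least-m m≤M m′ (H′ , refl , H′-arrows) with Graph.size H′ ℕ.≤? M
  ... | yes small = ℕ.≤-trans (least-m (compress H′ small H′-arrows)) (compressed-size H′ M small)
  ... | no  large = ℕ.≤-trans m≤M (ℕ.<⇒≤ (ℕ.≰⇒> large))

-- Monochromatic cycles

n≤2^⌈log₂n⌉ : ∀ n → n ≤ 2 ^ ℕ.⌈log₂ n ⌉
n≤2^⌈log₂n⌉ = <-rec (λ n → n ≤ 2 ^ ℕ.⌈log₂ n ⌉) step
  where
  open ℕ.≤-Reasoning
  step : ∀ N → (∀ {m} → m < N → m ≤ 2 ^ ℕ.⌈log₂ m ⌉) → N ≤ 2 ^ ℕ.⌈log₂ N ⌉
  step zero              _   = z≤n
  step (suc zero)        _   = ℕ.≤-refl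
  step N@(suc (suc n)) rec = begin
    N                              ≡⟨ ℕ.⌊n/2⌋+⌈n/2⌉≡n N ⟨
    ⌊ N /2⌋ + ⌈ N /2⌉              ≤⟨ ℕ.+-monoˡ-≤ ⌈ N /2⌉ (ℕ.⌊n/2⌋≤⌈n/2⌉ N) ⟩
    ⌈ N /2⌉ + ⌈ N /2⌉              ≡⟨ cong (⌈ N /2⌉ +_) (ℕ.+-identityʳ ⌈ N /2⌉) ⟨
    2 * ⌈ N /2⌉                    ≤⟨ ℕ.*-monoʳ-≤ 2 (rec (ℕ.⌈n/2⌉<n n)) ⟩
    2 ^ suc ℕ.⌈log₂ ⌈ N /2⌉ ⌉        ≡⟨ cong (λ l → 2 ^ suc l) (ℕ.⌈log₂⌈n/2⌉⌉≡⌈log₂n⌉∸1 N) ⟩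
    2 ^ suc (ℕ.⌈log₂ N ⌉ ∸ 1)        ≡⟨ cong (2 ^_) (ℕ.m+[n∸m]≡n (ℕ.⌈log₂⌉-mono-≤ {2} {N} (s≤s (s≤s z≤n)))) ⟩
    2 ^ ℕ.⌈log₂ N ⌉                  ∎

lookup-injective : ∀ {A : Set} {xs : List A} → Unique xs → ∀ i j → List.lookup xs i ≡ List.lookup xs j → i ≡ j
lookup-injective (_ ∷ _)    zero    zero    eq = refl
lookup-injective (x∉ ∷ _)   zero    (suc j) eq = contradiction eq (All.lookup x∉ (List∈.∈-lookup j))
lookup-injective (x∉ ∷ _)   (suc i) zero    eq = contradiction (sym eq) (All.lookup x∉ (List∈.∈-lookup i))
lookup-injective (_ ∷ uniq) (suc i) (suc j) eq = cong suc (lookup-injective uniq i j eq)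

module _ {V : Set} {R : Rel V 0ℓ} where

  Path-first : ∀ {u v xs} → Path R u v xs → ∀ i → toℕ i ≡ 0 → List.lookup xs i ≡ u
  Path-first [ _ ]   zero refl = refl
  Path-first (_ ∷ _) zero refl = refl

  Path-last : ∀ {u v xs} → Path R u v xs → ∀ i → suc (toℕ i) ≡ length xs → List.lookup xs i ≡ v
  Path-last [ _ ]   zero    eq = refl
  Path-last (_ ∷ [ _ ]) zero ()
  Path-last (_ ∷ (_ ∷ _)) zero ()
  Path-last (_ ∷ p) (suc i) eq = Path-last p i (ℕ.suc-injective eq)

  Path-consecutive : ∀ {u v xs} → Path R u v xs → ∀ i j → toℕ j ≡ suc (toℕ i) → R (List.lookup xs i) (List.lookup xs j)
  Path-consecutive [ _ ]    zero    zero    ()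
  Path-consecutive (Ru ∷ p) zero    (suc j) eq = subst (R _) (sym (Path-first p j (ℕ.suc-injective eq))) Ru
  Path-consecutive (Ru ∷ p) (suc i) (suc j) eq = Path-consecutive p i j (ℕ.suc-injective eq)

module _ {H : Graph} {t} (χ : EdgeColouring H t) where
  open Graph H
  open EdgeColouring χ

  Coloured : Fin t → Rel Vertex 0ℓ
  Coloured i u v = ∃[ e ] colour {u} {v} e ≡ i

  Coloured-sym : ∀ i → Symmetric (Coloured i)
  Coloured-sym i {u} {v} (e , eq) = let e′ = subst T (symmetric u v) e in e′ , trans (colour-sym e′ e) eq

  cycle-copy : ∀ {i ℓ} → Cycle (Coloured i) ℓ → MonochromaticCopy (cycle ℓ) H χ i
  cycle-copy {i} (u , v , xs , path , Rvu , unique , refl) = record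
    { φ = List.lookup xs
    ; injective = λ {x} {y} → lookup-injective unique x y
    ; homomorphism = λ {x} {y} x~y → proj₁ (edge x y x~y)
    ; monochromatic = λ {x} {y} x~y → proj₂ (edge x y x~y)
    }
    where
    next : ∀ x y → T ((toℕ y ≡ᵇ suc (toℕ x)) ∨ ((suc (toℕ x) ≡ᵇ length xs) ∧ (toℕ y ≡ᵇ 0))) →
           Coloured i (List.lookup xs x) (List.lookup xs y)
    next x y h with Equivalence.to (T-∨ {toℕ y ≡ᵇ suc (toℕ x)}) h
    ... | inj₁ consecutive = Path-consecutive path x y (ℕ.≡ᵇ⇒≡ (toℕ y) _ consecutive)
    ... | inj₂ wrap =
      let last , first = Equivalence.to (T-∧ {suc (toℕ x) ≡ᵇ length xs}) wrap
      in subst₂ (Coloured i) (sym (Path-last path x (ℕ.≡ᵇ⇒≡ _ _ last))) (sym (Path-first path y (ℕ.≡ᵇ⇒≡ _ _ first))) Rvu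

    edge : ∀ x y → Graph._~_ (cycle (length xs)) x y → Coloured i (List.lookup xs x) (List.lookup xs y)
    edge x y x~y =
      [ next x y , Coloured-sym i ∘ next y x ]′
        (Equivalence.to (T-∨ {(toℕ y ≡ᵇ suc (toℕ x)) ∨ ((suc (toℕ x) ≡ᵇ length xs) ∧ (toℕ y ≡ᵇ 0))})
          (proj₂ (Equivalence.to (T-∧ {not (does (x Fin.≟ y))}) x~y)))

cycle-full : ∀ ℓ → 2 ≤ ℓ → NoIsolated (cycle ℓ)
cycle-full ℓ 2≤ℓ u with suc (toℕ u) ℕ.<? ℓ
... | yes su<ℓ = fromℕ< su<ℓ , Equivalence.from T-∧ (distinct , Equivalence.from T-∨ (inj₁ (Equivalence.from T-∨ (inj₁ (ℕ.≡⇒≡ᵇ _ _ (Fin.toℕ-fromℕ< su<ℓ))))))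
  where
  distinct : T (not (does (u Fin.≟ fromℕ< su<ℓ)))
  distinct with u Fin.≟ fromℕ< su<ℓ
  ... | yes eq = contradiction (trans (cong toℕ eq) (Fin.toℕ-fromℕ< su<ℓ)) (ℕ.m≢1+n+m (toℕ u) {0})
  ... | no _   = _
... | no su≮ℓ = z , Equivalence.from T-∧ (distinct , Equivalence.from (T-∨ {(toℕ z ≡ᵇ suc (toℕ u)) ∨ wrap})
      (inj₁ (Equivalence.from (T-∨ {toℕ z ≡ᵇ suc (toℕ u)}) (inj₂ (Equivalence.from T-∧
        (ℕ.≡⇒≡ᵇ _ _ su≡ℓ , ℕ.≡⇒≡ᵇ _ _ (Fin.toℕ-fromℕ< 0<ℓ)))))))
  where
  0<ℓ : 0 < ℓ
  0<ℓ = ℕ.<⇒≤ 2≤ℓ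
  z = fromℕ< 0<ℓ
  wrap = (suc (toℕ u) ≡ᵇ ℓ) ∧ (toℕ z ≡ᵇ 0)
  su≡ℓ : suc (toℕ u) ≡ ℓ
  su≡ℓ = ℕ.≤-antisym (Fin.toℕ<n u) (ℕ.≮⇒≥ su≮ℓ)
  distinct : T (not (does (u Fin.≟ z)))
  distinct with u Fin.≟ z
  ... | yes eq = contradiction (ℕ.≤-trans 2≤ℓ (ℕ.≤-reflexive (trans (sym su≡ℓ) (cong suc (trans (cong toℕ eq) (Fin.toℕ-fromℕ< 0<ℓ)))))) (ℕ.<-irrefl refl)
  ... | no _   = _

module _ {t} (ns : Vec ℕ t) (n d : ℕ) (0<n : 0 < n)
         (ns≥ : ∀ i → 2 * d + 2 ≤ Vec.lookup ns i) (ns≤n : ∀ i → Vec.lookup ns i ≤ n)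
         (H : Graph) (order≤2^d : Graph.order H ≤ 2 ^ d)
         (order≥ : oddFactor (count (λ n → ¬? (2 ∣? n)) ns) * (21 ^ count (2 ∣?_) ns * n) ≤ Graph.order H)
         (joined : ∀ A B → Disjoint A B → ∣ A ∣ ≡ n → ∣ B ∣ ≡ n → Edge (Graph._~_ H) A B) where

  open Graph H

  -- Otherwise two sets of `n` vertices are separated in every colour, whereas `joined` gives an
  -- edge between them, and this edge has a colour.
  arrows-cycles : Arrows H (λ i → cycle (Vec.lookup ns i))
  arrows-cycles χ = [ (λ (i , c) → i , cycle-copy χ c) , impossible ]′
    (found-or-separated (Coloured χ) (colouredEdge? χ) (Coloured-sym χ) (Vec.lookup ns) d n 0<n order≤2^d ns≥ ns≤n {⊤}
      (subst₂ _≤_ (cong (λ ns → oddFactor (count (λ n → ¬? (2 ∣? n)) ns) * (21 ^ count (2 ∣?_) ns * n)) (sym (Vec.map-lookup-allFin ns)))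
        (sym (∣⊤∣≡n order)) order≥))
    where
    open EdgeColouring χ
    impossible : ∃[ S ] ∃[ T ] (Disjoint S T × ∣ S ∣ ≡ n × ∣ T ∣ ≡ n × (∀ i → Separated (Coloured χ i) S T)) → ∃[ i ] MonochromaticCopy (cycle (Vec.lookup ns i)) H χ i
    impossible (S , T , S#T , S≡n , T≡n , sep) =
      let s , t , s∈ , t∈ , e = joined S T S#T S≡n T≡n
      in contradiction (e , refl) (sep (colour e) s∈ t∈)

-- The constants

count-complement : ∀ {A : Set} {P : A → Set} (P? : Decidable P) {k} (xs : Vec A k) →
                   count (λ x → ¬? (P? x)) xs + count P? xs ≡ k
count-complement P? [] = refl
count-complement P? (x ∷ xs) with P? x
... | yes _ = trans (ℕ.+-suc _ _) (cong suc (count-complement P? xs))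
... | no _  = cong suc (count-complement P? xs)

lookup≤maximum : ∀ {t} (ns : Vec ℕ t) i → lookup ns i ≤ maximum ns
lookup≤maximum (n ∷ ns) zero    = ℕ.m≤m⊔n n (maximum ns)
lookup≤maximum (n ∷ ns) (suc i) = ℕ.≤-trans (lookup≤maximum ns i) (ℕ.m≤n⊔m n (maximum ns))

-- `2 ^ t - 1` by the recursion of the exponent of 26 in `oddFactor`: 13 (2 f)² = 2 * 26 f².
mersenne : ℕ → ℕ
mersenne zero    = 0
mersenne (suc t) = suc (mersenne t + mersenne t)

suc-mersenne : ∀ t → suc (mersenne t) ≡ 2 ^ t
suc-mersenne zero    = refl
suc-mersenne (suc t) = begin
  suc (suc (mersenne t + mersenne t))      ≡⟨ cong suc (ℕ.+-suc (mersenne t) (mersenne t)) ⟨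
  suc (mersenne t) + suc (mersenne t)      ≡⟨ cong (λ q → q + q) (suc-mersenne t) ⟩
  2 ^ t + 2 ^ t                            ≡⟨ cong (2 ^ t +_) (ℕ.+-identityʳ (2 ^ t)) ⟨
  2 ^ suc t                                ∎
  where open ≡-Reasoning

oddFactor-closed : ∀ t → oddFactor t ≡ 2 * 26 ^ mersenne t
oddFactor-closed zero    = refl
oddFactor-closed (suc t) = begin
  13 * (oddFactor t * oddFactor t)         ≡⟨ cong (λ f → 13 * (f * f)) (oddFactor-closed t) ⟩
  13 * (2 * f * (2 * f))                   ≡⟨ solve 1 (λ f → con 13 :* (con 2 :* f :* (con 2 :* f)) := con 2 :* (con 26 :* (f :* f))) refl f ⟩
  2 * (26 * (f * f))                       ≡⟨ cong (λ z → 2 * (26 * z)) (ℕ.^-distribˡ-+-* 26 (mersenne t) (mersenne t)) ⟨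
  2 * 26 ^ suc (mersenne t + mersenne t)   ∎
  where
  open ≡-Reasoning
  open +-*-Solver
  f = 26 ^ mersenne t

scale-≤ : ∀ A B k l {x y} → A * k ≤ B * l → x ≤ y → A * (k * x) ≤ B * (l * y)
scale-≤ A B k l {x} {y} Ak≤Bl x≤y = begin
  A * (k * x)  ≡⟨ ℕ.*-assoc A k x ⟨
  A * k * x    ≤⟨ ℕ.*-mono-≤ Ak≤Bl x≤y ⟩
  B * l * y    ≡⟨ ℕ.*-assoc B l y ⟩
  B * (l * y)  ∎
  where open ℕ.≤-Reasoning

-- A single factor 35/26 or 81/21 pays for `A / B`; the remaining powers are compared base by base.
-- At least one factor must be present.
power-gain : ∀ A B p s → 0 < p + s → A * 26 ≤ B * 35 → A * 21 ≤ B * 81 →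
             A * (26 ^ p * 21 ^ s) ≤ B * (35 ^ p * 81 ^ s)
power-gain A B (suc p) s _ A26≤B35 _ = begin
  A * (26 * 26 ^ p * 21 ^ s)    ≡⟨ cong (A *_) (ℕ.*-assoc 26 (26 ^ p) (21 ^ s)) ⟩
  A * (26 * (26 ^ p * 21 ^ s))  ≤⟨ scale-≤ A B 26 35 A26≤B35 (ℕ.*-mono-≤ (ℕ.^-monoˡ-≤ p (ℕ.m≤m+n 26 9)) (ℕ.^-monoˡ-≤ s (ℕ.m≤m+n 21 60))) ⟩
  B * (35 * (35 ^ p * 81 ^ s))  ≡⟨ cong (B *_) (ℕ.*-assoc 35 (35 ^ p) (81 ^ s)) ⟨
  B * (35 * 35 ^ p * 81 ^ s)    ∎
  where open ℕ.≤-Reasoning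
power-gain A B zero (suc s) _ _ A21≤B81 = begin
  A * (1 * (21 * 21 ^ s))       ≡⟨ cong (A *_) (ℕ.*-identityˡ (21 * 21 ^ s)) ⟩
  A * (21 * 21 ^ s)             ≤⟨ scale-≤ A B 21 81 A21≤B81 (ℕ.^-monoˡ-≤ s (ℕ.m≤m+n 21 60)) ⟩
  B * (81 * 81 ^ s)             ≡⟨ cong (B *_) (ℕ.*-identityˡ (81 * 81 ^ s)) ⟨
  B * (1 * (81 * 81 ^ s))       ∎
  where open ℕ.≤-Reasoning

private
  regroup₁ : ∀ k l x y → k * (l * x) * y ≡ k * (l * (x * y))
  regroup₁ = solve 4 (λ k l x y → k :* (l :* x) :* y := k :* (l :* (x :* y))) refl
    where open +-*-Solver

  regroup₂ : ∀ k l m x → k * (l * x) * m ≡ m * (k * l) * x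
  regroup₂ = solve 4 (λ k l m x → k :* (l :* x) :* m := m :* (k :* l) :* x) refl
    where open +-*-Solver

  regroup₃ : ∀ k l m x → k * (l * m) * x ≡ k * (l * (m * x))
  regroup₃ = solve 4 (λ k l m x → k :* (l :* m) :* x := k :* (l :* (m :* x))) refl
    where open +-*-Solver

-- The host graph has a n vertices; 2 ^ e separates a from c, which yields the lower bound on ln c.
module Constants (tₒ tₑ : ℕ) (0<t : 0 < tₒ + tₑ) where

  p j a e X : ℕ
  p = mersenne tₒ
  j = 26 ^ p * 21 ^ tₑ
  a = 2 * j
  -- 32 = 2 ^ 5 lies between 26 and 35 and between 21 and 81, so `2 ^ e = 2 * 32 ^ p * 32 ^ tₑ` lies
  -- between `a` and `c`.
  e = 5 * p + 5 * tₑ + 1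
  X = 82 * 35 ^ (2 ^ tₒ) * 81 ^ tₑ

  c : ℚ
  c = ramseyConstant tₒ tₑ

  0<j : 0 < j
  0<j = ℕ.*-mono-≤ (ℕ.m^n>0 26 p) (ℕ.m^n>0 21 tₑ)

  a-eq : oddFactor tₒ * 21 ^ tₑ ≡ a
  a-eq = trans (cong (_* 21 ^ tₑ) (oddFactor-closed tₒ)) (ℕ.*-assoc 2 (26 ^ p) (21 ^ tₑ))

  2^e-eq : 2 ^ e ≡ 2 * (32 ^ p * 32 ^ tₑ)
  2^e-eq = begin
    2 ^ (5 * p + 5 * tₑ + 1)             ≡⟨ ℕ.^-distribˡ-+-* 2 (5 * p + 5 * tₑ) 1 ⟩
    2 ^ (5 * p + 5 * tₑ) * 2             ≡⟨ ℕ.*-comm (2 ^ (5 * p + 5 * tₑ)) 2 ⟩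
    2 * 2 ^ (5 * p + 5 * tₑ)             ≡⟨ cong (2 *_) (ℕ.^-distribˡ-+-* 2 (5 * p) (5 * tₑ)) ⟩
    2 * (2 ^ (5 * p) * 2 ^ (5 * tₑ))     ≡⟨ cong₂ (λ x y → 2 * (x * y)) (ℕ.^-*-assoc 2 5 p) (ℕ.^-*-assoc 2 5 tₑ) ⟨
    2 * (32 ^ p * 32 ^ tₑ)               ∎
    where open ≡-Reasoning

  a≤2^e : a ≤ 2 ^ e
  a≤2^e = ℕ.≤-trans (ℕ.*-monoʳ-≤ 2 (ℕ.*-mono-≤ (ℕ.^-monoˡ-≤ p (ℕ.m≤m+n 26 6)) (ℕ.^-monoˡ-≤ tₑ (ℕ.m≤m+n 21 11))))
    (ℕ.≤-reflexive (sym 2^e-eq))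

  4a≤2^[e+2] : 4 * a ≤ 2 ^ (e + 2)
  4a≤2^[e+2] = begin
    4 * a          ≤⟨ ℕ.*-monoʳ-≤ 4 a≤2^e ⟩
    4 * 2 ^ e      ≡⟨ ℕ.*-comm 4 (2 ^ e) ⟩
    2 ^ e * 2 ^ 2  ≡⟨ ℕ.^-distribˡ-+-* 2 e 2 ⟨
    2 ^ (e + 2)    ∎
    where open ℕ.≤-Reasoning

  X-eq : X ≡ 82 * (35 * (35 ^ p * 81 ^ tₑ))
  X-eq = trans (cong (λ q → 82 * 35 ^ q * 81 ^ tₑ) (sym (suc-mersenne tₒ))) (regroup₁ 82 35 (35 ^ p) (81 ^ tₑ))

  2^e*1225≤X : 2 ^ e * 1225 ≤ X
  2^e*1225≤X = begin
    2 ^ e * 1225                     ≡⟨ ℕ.*-comm (2 ^ e) 1225 ⟩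
    1225 * 2 ^ e                     ≡⟨ cong (1225 *_) 2^e-eq ⟩
    1225 * (2 * (32 ^ p * 32 ^ tₑ))  ≤⟨ scale-≤ 1225 82 2 35 (ℕ.≤ᵇ⇒≤ (1225 * 2) (82 * 35) _)
                                         (ℕ.*-mono-≤ (ℕ.^-monoˡ-≤ p (ℕ.m≤m+n 32 3)) (ℕ.^-monoˡ-≤ tₑ (ℕ.m≤m+n 32 49))) ⟩
    82 * (35 * (35 ^ p * 81 ^ tₑ))   ≡⟨ X-eq ⟨
    X                                ∎
    where open ℕ.≤-Reasoning

  private
    0<p+tₑ : ∀ tₒ → 0 < tₒ + tₑ → 0 < mersenne tₒ + tₑ
    0<p+tₑ zero    0<tₑ = 0<tₑ
    0<p+tₑ (suc _) _    = s≤s z≤n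

  -- This is `c ≥ 31 a / 20` with the denominator 1225 = 35² of `c` cleared; 31/20 is barely above
  -- the square root of 12/5.
  31*a*1225≤20*X : 31 * a * 1225 ≤ 20 * X
  31*a*1225≤20*X = begin
    31 * (2 * j) * 1225                       ≡⟨ regroup₂ 31 2 1225 j ⟩
    1225 * (31 * 2) * j                       ≤⟨ power-gain (1225 * (31 * 2)) (20 * (82 * 35)) p tₑ (0<p+tₑ tₒ 0<t)
                                                  (ℕ.≤ᵇ⇒≤ (1225 * (31 * 2) * 26) (20 * (82 * 35) * 35) _)
                                                  (ℕ.≤ᵇ⇒≤ (1225 * (31 * 2) * 21) (20 * (82 * 35) * 81) _) ⟩
    20 * (82 * 35) * (35 ^ p * 81 ^ tₑ)       ≡⟨ regroup₃ 20 82 35 (35 ^ p * 81 ^ tₑ) ⟩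
    20 * (82 * (35 * (35 ^ p * 81 ^ tₑ)))     ≡⟨ cong (20 *_) X-eq ⟨
    20 * X                                    ∎
    where open ℕ.≤-Reasoning

  c-eq : c ℚ.* ι 1225 ≡ ι X
  c-eq = ι-cancel-/ X (35 ^ 2)

  2^e≤c : ι (2 ^ e) ℚ.≤ c
  2^e≤c = ℚ.*-cancelʳ-≤-pos (ι 1225) (subst₂ ℚ._≤_ (ι-homo-* (2 ^ e) 1225) (sym c-eq) (ι-mono-≤ {2 ^ e * 1225} {X} 2^e*1225≤X))

  0≤c : 0ℚ ℚ.≤ c
  0≤c = ℚ.≤-trans (0≤ι (2 ^ e)) 2^e≤c

  c≤X : c ℚ.≤ ι X
  c≤X = subst₂ ℚ._≤_ (ℚ.*-identityʳ c) c-eq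
    (ℚ.*-monoˡ-≤-nonNeg c {{ℚ.nonNegative 0≤c}} (ι-mono-≤ {1} {1225} (s≤s z≤n)))

  31a≤20c : ι 31 ℚ.* ι a ℚ.≤ ι 20 ℚ.* c
  31a≤20c = ℚ.*-cancelʳ-≤-pos (ι 1225) (subst₂ ℚ._≤_
    (trans (ι-homo-* (31 * a) 1225) (cong (ℚ._* ι 1225) (ι-homo-* 31 a)))
    (trans (ι-homo-* 20 X) (trans (cong (ι 20 ℚ.*_) (sym c-eq)) (sym (ℚ.*-assoc (ι 20) c (ι 1225)))))
    (ι-mono-≤ {31 * a * 1225} {20 * X} 31*a*1225≤20*X))

  12a²≤5c² : ι 12 ℚ.* (ι a ℚ.* ι a) ℚ.≤ ι 5 ℚ.* (c ℚ.* c)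
  -- 80 (5 c² - 12 a²) = (20 c)² - (31 a)² + a².
  12a²≤5c² = ≤-by {e = ℤ.+ 1 ℚ./ 80 ℚ.* ((ι 20 ℚ.* c ℚ.- ι 31 ℚ.* ι a) ℚ.* (ι 20 ℚ.* c ℚ.+ ι 31 ℚ.* ι a) ℚ.+ ι a ℚ.* ι a)}
    (0≤* {ℤ.+ 1 ℚ./ 80} (ℚ.≤ᵇ⇒≤ _) (0≤+ (0≤* (0≤- 31a≤20c) (0≤+ (0≤* (0≤ι 20) 0≤c) (0≤* (0≤ι 31) (0≤ι a)))) (0≤* (0≤ι a) (0≤ι a))))
    (solve 2 (λ c a → con (ι 5) :* (c :* c) := con (ι 12) :* (a :* a)
       :+ con (ℤ.+ 1 ℚ./ 80) :* ((con (ι 20) :* c :- con (ι 31) :* a) :* (con (ι 20) :* c :+ con (ι 31) :* a) :+ a :* a)) refl c (ι a))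
    where open ℚ.+-*-Solver

  order≤2^d : ∀ n → a * n ≤ 2 ^ ⌈log₂ (ι n ℚ.* c) ⌉
  order≤2^d n = ℕ.≤-trans (ι-≤-ceiling (a * n) (ι n ℚ.* c) an≤nc) (n≤2^⌈log₂n⌉ _)
    where
    open ℚ.≤-Reasoning
    an≤nc : ι (a * n) ℚ.≤ ι n ℚ.* c
    an≤nc = begin
      ι (a * n)          ≡⟨ trans (ι-homo-* a n) (ℚ.*-comm (ι a) (ι n)) ⟩
      ι n ℚ.* ι a        ≤⟨ ℚ.*-monoˡ-≤-nonNeg (ι n) {{ℚ.nonNegative (0≤ι n)}} (ℚ.≤-trans (ι-mono-≤ {a} {2 ^ e} a≤2^e) 2^e≤c) ⟩
      ι n ℚ.* c          ∎

theorem1p1 : ∀ (t : ℕ) .{{_ : NonZero t}} →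
    ∃[ N ] ∀ (ns : Vec ℕ t) →
      let n = maximum ns
          c = ramseyConstant (#odd ns) (#even ns)
          ln-c = ln c {{ramseyConstant>0 (#odd ns) (#even ns)}}
      in (∀ i → N ≤ lookup ns i) →
         (∀ i → 2 * ⌈log₂ (ι n ℚ.* c) ⌉ + 2 ≤ lookup ns i) →
         ∃[ m ] (IsSizeRamseyNumber (λ i → cycle (lookup ns i)) m
                 × fromℚ (ι m) ≤ᴿ (ln-c +ᴿ 1ℚ) *ᴿ (c ℚ.* c ℚ.* ι n))
-- Lengths of at least 2 make `n` positive and leave no isolated vertex in any cycle.
theorem1p1 (suc t) = 2 , λ ns 2≤ns long →
  let open Constants (#odd ns) (#even ns) (subst (0 <_) (sym (count-complement (2 ∣?_) ns)) (s≤s z≤n))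
      n = maximum ns
      0<n = ℕ.≤-trans (ℕ.<⇒≤ (2≤ns zero)) (lookup≤maximum ns zero)
      f , small , joined = sparse-joining-graph j n (e + 2) 0<j 0<n 4a≤2^[e+2]
      arrows = arrows-cycles ns n ⌈log₂ (ι n ℚ.* c) ⌉ 0<n long (lookup≤maximum ns) (graphOf (a * n) f) (order≤2^d n)
                 (ℕ.≤-reflexive (trans (sym (ℕ.*-assoc (oddFactor (#odd ns)) (21 ^ #even ns) n)) (cong (_* n) a-eq))) joined
      m , ramsey , m≤ = sizeRamseyNumber-≤ (λ i → cycle (lookup ns i)) zero (λ i → cycle-full (lookup ns i) (2≤ns i)) (graphOf (a * n) f) arrows
  in m , ramsey , ln-bound c {{ramseyConstant>0 (#odd ns) (#even ns)}} X e a n {m} c≤X 2^e≤c 12a²≤5c² (ℕ.≤-trans m≤ small)
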